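{- Let $F$ be a Ferrers shape, $n\ge0$ an integer and $s,t$ positive integers. Then $$N^*(F;n;\mathit{NE}=s,se=t)=N^*(F;n;ne=t,\mathit{SE}=s)$$ and $$N^{01}(F;n;nE=s,\mathit{Se}=t)=N^{01}(F;n;\mathit{Ne}=t,sE=s).$$
   Context: A Ferrers shape (French notation) has columns $1,\dots,m$ from left to right and rows numbered from the bottom, column $j$ consisting of the cells in rows $1,\dots,h_j$, $h_1\ge\dots\ge h_m\ge1$. Chains are sequences of distinct cells with nonzero entries in which each cell is positioned relative to the preceding one as follows: NE-chain: weakly above and weakly right; length = sum of entries. SE-chain: weakly below and weakly right; length = sum of entries. ne-chain: strictly above and strictly right; length = number of cells. se-chain: strictly below and strictly right; length = number of cells. nE-chain: strictly above and weakly right; Ne-chain: weakly above and strictly right; Se-chain: weakly below and strictly right; sE-chain: strictly below and weakly right (these four are used for $0$-$1$-fillings, length = number of cells). For chains going downward to the right (SE, se, Se, sE) only chains whose smallest enclosing rectangle (cells with column between those of the first and last cell and row between those of the first and last cell) is contained in $F$ are considered; for chains going upward to the right this holds automatically. $N^*(F;n;\mathit{NE}=s,se=t)$ is the number of fillings of $F$ with non-negative integers with sum of entries $n$ such that the longest NE-chain has length $s$ and the longest se-chain has length $t$; $N^*(F;n;ne=t,\mathit{SE}=s)$ is defined analogously. $N^{01}(F;n;nE=s,\mathit{Se}=t)$ is the number of $0$-$1$-fillings of $F$ (no restriction on the number of $1$'s per row or column) with exactly $n$ ones such that the longest nE-chain has length $s$ and the longest Se-chain has length $t$; $N^{01}(F;n;\mathit{Ne}=t,sE=s)$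 is defined analogously. -}

module Defs where

open import Data.Bool using (Bool; true; false; _∧_; _∨_; not; if_then_else_)
open import Data.Nat using (ℕ; zero; suc; _+_; _∸_; _≤_; _≥_; _≡ᵇ_; _≤ᵇ_; _<ᵇ_; _⊔_; _⊓_)
open import Data.Product using (_×_; _,_; proj₁; proj₂)
open import Data.List using (List; []; _∷_; length; map; concatMap; filter; upTo; foldr; last)
open import Data.Bool.ListAction using (all; any)
open import Data.Nat.ListAction using (sum)
open import Data.List.Relation.Unary.All using (All)
open import Data.List.Relation.Unary.Linked using (Linked)
open import Data.Maybe using (Maybe; just; nothing)
open import Relation.Nullary.Decidable using (Dec)
open import Data.Bool using (T?)

-- Ferrers shapes (French notation).
-- A shape is the list of column heights h₁ … hₘ (columns left to right),
-- with h₁ ≥ … ≥ hₘ ≥ 1.  Cells are pairs (column , row), 1-indexed,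
-- row counted from the bottom.

Shape : Set
Shape = List ℕ

IsFerrers : Shape → Set
IsFerrers hs = Linked _≥_ hs × All (λ h → 1 ≤ h) hs

Cell : Set
Cell = ℕ × ℕ

nth : {A : Set} → List A → ℕ → A → A
nth []       _       d = d
nth (x ∷ xs) zero    d = x
nth (x ∷ xs) (suc i) d = nth xs i d

-- height of column c (1-indexed); 0 outside the shape
height : Shape → ℕ → ℕ
height hs zero    = 0
height hs (suc c) = nth hs c 0

inF : Shape → Cell → Bool
inF hs (c , r) = (1 ≤ᵇ c) ∧ (c ≤ᵇ length hs) ∧ (1 ≤ᵇ r) ∧ (r ≤ᵇ height hs c)

range : ℕ → ℕ → List ℕ
range a b = map (a +_) (upTo (suc b ∸ a))

cells : Shape → List Cell
cells hs = concatMap (λ c → map (λ r → (c , r)) (range 1 (height hs c))) (range 1 (length hs))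

-- Fillings: a filling of the shape hs is a list of columns, column c being
-- the list of its entries from bottom (row 1) to top (row h_c).

Filling : Set
Filling = List (List ℕ)

entry : Filling → Cell → ℕ
entry f (zero  , _)     = 0
entry f (suc c , zero)  = 0
entry f (suc c , suc r) = nth (nth f c []) r 0

comps : ℕ → ℕ → List (List ℕ)
comps zero    n = if n ≡ᵇ 0 then [] ∷ [] else []
comps (suc k) n = concatMap (λ a → map (a ∷_) (comps k (n ∸ a))) (upTo (suc n))

fillings : Shape → ℕ → List Filling
fillings []       n = if n ≡ᵇ 0 then [] ∷ [] else []
fillings (h ∷ hs) n =
  concatMap (λ a → concatMap (λ col → map (col ∷_) (fillings hs (n ∸ a))) (comps h a))
            (upTo (suc n))

fillings01 : Shape → ℕ → List Filling
fillings01 hs n = filter (λ f → T? (all (all (_≤ᵇ 1)) f)) (fillings hs n)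

_==ᶜ_ : Cell → Cell → Bool
(a , b) ==ᶜ (c , d) = (a ≡ᵇ c) ∧ (b ≡ᵇ d)

distinct : List Cell → Bool
distinct []       = true
distinct (x ∷ xs) = not (any (x ==ᶜ_) xs) ∧ distinct xs

consecutive : (Cell → Cell → Bool) → List Cell → Bool
consecutive R []           = true
consecutive R (x ∷ [])     = true
consecutive R (x ∷ y ∷ xs) = R x y ∧ consecutive R (y ∷ xs)

rectIn : Shape → List Cell → Bool
rectIn hs []               = true
rectIn hs ((c₁ , r₁) ∷ cs) with last ((c₁ , r₁) ∷ cs)
... | nothing        = true
... | just (c₂ , r₂) =
  all (λ c → all (λ r → inF hs (c , r)) (range (r₁ ⊓ r₂) (r₁ ⊔ r₂)))
      (range (c₁ ⊓ c₂) (c₁ ⊔ c₂))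

NEr SEr ner ser nEr Ner Ser sEr : Cell → Cell → Bool
NEr (c , r) (c' , r') = (r ≤ᵇ r') ∧ (c ≤ᵇ c')
SEr (c , r) (c' , r') = (r' ≤ᵇ r) ∧ (c ≤ᵇ c')
ner (c , r) (c' , r') = (r <ᵇ r') ∧ (c <ᵇ c')
ser (c , r) (c' , r') = (r' <ᵇ r) ∧ (c <ᵇ c')
nEr (c , r) (c' , r') = (r <ᵇ r') ∧ (c ≤ᵇ c')
Ner (c , r) (c' , r') = (r ≤ᵇ r') ∧ (c <ᵇ c')
Ser (c , r) (c' , r') = (r' ≤ᵇ r) ∧ (c <ᵇ c')
sEr (c , r) (c' , r') = (r' <ᵇ r) ∧ (c ≤ᵇ c')

-- a chain kind: relation, whether it goes downward (rectangle condition),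
-- and whether length = sum of entries (true) or number of cells (false)
record ChainKind : Set where
  constructor kind
  field
    rel      : Cell → Cell → Bool
    downward : Bool
    weighted : Bool
open ChainKind

NE SE ne se nE Ne Se sE : ChainKind
NE = kind NEr false true
SE = kind SEr true  true
ne = kind ner false false
se = kind ser true  false
nE = kind nEr false false
Ne = kind Ner false false
Se = kind Ser true  false
sE = kind sEr true  false

isChain : ChainKind → Shape → Filling → List Cell → Bool
isChain k hs f cs =
  all (inF hs) cs ∧ all (λ x → not (entry f x ≡ᵇ 0)) cs ∧ distinct cs
  ∧ consecutive (rel k) cs
  ∧ (if downward k then rectIn hs cs else true)

chainLength : ChainKind → Filling → List Cell → ℕ
chainLength k f cs = if weighted k then sum (map (entry f) cs) else length cs

listsUpTo : {A : Set} → ℕ → List A → List (List A)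
listsUpTo zero    xs = [] ∷ []
listsUpTo (suc k) xs = [] ∷ concatMap (λ x → map (x ∷_) (listsUpTo k xs)) xs

-- length of a longest chain of kind k in the filling f of hs.
-- Every chain consists of distinct cells of hs, hence has at most
-- |cells hs| elements, so it occurs among the candidates below.
longest : ChainKind → Shape → Filling → ℕ
longest k hs f =
  foldr _⊔_ 0 (map (chainLength k f)
    (filter (λ cs → T? (isChain k hs f cs)) (listsUpTo (length (cells hs)) (cells hs))))

Nstar : Shape → ℕ → ChainKind → ℕ → ChainKind → ℕ → ℕ
Nstar hs n k₁ s k₂ t =
  length (filter (λ f → T? ((longest k₁ hs f ≡ᵇ s) ∧ (longest k₂ hs f ≡ᵇ t))) (fillings hs n))

N01 : Shape → ℕ → ChainKind → ℕ → ChainKind → ℕ → ℕ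
N01 hs n k₁ s k₂ t =
  length (filter (λ f → T? ((longest k₁ hs f ≡ᵇ s) ∧ (longest k₂ hs f ≡ᵇ t))) (fillings01 hs n))

{-# OPTIONS --safe #-}
module Submission where

-- Number cells and lattice points of F from 0.  For each of the four kinds of chains
-- X ∈ {NE, ne, nE, Ne} let S(x, y) be the longest X-chain in the rectangle of the first
-- x columns and y rows.  S obeys a local rule at every cell, and the defect
-- m′ = m − S(x,y) − S(x+1,y+1) + S(x+1,y) + S(x,y+1) is again a filling.  Let
-- Y ∈ {se, SE, Se, sE} be the complementary kind.  Passing from m to m′ shortens the
-- longest nonempty Y-chain of every rectangle by exactly one, so iterating it yields at
-- each point (x, y) a partition λ(x, y) whose first part is the longest X-chain and whose
-- number of parts is the longest Y-chain of the rectangle.  This is the growth diagram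
-- of the RSK, Burge and dual RSK correspondences, read row by row.
--
-- The local rules are invertible, so the fillings of F correspond bijectively to the
-- sequences of partitions along the boundary of F that start and end with the empty
-- partition and in which neighbours differ by horizontal strips (weak direction of X)
-- or vertical strips (strict direction of X).  Transposing all partitions exchanges the
-- sequences for (NE, se) with those for (ne, SE), and those for (nE, Se) with those for
-- (Ne, sE).  It preserves the sizes of the partitions, hence the column sums.

open import Defs
open import Data.Bool using (Bool; true; false; T; T?; _∧_; not; if_then_else_)
open import Data.Bool.ListAction using (all; any)
open import Data.Bool.Properties using (T-∧)
open import Data.Empty using (⊥; ⊥-elim)
open import Data.List using (List; []; _∷_; _++_; length; map; concatMap; filter; upTo; applyUpTo; foldr; last)
open import Data.List.Membership.Propositional using (_∈_; find)
open import Data.List.Membership.Propositional.Properties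
open import Data.List.Properties using (length-map; length-++; length-applyUpTo)
open import Data.List.Relation.Binary.Disjoint.Propositional using (Disjoint)
open import Data.List.Relation.Binary.Pointwise using (Pointwise; []; _∷_)
open import Data.List.Relation.Unary.All using (All; []; _∷_)
open import Data.List.Relation.Unary.All.Properties using (all⁺; all⁻; applyUpTo⁺₂) renaming (map⁺ to All-map⁺; map⁻ to All-map⁻)
open import Data.List.Relation.Unary.AllPairs using ([]; _∷_)
open import Data.List.Relation.Unary.Any using (here; there)
open import Data.List.Relation.Unary.Any.Properties using (any⁺; any⁻)
open import Data.List.Relation.Unary.Linked using (Linked; []; [-]; _∷_)
open import Data.List.Relation.Unary.Unique.Propositional using (Unique)
open import Data.Maybe using (just)
open import Data.Nat
open import Data.Nat.ListAction using (sum)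
open import Data.Nat.Properties
open import Data.Nat.Solver using (module +-*-Solver)
open import Data.Product using (_×_; _,_; proj₁; proj₂; ∃; ∃₂; swap)
open import Data.Sum using (_⊎_; inj₁; inj₂; map₁; map₂)
open import Data.Unit using (⊤; tt)
open import Function using (_∘_; Equivalence)
open import Relation.Binary.PropositionalEquality
open import Relation.Nullary using (¬_; yes; no)
import Data.List.Relation.Unary.All as All
import Data.List.Relation.Unary.AllPairs as AllPairs
import Data.List.Relation.Unary.AllPairs.Properties as AllPairs
import Data.List.Relation.Unary.Any as Any
import Data.List.Relation.Unary.Linked as Linked
import Data.List.Relation.Unary.Unique.Propositional.Properties as Unique

-- That the passage from m to m′ shortens Y-chains by exactly one has two different proofs. Where
-- Y-chains are counted by cells, the chains of m and m′ interlace: between consecutive cells of one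
-- there is a cell of the other, as otherwise two increasing sides of S would collide. Where they
-- are weighted, for (ne, SE), an SE-chain is seen as part of a lattice path, and the weights of
-- paths for m and m′ are compared by summing the conservation law m + q + r = p + t + m′. The
-- inverse local rules contain subtractions, which are harmless only if consecutive layers
-- interlace. Hence a layer is inverted with the next one at hand, the innermost first. The sizes of
-- the partitions are at most n, so n layers suffice and all partitions lie in an n by n square,
-- which transposing preserves. The rectangle condition makes both statistics maxima over rectangles
-- contained in F. As S is monotone, only rectangles with north-east corner on the boundary matter,
-- and there the partitions of the two fillings are conjugate.

-- Strip conditions and local rules

data Flag : Set where
  weak strict : Flag

data Step (p : ℕ) : ℕ → Set where
  stay : Step p p
  inc  : Step p (suc p)

-- Let p, q be a row and p₂, q₂ the next row of the partitions at the two ends of an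
-- edge.  Edge and Inter say that they differ by a horizontal strip (weak) or by a
-- vertical strip (strict).
Edge : Flag → ℕ → ℕ → Set
Edge weak   p q = p ≤ q
Edge strict p q = Step p q

Inter : Flag → (p q p₂ q₂ : ℕ) → Set
Inter weak   p q p₂ q₂ = q₂ ≤ p
Inter strict p q p₂ q₂ = p₂ ≤ p × q₂ ≤ q

Edge⇒≤ : ∀ f {p q} → Edge f p q → p ≤ q
Edge⇒≤ weak   e    = e
Edge⇒≤ strict stay = ≤-refl
Edge⇒≤ strict inc  = n≤1+n _

Step⇒≤suc : ∀ {p q} → Step p q → q ≤ suc p
Step⇒≤suc stay = n≤1+n _
Step⇒≤suc inc  = ≤-refl

Edge-refl : ∀ f {p} → Edge f p p
Edge-refl weak   = ≤-refl
Edge-refl strict = stay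

Inter-0 : ∀ f → Inter f 0 0 0 0
Inter-0 weak   = z≤n
Inter-0 strict = z≤n , z≤n

Inter⇒≤ʳ : ∀ f {p q p₂ q₂} → Edge f p q → Inter f p q p₂ q₂ → q₂ ≤ q
Inter⇒≤ʳ weak   e i       = ≤-trans i e
Inter⇒≤ʳ strict e (_ , i) = i

-- A chain ending in a cell has its other cells in a rectangle whose north-east corner
-- is one of these corners of the cell.
data Source : Set where
  sw se′ nw : Source

source : Source → ℕ → ℕ → ℕ → ℕ
source sw  p q r = p
source se′ p q r = q
source nw  p q r = r

IsSource : Flag → Flag → Source → Set
IsSource strict strict sw  = ⊤
IsSource weak   _      se′ = ⊤
IsSource _      weak   nw  = ⊤
IsSource _      _      _   = ⊥

isWeighted : Flag → Flag → Bool
isWeighted weak weak = true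
isWeighted _    _    = false

[_>0] : ℕ → ℕ
[ zero  >0] = 0
[ suc _ >0] = 1

weight : Bool → ℕ → ℕ
weight true  m = m
weight false m = [ m >0]

-- In Loc p q r t m m′ the values of S at the south-west, south-east, north-west and
-- north-east corners of a cell are p, q, r, t, its entry is m, and its entry in the
-- next layer is m′.  The subscript 2 in backward and inter refers to the next layer.
record Rule : Set₁ where
  field
    hf vf : Flag
    M     : ℕ → Set
    Loc   : (p q r t m m′ : ℕ) → Set
    up carry dn ent : ℕ → ℕ → ℕ → ℕ → ℕ
    M-0  : M 0
    up-0 : up 0 0 0 0 ≡ 0
    forward : ∀ {p q r m} → Edge hf p q → Edge vf p r → M m →
              Loc p q r (up p q r m) m (carry p q r m)
    backward : ∀ {q r t m′ p₂ q₂ r₂ t₂ m″} → Loc p₂ q₂ r₂ t₂ m′ m″ →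
               Edge hf r t → Edge vf q t → Inter hf r t r₂ t₂ → Inter vf q t q₂ t₂ →
               let p = dn q r t m′ in
               Loc p q r t (ent q r t m′) m′ × Inter hf p q p₂ q₂ × Inter vf p r p₂ r₂
    up-≡    : ∀ {p q r t m m′} → Loc p q r t m m′ → up p q r m ≡ t
    carry-≡ : ∀ {p q r t m m′} → Loc p q r t m m′ → carry p q r m ≡ m′
    dn-≡    : ∀ {p q r t m m′} → Loc p q r t m m′ → dn q r t m′ ≡ p
    ent-≡   : ∀ {p q r t m m′} → Loc p q r t m m′ → ent q r t m′ ≡ m
    edge-S  : ∀ {p q r t m m′} → Loc p q r t m m′ → Edge hf p q
    edge-W  : ∀ {p q r t m m′} → Loc p q r t m m′ → Edge vf p r
    edge-N  : ∀ {p q r t m m′} → Loc p q r t m m′ → Edge hf r t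
    edge-E  : ∀ {p q r t m m′} → Loc p q r t m m′ → Edge vf q t
    M-ent   : ∀ {p q r t m m′} → Loc p q r t m m′ → M m
    M-carry : ∀ {p q r t m m′} → Loc p q r t m m′ → M m′
    conserve : ∀ {p q r t m m′} → Loc p q r t m m′ → m + (q + r) ≡ (p + t) + m′
    inter : ∀ {p q r t m m′ p₂ q₂ r₂ t₂ m″} → Loc p q r t m m′ → Loc p₂ q₂ r₂ t₂ m′ m″ →
            Inter hf p q p₂ q₂ → Inter vf p r p₂ r₂ →
            Inter hf r t r₂ t₂ × Inter vf q t q₂ t₂
    source-≤ : ∀ {p q r t m m′} s → Loc p q r t m m′ → 0 < m → IsSource hf vf s →
               source s p q r + weight (isWeighted hf vf) m ≤ t
    source-≡ : ∀ {p q r t m m′} → Loc p q r t m m′ → t ≡ q ⊎ t ≡ r ⊎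
               (0 < m × ∃ λ s → IsSource hf vf s ×
                                t ≡ source s p q r + weight (isWeighted hf vf) m)

flipSource : Source → Source
flipSource sw  = sw
flipSource se′ = nw
flipSource nw  = se′

source-flip : ∀ s p q r → source (flipSource s) p q r ≡ source s p r q
source-flip sw  p q r = refl
source-flip se′ p q r = refl
source-flip nw  p q r = refl

IsSource-flip : ∀ f g s → IsSource f g s → IsSource g f (flipSource s)
IsSource-flip strict strict sw  _ = tt
IsSource-flip weak   weak   se′ _ = tt
IsSource-flip weak   strict se′ _ = tt
IsSource-flip weak   weak   nw  _ = tt
IsSource-flip strict weak   nw  _ = tt

isWeighted-comm : ∀ f g → isWeighted f g ≡ isWeighted g f
isWeighted-comm weak   weak   = refl
isWeighted-comm weak   strict = refl
isWeighted-comm strict weak   = refl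
isWeighted-comm strict strict = refl

flipRule : Rule → Rule
flipRule R = record
  { hf = vf ; vf = hf ; M = M
  ; Loc = λ p q r → Loc p r q
  ; up = λ p q r → up p r q ; carry = λ p q r → carry p r q
  ; dn = λ q r → dn r q ; ent = λ q r → ent r q
  ; M-0 = M-0 ; up-0 = up-0
  ; forward = λ e f → forward f e
  ; backward = λ l e f i j → let x , y , z = backward l f e j i in x , z , y
  ; up-≡ = up-≡ ; carry-≡ = carry-≡ ; dn-≡ = dn-≡ ; ent-≡ = ent-≡
  ; edge-S = edge-W ; edge-W = edge-S ; edge-N = edge-E ; edge-E = edge-N
  ; M-ent = M-ent ; M-carry = M-carry
  ; conserve = λ {p} {q} {r} {t} {m} l → trans (cong (m +_) (+-comm q r)) (conserve l)
  ; inter = λ l l₂ i j → swap (inter l l₂ j i)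
  ; source-≤ = λ {p} {q} {r} {t} {m} s l m>0 i →
      subst₂ (λ v w → v + weight w m ≤ t)
        (source-flip s p r q) (isWeighted-comm hf vf)
        (source-≤ (flipSource s) l m>0 (IsSource-flip vf hf s i))
  ; source-≡ = λ {p} {q} {r} {t} {m} l → flip-≡ {p} {q} {r} {t} {m} (source-≡ l)
  }
  where
  open Rule R
  flip-≡ : ∀ {p q r t m} →
           t ≡ r ⊎ t ≡ q ⊎ (0 < m × ∃ λ s → IsSource hf vf s ×
                                t ≡ source s p r q + weight (isWeighted hf vf) m) →
           t ≡ q ⊎ t ≡ r ⊎ (0 < m × ∃ λ s → IsSource vf hf s ×
                                t ≡ source s p q r + weight (isWeighted vf hf) m)
  flip-≡ (inj₁ e) = inj₂ (inj₁ e)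
  flip-≡ (inj₂ (inj₁ e)) = inj₁ e
  flip-≡ {p} {q} {r} {t} {m} (inj₂ (inj₂ (m>0 , s , i , e))) =
    inj₂ (inj₂ (m>0 , flipSource s , IsSource-flip hf vf s i ,
      trans e (cong₂ (λ v w → v + weight w m)
        (sym (source-flip s p q r)) (isWeighted-comm hf vf))))

-- The rule for (NE, se)

-- Fomin's growth rule for RSK restricted to first rows: the excess of the smaller of `q` and `r`
-- over `p` is handed to the second row. `c-≡` is written as an addition, so that no truncated
-- subtraction occurs.
record Loc₁ (p q r t m m′ : ℕ) : Set where
  constructor loc₁
  field
    p≤q : p ≤ q
    p≤r : p ≤ r
    t-≡ : t ≡ q ⊔ r + m
    c-≡ : m′ + p ≡ q ⊓ r

⊔+⊓ : ∀ q r → q ⊔ r + q ⊓ r ≡ q + r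
⊔+⊓ q r with ≤-total q r
... | inj₁ q≤r rewrite m≤n⇒m⊔n≡n q≤r | m≤n⇒m⊓n≡m q≤r = +-comm r q
... | inj₂ r≤q rewrite m≥n⇒m⊔n≡m r≤q | m≥n⇒m⊓n≡n r≤q = refl

rule₁ : Rule
rule₁ = record
  { hf = weak ; vf = weak ; M = λ _ → ⊤ ; Loc = Loc₁
  ; up = λ p q r m → q ⊔ r + m ; carry = λ p q r m → q ⊓ r ∸ p
  ; dn = λ q r t m′ → q ⊓ r ∸ m′ ; ent = λ q r t m′ → t ∸ (q ⊔ r)
  ; M-0 = tt ; up-0 = refl
  ; forward = λ e f _ → loc₁ e f refl (m∸n+n≡m (⊓-glb e f))
  ; backward = λ {q} {r} → back {q} {r}
  ; up-≡ = λ { (loc₁ _ _ e _) → sym e }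
  ; carry-≡ = λ { {p} {q} {r} {t} {m} {m′} (loc₁ _ _ _ e) → trans (cong (_∸ p) (sym e)) (m+n∸n≡m m′ p) }
  ; dn-≡ = λ { {p} {q} {r} {t} {m} {m′} (loc₁ _ _ _ e) → trans (cong (_∸ m′) (sym e)) (m+n∸m≡n m′ p) }
  ; ent-≡ = λ { {p} {q} {r} {t} {m} (loc₁ _ _ e _) → trans (cong (_∸ (q ⊔ r)) e) (m+n∸m≡n (q ⊔ r) m) }
  ; edge-S = Loc₁.p≤q ; edge-W = Loc₁.p≤r
  ; edge-N = λ { {p} {q} {r} (loc₁ _ _ refl _) → ≤-trans (m≤n⊔m q r) (m≤m+n _ _) }
  ; edge-E = λ { {p} {q} {r} (loc₁ _ _ refl _) → ≤-trans (m≤m⊔n q r) (m≤m+n _ _) }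
  ; M-ent = λ _ → tt ; M-carry = λ _ → tt
  ; conserve = cons
  ; inter = int
  ; source-≤ = src≤
  ; source-≡ = src≡
  }
  where
  open ≡-Reasoning
  -- Interlacing gives `q₂ ⊔ r₂ + m′ ≤ q ⊓ r`. So the subtraction of `m′` does not truncate, and
  -- what is left still dominates `q₂` and `r₂`.
  back : ∀ {q r t m′ p₂ q₂ r₂ t₂ m″} → Loc₁ p₂ q₂ r₂ t₂ m′ m″ → r ≤ t → q ≤ t → t₂ ≤ r → t₂ ≤ q →
         Loc₁ (q ⊓ r ∸ m′) q r t (t ∸ (q ⊔ r)) m′ × q₂ ≤ q ⊓ r ∸ m′ × r₂ ≤ q ⊓ r ∸ m′
  back {q} {r} {t} {m′} {p₂} {q₂} {r₂} (loc₁ _ _ refl _) r≤t q≤t i j =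
    loc₁ (≤-trans (m∸n≤m _ m′) (m⊓n≤m q r)) (≤-trans (m∸n≤m _ m′) (m⊓n≤n q r))
         (sym (m+[n∸m]≡n (⊔-lub q≤t r≤t))) (m+[n∸m]≡n (m+n≤o⇒n≤o (q₂ ⊔ r₂) t₂≤)) ,
    ≤-trans (m≤m⊔n q₂ r₂) (m+n≤o⇒m≤o∸n _ t₂≤) , ≤-trans (m≤n⊔m q₂ r₂) (m+n≤o⇒m≤o∸n _ t₂≤)
    where
    t₂≤ : q₂ ⊔ r₂ + m′ ≤ q ⊓ r
    t₂≤ = ⊓-glb j i
  cons : ∀ {p q r t m m′} → Loc₁ p q r t m m′ → m + (q + r) ≡ (p + t) + m′
  cons {p} {q} {r} {t} {m} {m′} (loc₁ _ _ refl e) = begin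
    m + (q + r)               ≡⟨ cong (m +_) (sym (⊔+⊓ q r)) ⟩
    m + ((q ⊔ r) + (q ⊓ r))   ≡⟨ cong (λ z → m + (q ⊔ r + z)) (sym e) ⟩
    m + ((q ⊔ r) + (m′ + p))  ≡⟨ sym (+-assoc m _ _) ⟩
    (m + (q ⊔ r)) + (m′ + p)  ≡⟨ cong₂ _+_ (+-comm m (q ⊔ r)) (+-comm m′ p) ⟩
    (q ⊔ r + m) + (p + m′)    ≡⟨ sym (+-assoc _ p m′) ⟩
    ((q ⊔ r + m) + p) + m′    ≡⟨ cong (_+ m′) (+-comm _ p) ⟩
    (p + (q ⊔ r + m)) + m′    ∎
  int : ∀ {p q r t m m′ p₂ q₂ r₂ t₂ m″} → Loc₁ p q r t m m′ → Loc₁ p₂ q₂ r₂ t₂ m′ m″ →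
        q₂ ≤ p → r₂ ≤ p → t₂ ≤ r × t₂ ≤ q
  int {p} {q} {r} {m′ = m′} {q₂ = q₂} {r₂} (loc₁ _ _ refl e) (loc₁ _ _ refl _) i j =
    ≤-trans t₂≤ (m⊓n≤n q r) , ≤-trans t₂≤ (m⊓n≤m q r)
    where
    t₂≤ : q₂ ⊔ r₂ + m′ ≤ q ⊓ r
    t₂≤ = ≤-trans (+-monoˡ-≤ m′ (⊔-lub i j)) (≤-reflexive (trans (+-comm p m′) e))
  src≤ : ∀ {p q r t m m′} s → Loc₁ p q r t m m′ → 0 < m → IsSource weak weak s → source s p q r + m ≤ t
  src≤ {p} {q} {r} {m = m} se′ (loc₁ _ _ refl _) _ _ = +-monoˡ-≤ m (m≤m⊔n q r)
  src≤ {p} {q} {r} {m = m} nw  (loc₁ _ _ refl _) _ _ = +-monoˡ-≤ m (m≤n⊔m q r)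
  src≡ : ∀ {p q r t m m′} → Loc₁ p q r t m m′ → t ≡ q ⊎ t ≡ r ⊎
         (0 < m × ∃ λ s → IsSource weak weak s × t ≡ source s p q r + m)
  src≡ {p} {q} {r} {m = zero} (loc₁ _ _ refl _) with ⊔-sel q r
  ... | inj₁ e = inj₁ (trans (+-identityʳ _) e)
  ... | inj₂ e = inj₂ (inj₁ (trans (+-identityʳ _) e))
  src≡ {p} {q} {r} {m = suc m} (loc₁ _ _ refl _) with ⊔-sel q r
  ... | inj₁ e = inj₂ (inj₂ (z<s , se′ , tt , cong (_+ suc m) e))
  ... | inj₂ e = inj₂ (inj₂ (z<s , nw , tt , cong (_+ suc m) e))

-- The rule for (ne, SE)

-- The Burge rule on first rows: the value rises by at most one across a cell. A `fresh` cell spends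
-- one unit of its entry on the rise; in `both` two rises meet, and the surplus unit is added to
-- what is carried.
data Loc₂ : (p q r t m m′ : ℕ) → Set where
  none  : ∀ {p}   → Loc₂ p p p p 0 0
  fresh : ∀ {p m} → Loc₂ p p p (suc p) (suc m) m
  east  : ∀ {p m} → Loc₂ p (suc p) p (suc p) m m
  north : ∀ {p m} → Loc₂ p p (suc p) (suc p) m m
  both  : ∀ {p m} → Loc₂ p (suc p) (suc p) (suc p) m (suc m)

-- `carry₂` and `ent₂` solve the conservation law for its one unknown term, so their correctness
-- needs no case analysis of its own.
up₂ carry₂ dn₂ ent₂ : ℕ → ℕ → ℕ → ℕ → ℕ
up₂    p q r m  = q ⊔ r ⊔ (p + [ m >0])
carry₂ p q r m  = (m + (q + r)) ∸ (p + up₂ p q r m)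
dn₂    q r t m′ = q ⊓ r ⊓ (t ∸ [ m′ >0])
ent₂   q r t m′ = ((dn₂ q r t m′ + t) + m′) ∸ (q + r)

-- `up₂` commutes with adding 1 to `p`, `q` and `r`, so only `p` = 0 has to be evaluated.
loc₂-up : ∀ {p q r t m m′} → Loc₂ p q r t m m′ → up₂ p q r m ≡ t
loc₂-up {zero} none  = refl
loc₂-up {zero} fresh = refl
loc₂-up {zero} (east  {m = zero})  = refl
loc₂-up {zero} (east  {m = suc m}) = refl
loc₂-up {zero} (north {m = zero})  = refl
loc₂-up {zero} (north {m = suc m}) = refl
loc₂-up {zero} (both  {m = zero})  = refl
loc₂-up {zero} (both  {m = suc m}) = refl
loc₂-up {suc p} none  = cong suc (loc₂-up {p} none)
loc₂-up {suc p} (fresh {m = m}) = cong suc (loc₂-up {p} (fresh {m = m}))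
loc₂-up {suc p} (east  {m = m}) = cong suc (loc₂-up {p} (east {m = m}))
loc₂-up {suc p} (north {m = m}) = cong suc (loc₂-up {p} (north {m = m}))
loc₂-up {suc p} (both  {m = m}) = cong suc (loc₂-up {p} (both {m = m}))

loc₂-dn : ∀ {p q r t m m′} → Loc₂ p q r t m m′ → dn₂ q r t m′ ≡ p
loc₂-dn {zero} none  = refl
loc₂-dn {zero} fresh = refl
loc₂-dn {zero} east  = refl
loc₂-dn {zero} north = refl
loc₂-dn {zero} both  = refl
loc₂-dn {suc p} none  = cong suc (loc₂-dn {p} none)
loc₂-dn {suc p} (fresh {m = zero}) = cong suc (loc₂-dn {p} (fresh {m = zero}))
loc₂-dn {suc p} (fresh {m = suc m}) = cong suc (loc₂-dn {p} (fresh {m = suc m}))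
loc₂-dn {suc p} (east  {m = zero}) = cong suc (loc₂-dn {p} (east {m = zero}))
loc₂-dn {suc p} (east  {m = suc m}) = cong suc (loc₂-dn {p} (east {m = suc m}))
loc₂-dn {suc p} (north {m = zero}) = cong suc (loc₂-dn {p} (north {m = zero}))
loc₂-dn {suc p} (north {m = suc m}) = cong suc (loc₂-dn {p} (north {m = suc m}))
loc₂-dn {suc p} (both  {m = m}) = cong suc (loc₂-dn {p} (both {m = m}))

loc₂-conserve : ∀ {p q r t m m′} → Loc₂ p q r t m m′ → m + (q + r) ≡ (p + t) + m′
loc₂-conserve {p} none = sym (+-identityʳ _)
loc₂-conserve {p} (fresh {m = m}) = trans (+-comm (suc m) _) (trans (+-suc (p + p) m) (cong (_+ m) (sym (+-suc p p))))
loc₂-conserve {p} (east  {m = m}) = trans (+-comm m _) (cong (_+ m) (sym (+-suc p p)))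
loc₂-conserve {p} (north {m = m}) = +-comm m _
loc₂-conserve {p} (both  {m = m}) = trans (+-comm m _) (sym (+-suc (p + suc p) m))

loc₂-carry : ∀ {p q r t m m′} → Loc₂ p q r t m m′ → carry₂ p q r m ≡ m′
loc₂-carry {p} {q} {r} {t} {m} {m′} l = trans
  (cong₂ _∸_ (loc₂-conserve l) (cong (p +_) (loc₂-up l))) (m+n∸m≡n (p + t) m′)

loc₂-ent : ∀ {p q r t m m′} → Loc₂ p q r t m m′ → ent₂ q r t m′ ≡ m
loc₂-ent {p} {q} {r} {t} {m} {m′} l = trans
  (cong (_∸ (q + r)) (trans (cong (λ z → (z + t) + m′) (loc₂-dn l)) (sym (loc₂-conserve l)))) (m+n∸n≡m m (q + r))

rule₂ : Rule
rule₂ = record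
  { hf = strict ; vf = strict ; M = λ _ → ⊤ ; Loc = Loc₂
  ; up = up₂ ; carry = carry₂ ; dn = dn₂ ; ent = ent₂
  ; M-0 = tt ; up-0 = refl
  ; forward = λ e f _ → fw e f
  ; backward = bw
  ; up-≡ = loc₂-up ; carry-≡ = loc₂-carry ; dn-≡ = loc₂-dn ; ent-≡ = loc₂-ent
  ; edge-S = λ { none → stay ; fresh → stay ; east → inc ; north → stay ; both → inc }
  ; edge-W = λ { none → stay ; fresh → stay ; east → stay ; north → inc ; both → inc }
  ; edge-N = λ { none → stay ; fresh → inc ; east → inc ; north → stay ; both → stay }
  ; edge-E = λ { none → stay ; fresh → inc ; east → stay ; north → inc ; both → stay }
  ; M-ent = λ _ → tt ; M-carry = λ _ → tt
  ; conserve = loc₂-conserve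
  ; inter = λ l l₂ (h , i) (_ , j) → (j , int l l₂ h i j) , (i , int l l₂ h i j)
  ; source-≤ = src≤
  ; source-≡ = src≡
  }
  where
  fw′ : ∀ {p q r t m m′} → Loc₂ p q r t m m′ → Loc₂ p q r (up₂ p q r m) m (carry₂ p q r m)
  fw′ {p} {q} {r} {t} {m} l = subst₂ (λ t m′ → Loc₂ p q r t m m′) (sym (loc₂-up l)) (sym (loc₂-carry l)) l
  bw′ : ∀ {p q r t m m′} → Loc₂ p q r t m m′ → Loc₂ (dn₂ q r t m′) q r t (ent₂ q r t m′) m′
  bw′ {p} {q} {r} {t} {m} {m′} l = subst₂ (λ p m → Loc₂ p q r t m m′) (sym (loc₂-dn l)) (sym (loc₂-ent l)) l
  fw : ∀ {p q r m} → Step p q → Step p r → Loc₂ p q r (up₂ p q r m) m (carry₂ p q r m)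
  fw {m = zero}  stay stay = fw′ none
  fw {m = suc m} stay stay = fw′ fresh
  fw inc stay = fw′ east
  fw stay inc = fw′ north
  fw inc inc  = fw′ both
  W≤ : ∀ {p q r t m m′} → Loc₂ p q r t m m′ → p ≤ r
  W≤ none  = ≤-refl
  W≤ fresh = ≤-refl
  W≤ east  = ≤-refl
  W≤ north = n≤1+n _
  W≤ both  = n≤1+n _
  S≤ : ∀ {p q r t m m′} → Loc₂ p q r t m m′ → p ≤ q
  S≤ none  = ≤-refl
  S≤ fresh = ≤-refl
  S≤ east  = n≤1+n _
  S≤ north = ≤-refl
  S≤ both  = n≤1+n _
  suc≤ : ∀ {p q r t m m′} → Loc₂ p q r t (suc m) m′ → suc p ≤ t
  suc≤ fresh = ≤-refl
  suc≤ east  = ≤-refl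
  suc≤ north = ≤-refl
  suc≤ both  = ≤-refl
  bw : ∀ {q r t m′ p₂ q₂ r₂ t₂ m″} → Loc₂ p₂ q₂ r₂ t₂ m′ m″ → Step r t → Step q t →
       r₂ ≤ r × t₂ ≤ t → q₂ ≤ q × t₂ ≤ t → let p = dn₂ q r t m′ in
       Loc₂ p q r t (ent₂ q r t m′) m′ × (p₂ ≤ p × q₂ ≤ q) × (p₂ ≤ p × r₂ ≤ r)
  bw {q} {r} {t} {m′} {p₂} {q₂} {r₂} {t₂} l₂ e f (i , k) (j , _) = go l₂ e f
    where
    fin : ∀ {p m} → Loc₂ p q r t m m′ → p₂ ≤ p → let p = dn₂ q r t m′ in
          Loc₂ p q r t (ent₂ q r t m′) m′ × (p₂ ≤ p × q₂ ≤ q) × (p₂ ≤ p × r₂ ≤ r)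
    fin {p} {m} l x = bw′ l , (x′ , j) , (x′ , i)
      where x′ = ≤-trans x (≤-reflexive (sym (loc₂-dn l)))
    -- The steps into the north-east corner determine the constructor unless both are `stay`; then
    -- `none` and `both` are told apart by whether `m′` is zero.
    go : ∀ {m″} → Loc₂ p₂ q₂ r₂ t₂ m′ m″ → Step r t → Step q t → let p = dn₂ q r t m′ in
         Loc₂ p q r t (ent₂ q r t m′) m′ × (p₂ ≤ p × q₂ ≤ q) × (p₂ ≤ p × r₂ ≤ r)
    go l₂ stay stay = zs m′ refl t refl
      where
      zs : ∀ k → m′ ≡ k → ∀ u → t ≡ u → let p = dn₂ q r t m′ in
           Loc₂ p q r t (ent₂ q r t m′) m′ × (p₂ ≤ p × q₂ ≤ q) × (p₂ ≤ p × r₂ ≤ r)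
      zs zero    refl _       refl = fin none (≤-trans (S≤ l₂) j)
      -- A positive entry of the next layer makes `t₂` positive, and `t₂ ≤ t` by interlacing.
      zs (suc _) refl zero    refl = ⊥-elim (n≮0 (≤-trans (suc≤ l₂) k))
      zs (suc _) refl (suc u) refl = fin both (s≤s⁻¹ (≤-trans (suc≤ l₂) k))
    go l₂ inc  stay = fin east (≤-trans (W≤ l₂) i)
    go l₂ stay inc  = fin north (≤-trans (S≤ l₂) j)
    go l₂ inc  inc  = fin fresh (≤-trans (S≤ l₂) j)
  t≤ : ∀ {p q r t m m′} → Loc₂ p q r t m m′ → q ≤ t × r ≤ t
  t≤ none  = ≤-refl , ≤-refl
  t≤ fresh = n≤1+n _ , n≤1+n _
  t≤ east  = ≤-refl , n≤1+n _
  t≤ north = n≤1+n _ , ≤-refl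
  t≤ both  = ≤-refl , ≤-refl
  int : ∀ {p q r t m m′ p₂ q₂ r₂ t₂ m″} → Loc₂ p q r t m m′ → Loc₂ p₂ q₂ r₂ t₂ m′ m″ →
        p₂ ≤ p → q₂ ≤ q → r₂ ≤ r → t₂ ≤ t
  int l none  _ i j = ≤-trans i (proj₁ (t≤ l))
  int fresh fresh h i j = s≤s h
  int east  fresh h i j = s≤s h
  int north fresh h i j = s≤s h
  int both  fresh h i j = s≤s h
  int l east  _ i j = ≤-trans i (proj₁ (t≤ l))
  int l north _ i j = ≤-trans j (proj₂ (t≤ l))
  int l both  _ i j = ≤-trans i (proj₁ (t≤ l))
  src≤ : ∀ {p q r t m m′} s → Loc₂ p q r t m m′ → 0 < m → IsSource strict strict s →
         source s p q r + [ m >0] ≤ t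
  src≤ {p} {m = suc m} sw l _ _ = ≤-trans (≤-reflexive (+-comm p 1)) (suc≤ l)
  src≡ : ∀ {p q r t m m′} → Loc₂ p q r t m m′ → t ≡ q ⊎ t ≡ r ⊎
         (0 < m × ∃ λ s → IsSource strict strict s × t ≡ source s p q r + [ m >0])
  src≡ none  = inj₁ refl
  src≡ {p} fresh = inj₂ (inj₂ (z<s , sw , tt , +-comm 1 p))
  src≡ east  = inj₁ refl
  src≡ north = inj₂ (inj₁ refl)
  src≡ both  = inj₁ refl

-- The rule for (nE, Se)

-- The dual RSK rule on first rows. The name records the west side (`flat` for `r = p`, `tall` for
-- `r = p + 1`), the subscript the entry. Plain `tall` is the case `p = q` without an entry, the
-- only tall one in which nothing is carried.
data Loc₃ : (p q r t m m′ : ℕ) → Set where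
  flat₀ : ∀ {p q} → p ≤ q → Loc₃ p q p q 0 0
  flat₁ : ∀ {p q} → p ≤ q → Loc₃ p q p (suc q) 1 0
  tall  : ∀ {p}   → Loc₃ p p (suc p) (suc p) 0 0
  tall₀ : ∀ {p q} → suc p ≤ q → Loc₃ p q (suc p) q 0 1
  tall₁ : ∀ {p q} → p ≤ q → Loc₃ p q (suc p) (suc q) 1 1

up₃ carry₃ dn₃ ent₃ : ℕ → ℕ → ℕ → ℕ → ℕ
up₃    p q r m  = r ⊔ (q + m)
carry₃ p q r m  = r ⊓ (q + m) ∸ p
dn₃    q r t m′ = q ⊓ (r ∸ m′)
ent₃   q r t m′ = t ∸ (q ⊔ (r ∸ m′))

loc₃-up : ∀ {p q r t m m′} → Loc₃ p q r t m m′ → up₃ p q r m ≡ t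
loc₃-up {p} {q} (flat₀ i) rewrite +-identityʳ q = m≤n⇒m⊔n≡n i
loc₃-up {p} {q} (flat₁ i) rewrite +-comm q 1 = m≤n⇒m⊔n≡n (m≤n⇒m≤1+n i)
loc₃-up {p} {q} tall rewrite +-identityʳ p = m≥n⇒m⊔n≡m (n≤1+n p)
loc₃-up {p} {q} (tall₀ i) rewrite +-identityʳ q = m≤n⇒m⊔n≡n i
loc₃-up {p} {q} (tall₁ i) rewrite +-comm q 1 = m≤n⇒m⊔n≡n (s≤s i)

loc₃-carry : ∀ {p q r t m m′} → Loc₃ p q r t m m′ → carry₃ p q r m ≡ m′
loc₃-carry {p} {q} (flat₀ i) rewrite +-identityʳ q | m≤n⇒m⊓n≡m i = n∸n≡0 p
loc₃-carry {p} {q} (flat₁ i) rewrite +-comm q 1 | m≤n⇒m⊓n≡m (m≤n⇒m≤1+n i) = n∸n≡0 p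
loc₃-carry {p} {q} tall rewrite +-identityʳ p | m≥n⇒m⊓n≡n (n≤1+n p) = n∸n≡0 p
loc₃-carry {p} {q} (tall₀ i) rewrite +-identityʳ q | m≤n⇒m⊓n≡m i = m+n∸n≡m 1 p
loc₃-carry {p} {q} (tall₁ i) rewrite +-comm q 1 | m≤n⇒m⊓n≡m i = m+n∸n≡m 1 p

loc₃-dn : ∀ {p q r t m m′} → Loc₃ p q r t m m′ → dn₃ q r t m′ ≡ p
loc₃-dn (flat₀ i) = m≥n⇒m⊓n≡n i
loc₃-dn (flat₁ i) = m≥n⇒m⊓n≡n i
loc₃-dn {p} tall = m≤n⇒m⊓n≡m (n≤1+n p)
loc₃-dn (tall₀ i) = m≥n⇒m⊓n≡n (<⇒≤ i)
loc₃-dn (tall₁ i) = m≥n⇒m⊓n≡n i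

loc₃-ent : ∀ {p q r t m m′} → Loc₃ p q r t m m′ → ent₃ q r t m′ ≡ m
loc₃-ent {p} {q} (flat₀ i) rewrite m≥n⇒m⊔n≡m i = n∸n≡0 q
loc₃-ent {p} {q} (flat₁ i) rewrite m≥n⇒m⊔n≡m i = m+n∸n≡m 1 q
loc₃-ent {p} {q} tall rewrite m≤n⇒m⊔n≡n (n≤1+n p) = n∸n≡0 p
loc₃-ent {p} {q} (tall₀ i) rewrite m≥n⇒m⊔n≡m (<⇒≤ i) = n∸n≡0 q
loc₃-ent {p} {q} (tall₁ i) rewrite m≥n⇒m⊔n≡m i = m+n∸n≡m 1 q

loc₃-conserve : ∀ {p q r t m m′} → Loc₃ p q r t m m′ → m + (q + r) ≡ (p + t) + m′
loc₃-conserve {p} {q} (flat₀ i) = trans (+-comm q p) (sym (+-identityʳ _))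
loc₃-conserve {p} {q} (flat₁ i) = trans (+-comm (suc q) p) (sym (+-identityʳ _))
loc₃-conserve {p} {q} tall = sym (+-identityʳ _)
loc₃-conserve {p} {q} (tall₀ i) = trans (+-suc q p) (trans (cong suc (+-comm q p)) (+-comm 1 _))
loc₃-conserve {p} {q} (tall₁ i) = trans (cong suc (+-suc q p)) (trans (cong suc (+-comm (suc q) p)) (+-comm 1 _))

rule₃ : Rule
rule₃ = record
  { hf = weak ; vf = strict ; M = λ m → m ≤ 1 ; Loc = Loc₃
  ; up = up₃ ; carry = carry₃ ; dn = dn₃ ; ent = ent₃
  ; M-0 = z≤n ; up-0 = refl
  ; forward = fw
  ; backward = bw
  ; up-≡ = loc₃-up ; carry-≡ = loc₃-carry ; dn-≡ = loc₃-dn ; ent-≡ = loc₃-ent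
  ; edge-S = S≤
  ; edge-W = λ { (flat₀ _) → stay ; (flat₁ _) → stay ; tall → inc ; (tall₀ _) → inc ; (tall₁ _) → inc }
  ; edge-N = N≤
  ; edge-E = λ { (flat₀ _) → stay ; (flat₁ _) → inc ; tall → inc ; (tall₀ _) → stay ; (tall₁ _) → inc }
  ; M-ent   = λ { (flat₀ _) → z≤n ; (flat₁ _) → ≤-refl ; tall → z≤n ; (tall₀ _) → z≤n ; (tall₁ _) → ≤-refl }
  ; M-carry = λ { (flat₀ _) → z≤n ; (flat₁ _) → z≤n ; tall → z≤n ; (tall₀ _) → ≤-refl ; (tall₁ _) → ≤-refl }
  ; conserve = loc₃-conserve
  ; inter = int
  ; source-≤ = src≤
  ; source-≡ = src≡
  }
  where
  fw′ : ∀ {p q r t m m′} → Loc₃ p q r t m m′ → Loc₃ p q r (up₃ p q r m) m (carry₃ p q r m)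
  fw′ {p} {q} {r} {t} {m} l = subst₂ (λ t m′ → Loc₃ p q r t m m′) (sym (loc₃-up l)) (sym (loc₃-carry l)) l
  fw : ∀ {p q r m} → p ≤ q → Step p r → m ≤ 1 → Loc₃ p q r (up₃ p q r m) m (carry₃ p q r m)
  fw i stay z≤n = fw′ (flat₀ i)
  fw i stay (s≤s z≤n) = fw′ (flat₁ i)
  fw i inc (s≤s z≤n) = fw′ (tall₁ i)
  fw i inc z≤n with m≤n⇒m<n∨m≡n i
  ... | inj₁ i<    = fw′ (tall₀ i<)
  ... | inj₂ refl = fw′ tall
  S≤ : ∀ {p q r t m m′} → Loc₃ p q r t m m′ → p ≤ q
  S≤ (flat₀ i) = i
  S≤ (flat₁ i) = i
  S≤ tall = ≤-refl
  S≤ (tall₀ i) = <⇒≤ i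
  S≤ (tall₁ i) = i
  N≤ : ∀ {p q r t m m′} → Loc₃ p q r t m m′ → r ≤ t
  N≤ (flat₀ i) = i
  N≤ (flat₁ i) = m≤n⇒m≤1+n i
  N≤ tall = ≤-refl
  N≤ (tall₀ i) = i
  N≤ (tall₁ i) = s≤s i
  pos : ∀ {p q r t m m′} → Loc₃ p q r t (suc m) m′ → suc q ≤ t
  pos (flat₁ i) = ≤-refl
  pos (tall₁ i) = ≤-refl
  bw : ∀ {q r t m′ p₂ q₂ r₂ t₂ m″} → Loc₃ p₂ q₂ r₂ t₂ m′ m″ → r ≤ t → Step q t →
       t₂ ≤ r → q₂ ≤ q × t₂ ≤ t → let p = dn₃ q r t m′ in
       Loc₃ p q r t (ent₃ q r t m′) m′ × q₂ ≤ p × (p₂ ≤ p × r₂ ≤ r)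
  bw {q} {r} {t} {m′} {p₂} {q₂} {r₂} {t₂} l₂ e f i (j , k) = go m′ refl r refl f
    where
    Goal = let p = dn₃ q r t m′ in
           Loc₃ p q r t (ent₃ q r t m′) m′ × q₂ ≤ p × (p₂ ≤ p × r₂ ≤ r)
    fin : ∀ {p m} → Loc₃ p q r t m m′ → q₂ ≤ p → Goal
    fin {p} {m} l x =
      subst₂ (λ p m → Loc₃ p q r t m m′) (sym (loc₃-dn l)) (sym (loc₃-ent l)) l ,
      x′ , ≤-trans (S≤ l₂) x′ , ≤-trans (N≤ l₂) i
      where x′ = ≤-trans x (≤-reflexive (sym (loc₃-dn l)))
    q₂≤t₂ : ∀ {p₂ q₂ r₂ t₂ m m′} → Loc₃ p₂ q₂ r₂ t₂ m m′ → q₂ ≤ t₂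
    q₂≤t₂ (flat₀ _) = ≤-refl
    q₂≤t₂ (flat₁ _) = n≤1+n _
    q₂≤t₂ tall      = n≤1+n _
    q₂≤t₂ (tall₀ _) = ≤-refl
    q₂≤t₂ (tall₁ _) = n≤1+n _
    M≤1 : ∀ {p₂ q₂ r₂ t₂ m m′} → Loc₃ p₂ q₂ r₂ t₂ m m′ → m ≤ 1
    M≤1 (flat₀ _) = z≤n
    M≤1 (flat₁ _) = ≤-refl
    M≤1 tall      = z≤n
    M≤1 (tall₀ _) = z≤n
    M≤1 (tall₁ _) = ≤-refl
    q₂≤r : q₂ ≤ r
    q₂≤r = ≤-trans (q₂≤t₂ l₂) i
    go : ∀ k → m′ ≡ k → ∀ u → r ≡ u → Step q t → Goal
    go zero refl _ _ stay = fin (flat₀ e) q₂≤r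
    go zero refl _ _ inc with m≤n⇒m<n∨m≡n e
    ... | inj₁ r<t  = fin (flat₁ (s≤s⁻¹ r<t)) q₂≤r
    ... | inj₂ refl = fin tall j
    go (suc zero) refl zero    refl _    = ⊥-elim (n≮0 (≤-trans (pos l₂) i))
    go (suc zero) refl (suc u) refl stay = fin (tall₀ e) (s≤s⁻¹ (≤-trans (pos l₂) i))
    go (suc zero) refl (suc u) refl inc  = fin (tall₁ (s≤s⁻¹ e)) (s≤s⁻¹ (≤-trans (pos l₂) i))
    go (suc (suc _)) refl _ _ _ with M≤1 l₂
    ... | s≤s ()
  int : ∀ {p q r t m m′ p₂ q₂ r₂ t₂ m″} → Loc₃ p q r t m m′ → Loc₃ p₂ q₂ r₂ t₂ m′ m″ →
        q₂ ≤ p → p₂ ≤ p × r₂ ≤ r → t₂ ≤ r × (q₂ ≤ q × t₂ ≤ t)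
  int {p} {q} {r} {t} {q₂ = q₂} {r₂} {t₂} l l₂ i (_ , k) =
    t₂≤r , ≤-trans i (S≤ l) , ≤-trans t₂≤r (N≤ l)
    where
    p≤r : ∀ {p q r t m m′} → Loc₃ p q r t m m′ → p ≤ r
    p≤r (flat₀ _) = ≤-refl
    p≤r (flat₁ _) = ≤-refl
    p≤r tall      = n≤1+n _
    p≤r (tall₀ _) = n≤1+n _
    p≤r (tall₁ _) = n≤1+n _
    carry⇒ : ∀ {p q r t m m′} → Loc₃ p q r t m (suc m′) → suc p ≤ r
    carry⇒ (tall₀ _) = ≤-refl
    carry⇒ (tall₁ _) = ≤-refl
    -- Either `t₂` is `q₂` or `r₂`, or it exceeds `q₂` by an entry 1 of the next layer. That entry
    -- was carried out of this cell, which happens only when `p < r`.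
    go : ∀ {p₂ q₂ r₂ t₂ m m′ m″} → Loc₃ p q r t m m′ → Loc₃ p₂ q₂ r₂ t₂ m′ m″ → q₂ ≤ p → r₂ ≤ r → t₂ ≤ r
    go l (flat₀ _) i k = ≤-trans i (p≤r l)
    go l (flat₁ _) i k = ≤-trans (s≤s i) (carry⇒ l)
    go l tall      i k = k
    go l (tall₀ _) i k = ≤-trans i (p≤r l)
    go l (tall₁ _) i k = ≤-trans (s≤s i) (carry⇒ l)
    t₂≤r : t₂ ≤ r
    t₂≤r = go l l₂ i k
  src≤ : ∀ {p q r t m m′} s → Loc₃ p q r t m m′ → 0 < m → IsSource weak strict s →
         source s p q r + [ m >0] ≤ t
  src≤ {q = q} {m = suc m} se′ l _ _ = ≤-trans (≤-reflexive (+-comm q 1)) (pos l)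
  src≡ : ∀ {p q r t m m′} → Loc₃ p q r t m m′ → t ≡ q ⊎ t ≡ r ⊎
         (0 < m × ∃ λ s → IsSource weak strict s × t ≡ source s p q r + [ m >0])
  src≡ (flat₀ _) = inj₁ refl
  src≡ {q = q} (flat₁ _) = inj₂ (inj₂ (z<s , se′ , tt , +-comm 1 q))
  src≡ tall      = inj₂ (inj₁ refl)
  src≡ (tall₀ _) = inj₁ refl
  src≡ {q = q} (tall₁ _) = inj₂ (inj₂ (z<s , se′ , tt , +-comm 1 q))

-- Exchanging rows and columns swaps the flags `weak` and `strict` of `rule₃`, and so does dualising
-- each of them. Hence the rule for (Ne, sE) is the mirror image of the one for (nE, Se).
rule₄ : Rule
rule₄ = flipRule rule₃

-- Layers of a grid and conservation of column sums

Grid : Set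
Grid = ℕ → ℕ → ℕ

columnSum : Grid → Grid
columnSum m x zero    = 0
columnSum m x (suc y) = columnSum m x y + m x y

columnSum-mono : ∀ m x {y y′} → y ≤ y′ → columnSum m x y ≤ columnSum m x y′
columnSum-mono m x {zero} _ = z≤n
columnSum-mono m x {suc y} {suc y′} (s≤s y≤y′) with m≤n⇒m<n∨m≡n y≤y′
... | inj₁ y<y′ = ≤-trans (columnSum-mono m x y<y′) (m≤m+n _ _)
... | inj₂ refl = ≤-refl

columnSum-0 : ∀ m x y → (∀ z → z < y → m x z ≡ 0) → columnSum m x y ≡ 0
columnSum-0 m x zero    _ = refl
columnSum-0 m x (suc y) e =
  cong₂ _+_ (columnSum-0 m x y (λ z z<y → e z (m≤n⇒m≤1+n z<y))) (e y ≤-refl)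

hasSource : ∀ f g → ∃ (IsSource f g)
hasSource weak   weak   = se′ , tt
hasSource weak   strict = se′ , tt
hasSource strict weak   = nw , tt
hasSource strict strict = sw , tt

weight>0 : ∀ w {m} → 0 < m → 0 < weight w m
weight>0 true  m>0 = m>0
weight>0 false {suc m} _ = z<s

module Growth (R : Rule) where
  open Rule R public

  S : Grid → Grid
  S m zero    y       = 0
  S m (suc x) zero    = 0
  S m (suc x) (suc y) = up (S m x y) (S m (suc x) y) (S m x (suc y)) (m x y)

  peel : Grid → Grid
  peel m x y = carry (S m x y) (S m (suc x) y) (S m x (suc y)) (m x y)

  layer : ℕ → Grid → Grid
  layer zero    m = m
  layer (suc k) m = layer k (peel m)

  Valid : Grid → Set
  Valid m = ∀ x y → M (m x y)

  S-x0 : ∀ m x → S m x 0 ≡ 0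
  S-x0 m zero    = refl
  S-x0 m (suc x) = refl

  Cell-Loc : (m′ T m : Grid) → ℕ → ℕ → Set
  Cell-Loc m′ T m x y =
    Loc (T x y) (T (suc x) y) (T x (suc y)) (T (suc x) (suc y)) (m x y) (m′ x y)

  module _ {m : Grid} (v : Valid m) where

    edgeH : ∀ x y → Edge hf (S m x y) (S m (suc x) y)
    edgeV : ∀ x y → Edge vf (S m x y) (S m x (suc y))
    loc   : ∀ x y → Cell-Loc (peel m) (S m) m x y
    edgeH x zero rewrite S-x0 m x = Edge-refl hf
    edgeH x (suc y) = edge-N (loc x y)
    edgeV zero    y = Edge-refl vf
    edgeV (suc x) y = edge-E (loc x y)
    loc x y = forward (edgeH x y) (edgeV x y) (v x y)

    peel-valid : Valid (peel m)
    peel-valid x y = M-carry (loc x y)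

    S-monoˣ : ∀ {x x′} y → x ≤ x′ → S m x y ≤ S m x′ y
    S-monoˣ {x} {zero} y z≤n = ≤-refl
    S-monoˣ {x} {suc x′} y x≤ with m≤n⇒m<n∨m≡n x≤
    ... | inj₁ (s≤s x≤x′) = ≤-trans (S-monoˣ y x≤x′) (Edge⇒≤ hf (edgeH x′ y))
    ... | inj₂ refl = ≤-refl

    S-monoʸ : ∀ x {y y′} → y ≤ y′ → S m x y ≤ S m x y′
    S-monoʸ x {y} {zero} z≤n = ≤-refl
    S-monoʸ x {y} {suc y′} y≤ with m≤n⇒m<n∨m≡n y≤
    ... | inj₁ (s≤s y≤y′) = ≤-trans (S-monoʸ x y≤y′) (Edge⇒≤ vf (edgeV x y′))
    ... | inj₂ refl = ≤-refl

    S-mono : ∀ {x x′ y y′} → x ≤ x′ → y ≤ y′ → S m x y ≤ S m x′ y′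
    S-mono {x} {x′} {y} x≤ y≤ = ≤-trans (S-monoˣ y x≤) (S-monoʸ x′ y≤)

    S-pos : ∀ x y → 0 < m x y → 0 < S m (suc x) (suc y)
    S-pos x y m>0 = let s , i = hasSource hf vf in
      <-≤-trans (weight>0 (isWeighted hf vf) m>0) (≤-trans (m≤n+m _ _) (source-≤ s (loc x y) m>0 i))

    -- Adding `conserve` over the cells of a column, the vertical differences of `S` telescope: the
    -- part of a column sum that does not increase `S` is passed on to the next layer.
    column-conserve : ∀ x y → S m (suc x) y + columnSum (peel m) x y ≡ S m x y + columnSum m x y
    column-conserve x zero rewrite S-x0 m x = refl
    column-conserve x (suc y) = +-cancelˡ-≡ p _ _ (begin
      p + (t + (C′ + e′))    ≡⟨ solve 4 (λ p t C′ e′ → p :+ (t :+ (C′ :+ e′)) := ((p :+ t) :+ e′) :+ C′) refl p t C′ e′ ⟩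
      ((p + t) + e′) + C′    ≡⟨ cong (_+ C′) (sym (conserve (loc x y))) ⟩
      (e + (q + r)) + C′     ≡⟨ solve 4 (λ e q r C′ → (e :+ (q :+ r)) :+ C′ := (q :+ C′) :+ (e :+ r)) refl e q r C′ ⟩
      (q + C′) + (e + r)     ≡⟨ cong (_+ (e + r)) (column-conserve x y) ⟩
      (p + C) + (e + r)      ≡⟨ solve 4 (λ p C e r → (p :+ C) :+ (e :+ r) := p :+ (r :+ (C :+ e))) refl p C e r ⟩
      p + (r + (C + e))      ∎)
      where
      open ≡-Reasoning
      open +-*-Solver
      p = S m x y
      q = S m (suc x) y
      r = S m x (suc y)
      t = S m (suc x) (suc y)
      e = m x y
      e′ = peel m x y
      C = columnSum m x y
      C′ = columnSum (peel m) x y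

  module _ {m : Grid} (v : Valid m) where

    interH : ∀ x y → Inter hf (S m x y) (S m (suc x) y) (S (peel m) x y) (S (peel m) (suc x) y)
    interV : ∀ x y → Inter vf (S m x y) (S m x (suc y)) (S (peel m) x y) (S (peel m) x (suc y))
    interH x zero rewrite S-x0 m x | S-x0 (peel m) x = Inter-0 hf
    interH x (suc y) = proj₁ (inter (loc v x y) (loc (peel-valid v) x y) (interH x y) (interV x y))
    interV zero    y = Inter-0 vf
    interV (suc x) y = proj₂ (inter (loc v x y) (loc (peel-valid v) x y) (interH x y) (interV x y))

    S-peel-≤ : ∀ x y → S (peel m) x y ≤ S m x y
    S-peel-≤ zero    y = z≤n
    S-peel-≤ (suc x) y = Inter⇒≤ʳ hf (edgeH v x y) (interH x y)

  layer-valid : ∀ k {m} → Valid m → Valid (layer k m)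
  layer-valid zero    v = v
  layer-valid (suc k) v = layer-valid k (peel-valid v)

  layer-suc : ∀ k m → layer (suc k) m ≡ peel (layer k m)
  layer-suc zero    m = refl
  layer-suc (suc k) m = layer-suc k (peel m)

  shapeSize : ℕ → Grid → Grid
  shapeSize zero    m x y = 0
  shapeSize (suc K) m x y = S m x y + shapeSize K (peel m) x y

  shapeSize-0y : ∀ K m y → shapeSize K m 0 y ≡ 0
  shapeSize-0y zero    m y = refl
  shapeSize-0y (suc K) m y = shapeSize-0y K (peel m) y

  -- Each layer accounts for a part of the column sum and passes on the rest, by `column-conserve`.
  -- Once nothing is left in layer `K`, column sums are differences of partition sizes.
  shapeSize-conserve : ∀ K {m} → Valid m → ∀ x y →
    shapeSize K m (suc x) y + columnSum (layer K m) x y ≡ shapeSize K m x y + columnSum m x y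
  shapeSize-conserve zero    v x y = refl
  shapeSize-conserve (suc K) {m} v x y = begin
    (S m (suc x) y + B′) + C″          ≡⟨ +-assoc (S m (suc x) y) B′ C″ ⟩
    S m (suc x) y + (B′ + C″)          ≡⟨ cong (S m (suc x) y +_) (shapeSize-conserve K (peel-valid v) x y) ⟩
    S m (suc x) y + (B + C′)           ≡⟨ solve 3 (λ s b c → s :+ (b :+ c) := (s :+ c) :+ b) refl (S m (suc x) y) B C′ ⟩
    (S m (suc x) y + C′) + B           ≡⟨ cong (_+ B) (column-conserve v x y) ⟩
    (S m x y + columnSum m x y) + B    ≡⟨ solve 3 (λ s c b → (s :+ c) :+ b := (s :+ b) :+ c) refl (S m x y) (columnSum m x y) B ⟩
    (S m x y + B) + columnSum m x y    ∎
    where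
    open ≡-Reasoning
    open +-*-Solver
    B′ = shapeSize K (peel m) (suc x) y
    B  = shapeSize K (peel m) x y
    C′ = columnSum (peel m) x y
    C″ = columnSum (layer K (peel m)) x y

  -- The values of successive layers decrease, so a positive value in layer `K` makes all `K + 1`
  -- summands positive. A bound on the size thus bounds the number of layers.
  shapeSize-≥ : ∀ K {m} → Valid m → ∀ x y → 0 < S (layer K m) x y → K < shapeSize (suc K) m x y
  shapeSize-≥ zero    {m} v x y pos = <-≤-trans pos (m≤m+n _ _)
  shapeSize-≥ (suc K) {m} v x y pos =
    +-mono-≤ (<-≤-trans pos (top (suc K) v)) (shapeSize-≥ K (peel-valid v) x y pos)
    where
    top : ∀ k {m} → Valid m → S (layer k m) x y ≤ S m x y
    top zero    v = ≤-refl
    top (suc k) v = ≤-trans (top k (peel-valid v)) (S-peel-≤ v x y)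

-- Reconstruction of a grid from its boundary values

-- `bound` exceeds the coordinate sum of every cell. It is the fuel for the recursions that start at
-- the boundary and run south-west.
record Region : Set where
  field
    h     : ℕ → ℕ
    h-anti : ∀ x → h (suc x) ≤ h x
    bound : ℕ
    h-bound : ∀ x y → y < h x → x + y < bound

  -- The closed region (together with the whole axis x = 0) and its north-east boundary.
  Cl : ℕ → ℕ → Set
  Cl zero    y = ⊤
  Cl (suc x) y = y ≤ h x

  Border : ℕ → ℕ → Set
  Border x y = Cl x y × h x ≤ y

  Cl-sw : ∀ x y → y < h x → Cl x y
  Cl-sw zero    y i = tt
  Cl-sw (suc x) y i = ≤-trans (<⇒≤ i) (h-anti x)

  Cl-nw : ∀ x y → y < h x → Cl x (suc y)
  Cl-nw zero    y i = tt
  Cl-nw (suc x) y i = ≤-trans i (h-anti x)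

  Cl-suc : ∀ x y → Cl (suc x) y → Cl x y
  Cl-suc zero    y i = tt
  Cl-suc (suc x) y i = ≤-trans i (h-anti x)

  Cl-down : ∀ x y → Cl x (suc y) → Cl x y
  Cl-down zero    y i = tt
  Cl-down (suc x) y i = <⇒≤ i

  _≐_ : Grid → Grid → Set
  m ≐ m′ = ∀ x y → y < h x → m x y ≡ m′ x y

  -- Induction on `bound ∸ (x + y)`, in the direction in which the local rules are inverted.
  descend : (P : ℕ → ℕ → Set) → (∀ x y → h x ≤ y → P x y) →
            (∀ x y → y < h x → P (suc x) y → P x (suc y) → P (suc x) (suc y) → P x y) →
            ∀ x y → P x y
  descend P out step x y = go bound x y (m≤n+m bound (x + y))
    where
    go : ∀ n x y → bound ≤ (x + y) + n → P x y
    go n x y b with y <? h x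
    ... | no ¬p = out x y (≮⇒≥ ¬p)
    go zero x y b | yes p = ⊥-elim (<⇒≱ (h-bound x y p) (≤-trans b (≤-reflexive (+-identityʳ _))))
    go (suc n) x y b | yes p = step x y p
      (go n (suc x) y b′)
      (go n x (suc y) (≤-trans b′ (≤-reflexive (cong (_+ n) (sym (+-suc x y))))))
      (go n (suc x) (suc y) (≤-trans (m≤n⇒m≤1+n b′) (≤-reflexive (cong (λ z → suc (z + n)) (sym (+-suc x y))))))
      where
      b′ : bound ≤ suc (x + y) + n
      b′ = ≤-trans b (≤-reflexive (+-suc (x + y) n))

module Shape-Growth (R : Rule) (F : Region) where
  open Growth R public
  open Region F public

  -- The closed region contains everything south-west of its points, so the recursion for `S` never
  -- leaves it. In this way values reconstructed from the boundary are recognised as those of some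
  -- `S m`.
  S-unique : ∀ (T m : Grid) → (∀ y → T 0 y ≡ 0) → (∀ x → T x 0 ≡ 0) →
    (∀ x y → y < h x → T (suc x) (suc y) ≡ up (T x y) (T (suc x) y) (T x (suc y)) (m x y)) →
    ∀ x y → Cl x y → T x y ≡ S m x y
  S-unique T m T0y Tx0 rec = go
    where
    go : ∀ x y → Cl x y → T x y ≡ S m x y
    go zero    y       _ = T0y y
    go (suc x) zero    _ = Tx0 (suc x)
    go (suc x) (suc y) c = trans (rec x y c) (trans
      (cong₂ (λ p q → up p q (T x (suc y)) (m x y)) (go x y (Cl-sw x y c)) (go (suc x) y (<⇒≤ c)))
      (cong (λ r → up (S m x y) (S m (suc x) y) r (m x y)) (go x (suc y) (Cl-nw x y c))))

  S-local : ∀ {m m′} → m ≐ m′ → ∀ x y → Cl x y → S m x y ≡ S m′ x y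
  S-local {m} {m′} e = S-unique (S m) m′ (λ y → refl) (S-x0 m)
    (λ x y i → cong (up (S m x y) (S m (suc x) y) (S m x (suc y))) (e x y i))

  carry-local : ∀ {m} (T m₁ : Grid) → (∀ x y → Cl x y → T x y ≡ S m x y) → m₁ ≐ m → ∀ x y → y < h x →
    carry (T x y) (T (suc x) y) (T x (suc y)) (m₁ x y) ≡ peel m x y
  carry-local {m} T m₁ eT e x y i = trans
    (cong₂ (λ p q → carry p q (T x (suc y)) (m₁ x y)) (eT x y (Cl-sw x y i)) (eT (suc x) y (<⇒≤ i)))
    (cong₂ (carry (S m x y) (S m (suc x) y)) (eT x (suc y) (Cl-nw x y i)) (e x y i))

  peel-local : ∀ {m m′} → m ≐ m′ → peel m ≐ peel m′
  peel-local {m} e = carry-local (S m) m (S-local e) e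

  layer-local : ∀ k {m m′} → m ≐ m′ → layer k m ≐ layer k m′
  layer-local zero    e = e
  layer-local (suc k) e = layer-local k (peel-local e)

  zeroGrid : Grid
  zeroGrid _ _ = 0

  S-zero : ∀ x y → S zeroGrid x y ≡ 0
  S-zero zero    y       = refl
  S-zero (suc x) zero    = refl
  S-zero (suc x) (suc y) rewrite S-zero x y | S-zero (suc x) y | S-zero x (suc y) = up-0

  peel-zero : ∀ x y → peel zeroGrid x y ≡ 0
  peel-zero x y = m+n≡0⇒n≡0 (S zeroGrid x y + S zeroGrid (suc x) (suc y)) (sym (trans
    (sym (cong₂ _+_ (S-zero (suc x) y) (S-zero x (suc y))))
    (conserve (loc {zeroGrid} (λ _ _ → M-0) x y))))

  layer-zero : ∀ k → layer k zeroGrid ≐ zeroGrid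
  layer-zero zero    x y i = refl
  layer-zero (suc k) x y i =
    trans (layer-local k (λ x y _ → peel-zero x y) x y i) (layer-zero k x y i)

  -- Inverts one layer, given its boundary values β and the entries m′ of the next layer.
  -- The third argument is fuel.
  unwind : Grid → Grid → ℕ → Grid
  unwind β m′ zero    x y = β x y
  unwind β m′ (suc n) x y with y <? h x
  ... | yes _ = dn (unwind β m′ n (suc x) y) (unwind β m′ n x (suc y)) (unwind β m′ n (suc x) (suc y)) (m′ x y)
  ... | no  _ = β x y

  -- `unwind` calls itself with less fuel; stability lets `unwound` satisfy its recursion with the
  -- same fuel on both sides.
  unwind-stable : ∀ β m′ n x y → bound ≤ (x + y) + n → unwind β m′ (suc n) x y ≡ unwind β m′ n x y
  unwind-stable β m′ zero x y b with y <? h x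
  ... | yes p = ⊥-elim (<⇒≱ (h-bound x y p) (≤-trans b (≤-reflexive (+-identityʳ _))))
  ... | no  _ = refl
  unwind-stable β m′ (suc n) x y b with y <? h x
  ... | no  _ = refl
  ... | yes p = trans
    (cong₂ (λ q r → dn q r (unwind β m′ (suc n) (suc x) (suc y)) (m′ x y))
       (unwind-stable β m′ n (suc x) y b′)
       (unwind-stable β m′ n x (suc y) (≤-trans b′ (≤-reflexive (cong (_+ n) (sym (+-suc x y)))))))
    (cong (λ t → dn (unwind β m′ n (suc x) y) (unwind β m′ n x (suc y)) t (m′ x y))
       (unwind-stable β m′ n (suc x) (suc y)
         (≤-trans (m≤n⇒m≤1+n b′) (≤-reflexive (cong (λ z → suc (z + n)) (sym (+-suc x y)))))))
    where
    b′ : bound ≤ suc (x + y) + n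
    b′ = ≤-trans b (≤-reflexive (+-suc (x + y) n))

  unwound : Grid → Grid → Grid
  unwound β m′ = unwind β m′ bound

  unwound-out : ∀ β m′ x y → h x ≤ y → unwound β m′ x y ≡ β x y
  unwound-out β m′ x y o = trans (sym (unwind-stable β m′ bound x y (m≤n+m bound (x + y)))) eq
    where
    eq : unwind β m′ (suc bound) x y ≡ β x y
    eq with y <? h x
    ... | yes p = ⊥-elim (<⇒≱ p o)
    ... | no  _ = refl

  unwound-in : ∀ β m′ x y → y < h x →
         unwound β m′ x y ≡ dn (unwound β m′ (suc x) y) (unwound β m′ x (suc y)) (unwound β m′ (suc x) (suc y)) (m′ x y)
  unwound-in β m′ x y i = trans (sym (unwind-stable β m′ bound x y (m≤n+m bound (x + y)))) eq
    where
    eq : unwind β m′ (suc bound) x y ≡ dn (unwound β m′ (suc x) y) (unwound β m′ x (suc y)) (unwound β m′ (suc x) (suc y)) (m′ x y)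
    eq with y <? h x
    ... | yes _ = refl
    ... | no ¬p = ⊥-elim (¬p i)

  entries : Grid → Grid → Grid
  entries β m′ x y with y <? h x
  ... | yes _ = ent (unwound β m′ (suc x) y) (unwound β m′ x (suc y)) (unwound β m′ (suc x) (suc y)) (m′ x y)
  ... | no  _ = 0

  entries-in : ∀ β m′ x y → y < h x → entries β m′ x y ≡
    ent (unwound β m′ (suc x) y) (unwound β m′ x (suc y)) (unwound β m′ (suc x) (suc y)) (m′ x y)
  entries-in β m′ x y i with y <? h x
  ... | yes _ = refl
  ... | no ¬p = ⊥-elim (¬p i)

  -- Inverting a layer needs the entries of the next one, so the layers are rebuilt from the
  -- innermost outwards, with the zero grid in place of layer `K`.
  rebuild : ℕ → (ℕ → Grid) → Grid
  rebuild zero    β = zeroGrid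
  rebuild (suc K) β = entries (β 0) (rebuild K (λ k → β (suc k)))

  -- In each layer `dn-≡` recovers `S` from the boundary towards the south-west, after which `ent-≡`
  -- reads off the entries.
  rebuild-S : ∀ K (β : ℕ → Grid) {m} → Valid m → (∀ k x y → Border x y → β k x y ≡ S (layer k m) x y) →
              layer K m ≐ zeroGrid → rebuild K β ≐ m
  rebuild-S zero    β v b z x y i = sym (z x y i)
  rebuild-S (suc K) β {m} v b z x y i = begin
    entries (β 0) m′ x y
      ≡⟨ entries-in (β 0) m′ x y i ⟩
    ent (T₀ (suc x) y) (T₀ x (suc y)) (T₀ (suc x) (suc y)) (m′ x y)
      ≡⟨ cong₂ (λ q r → ent q r (T₀ (suc x) (suc y)) (m′ x y)) (T≡S (suc x) y (<⇒≤ i)) (T≡S x (suc y) (Cl-nw x y i)) ⟩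
    ent (S m (suc x) y) (S m x (suc y)) (T₀ (suc x) (suc y)) (m′ x y)
      ≡⟨ cong₂ (ent (S m (suc x) y) (S m x (suc y))) (T≡S (suc x) (suc y) i) (m′≐ x y i) ⟩
    ent (S m (suc x) y) (S m x (suc y)) (S m (suc x) (suc y)) (peel m x y)
      ≡⟨ ent-≡ (loc v x y) ⟩
    m x y ∎
    where
    open ≡-Reasoning
    m′ = rebuild K (λ k → β (suc k))
    T₀ = unwound (β 0) m′
    m′≐ : m′ ≐ peel m
    m′≐ = rebuild-S K (λ k → β (suc k)) (peel-valid v) (λ k → b (suc k)) z
    T≡S : ∀ x y → Cl x y → T₀ x y ≡ S m x y
    T≡S = descend (λ x y → Cl x y → T₀ x y ≡ S m x y)
      (λ x y o c → trans (unwound-out (β 0) m′ x y o) (b 0 x y (c , o)))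
      (λ x y i e₁ e₂ e₃ _ → trans (unwound-in (β 0) m′ x y i) (trans
        (cong₂ (λ q r → dn q r (T₀ (suc x) (suc y)) (m′ x y)) (e₁ (<⇒≤ i)) (e₂ (Cl-nw x y i)))
        (trans (cong₂ (dn (S m (suc x) y) (S m x (suc y))) (e₃ i) (m′≐ x y i)) (dn-≡ (loc v x y)))))

  record ValidBorder (K : ℕ) (β : ℕ → Grid) : Set where
    field
      βH  : ∀ k x y → Border x y → Border (suc x) y → Edge hf (β k x y) (β k (suc x) y)
      βV  : ∀ k x y → Border x y → Border x (suc y) → Edge vf (β k x y) (β k x (suc y))
      βHI : ∀ k x y → Border x y → Border (suc x) y →
            Inter hf (β k x y) (β k (suc x) y) (β (suc k) x y) (β (suc k) (suc x) y)
      βVI : ∀ k x y → Border x y → Border x (suc y) →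
            Inter vf (β k x y) (β k x (suc y)) (β (suc k) x y) (β (suc k) x (suc y))
      β0y : ∀ k y → h 0 ≤ y → β k 0 y ≡ 0
      βx0 : ∀ k x → h x ≤ 0 → β k x 0 ≡ 0
      β≥K : ∀ k x y → Border x y → β (k + K) x y ≡ 0

  ValidBorder-suc : ∀ {K β} → ValidBorder (suc K) β → ValidBorder K (λ k → β (suc k))
  ValidBorder-suc {K} {β} vb = record
    { βH = λ k → βH (suc k) ; βV = λ k → βV (suc k) ; βHI = λ k → βHI (suc k) ; βVI = λ k → βVI (suc k)
    ; β0y = λ k → β0y (suc k) ; βx0 = λ k → βx0 (suc k)
    ; β≥K = λ k x y b → trans (cong (λ z → β z x y) (sym (+-suc k K))) (β≥K k x y b) }
    where open ValidBorder vb

  record Rebuilt (K : ℕ) (β : ℕ → Grid) (m : Grid) : Set where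
    field
      valid  : Valid m
      border : ∀ k x y → Border x y → S (layer k m) x y ≡ β k x y
      final  : layer K m ≐ zeroGrid

  -- The induction supplies `m′`, which realises the inner layers. Starting at the boundary,
  -- `backward` yields the local rule at a cell together with the strip conditions on its south and
  -- west sides, and these are the premises for the cells further south-west. `S-unique` then
  -- identifies the reconstructed values with `S`.
  S-rebuild : ∀ K β → ValidBorder K β → Rebuilt K β (rebuild K β)
  S-rebuild zero β vb = record
    { valid  = λ _ _ → M-0
    ; border = λ k x y b → trans (S-local (layer-zero k) x y (proj₁ b)) (trans (S-zero x y)
                 (sym (trans (cong (λ z → β z x y) (sym (+-identityʳ k))) (ValidBorder.β≥K vb k x y b))))
    ; final  = λ _ _ _ → refl }
  S-rebuild (suc K) β vb = record { valid = valid ; border = border ; final = final }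
    where
    open ValidBorder vb
    m′ = rebuild K (λ k → β (suc k))
    module IH = Rebuilt (S-rebuild K (λ k → β (suc k)) (ValidBorder-suc vb))
    T₀ = unwound (β 0) m′
    m₀ = entries (β 0) m′
    S′ = S m′
    Good : ℕ → ℕ → Set
    Good x y =
      (Cl (suc x) y → Edge hf (T₀ x y) (T₀ (suc x) y) × Inter hf (T₀ x y) (T₀ (suc x) y) (S′ x y) (S′ (suc x) y)) ×
      (Cl x (suc y) → Edge vf (T₀ x y) (T₀ x (suc y)) × Inter vf (T₀ x y) (T₀ x (suc y)) (S′ x y) (S′ x (suc y)))
    T≡β : ∀ x y → Border x y → T₀ x y ≡ β 0 x y
    T≡β x y (_ , o) = unwound-out (β 0) m′ x y o
    out : ∀ x y → h x ≤ y → Good x y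
    out x y o = right , above
      where
      right : Cl (suc x) y → Edge hf (T₀ x y) (T₀ (suc x) y) × Inter hf (T₀ x y) (T₀ (suc x) y) (S′ x y) (S′ (suc x) y)
      right c = go (Cl-suc x y c , o) (c , ≤-trans (h-anti x) o)
        where
        go : Border x y → Border (suc x) y →
             Edge hf (T₀ x y) (T₀ (suc x) y) × Inter hf (T₀ x y) (T₀ (suc x) y) (S′ x y) (S′ (suc x) y)
        go b₁ b₂ rewrite T≡β x y b₁ | T≡β (suc x) y b₂ | IH.border 0 x y b₁ | IH.border 0 (suc x) y b₂ =
          βH 0 x y b₁ b₂ , βHI 0 x y b₁ b₂
      above : Cl x (suc y) → Edge vf (T₀ x y) (T₀ x (suc y)) × Inter vf (T₀ x y) (T₀ x (suc y)) (S′ x y) (S′ x (suc y))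
      above c = go (Cl-down x y c , o) (c , m≤n⇒m≤1+n o)
        where
        go : Border x y → Border x (suc y) →
             Edge vf (T₀ x y) (T₀ x (suc y)) × Inter vf (T₀ x y) (T₀ x (suc y)) (S′ x y) (S′ x (suc y))
        go b₁ b₂ rewrite T≡β x y b₁ | T≡β x (suc y) b₂ | IH.border 0 x y b₁ | IH.border 0 x (suc y) b₂ =
          βV 0 x y b₁ b₂ , βVI 0 x y b₁ b₂
    stepL : ∀ x y → y < h x → Good (suc x) y → Good x (suc y) →
      Cell-Loc m′ T₀ m₀ x y × Inter hf (T₀ x y) (T₀ (suc x) y) (S′ x y) (S′ (suc x) y) ×
      Inter vf (T₀ x y) (T₀ x (suc y)) (S′ x y) (S′ x (suc y))
    stepL x y i (_ , above) (right , _)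
      rewrite unwound-in (β 0) m′ x y i | entries-in (β 0) m′ x y i =
        backward (loc IH.valid x y) (proj₁ (right i)) (proj₁ (above i)) (proj₂ (right i)) (proj₂ (above i))
    good : ∀ x y → Good x y
    good = descend Good out λ x y i g₁ g₂ _ → let l , ih , iv = stepL x y i g₁ g₂ in
      (λ _ → edge-S l , ih) , (λ _ → edge-W l , iv)
    cell : ∀ x y → y < h x → Cell-Loc m′ T₀ m₀ x y
    cell x y i = proj₁ (stepL x y i (good (suc x) y) (good x (suc y)))
    -- Along an axis the values decrease towards the origin, and where the axis meets the boundary
    -- they are 0 because the partition there is empty.
    T0y : ∀ x y → x ≡ 0 → T₀ x y ≡ 0
    T0y = descend (λ x y → x ≡ 0 → T₀ x y ≡ 0)
      (λ { x y o refl → trans (unwound-out (β 0) m′ x y o) (β0y 0 y o) })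
      (λ { x y i _ e _ refl → n≤0⇒n≡0 (≤-trans (Edge⇒≤ vf (edge-W (cell x y i))) (≤-reflexive (e refl))) })
    Tx0 : ∀ x y → y ≡ 0 → T₀ x y ≡ 0
    Tx0 = descend (λ x y → y ≡ 0 → T₀ x y ≡ 0)
      (λ { x y o refl → trans (unwound-out (β 0) m′ x y o) (βx0 0 x o) })
      (λ { x y i e _ _ refl → n≤0⇒n≡0 (≤-trans (Edge⇒≤ hf (edge-S (cell x y i))) (≤-reflexive (e refl))) })
    valid : Valid m₀
    valid x y with y <? h x
    ... | yes i = subst M (entries-in (β 0) m′ x y i) (M-ent (cell x y i))
    ... | no  _ = M-0
    T≡S : ∀ x y → Cl x y → T₀ x y ≡ S m₀ x y
    T≡S = S-unique T₀ m₀ (λ y → T0y 0 y refl) (λ x → Tx0 x 0 refl) (λ x y i → sym (up-≡ (cell x y i)))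
    peel≐ : peel m₀ ≐ m′
    peel≐ x y i = trans (sym (carry-local T₀ m₀ T≡S (λ _ _ _ → refl) x y i)) (carry-≡ (cell x y i))
    border : ∀ k x y → Border x y → S (layer k m₀) x y ≡ β k x y
    border zero    x y b = trans (sym (T≡S x y (proj₁ b))) (T≡β x y b)
    border (suc k) x y b = trans (S-local (layer-local k peel≐) x y (proj₁ b)) (IH.border k x y b)
    final : layer (suc K) m₀ ≐ zeroGrid
    final x y i = trans (layer-local K peel≐ x y i) (IH.final x y i)

-- Conjugate partitions

-- The indicator of `l < n`. Summed over the rows of a diagram, as in `transpose`, it gives the
-- length of column `l`.
below : ℕ → ℕ → ℕ
below l       zero    = 0
below zero    (suc n) = 1
below (suc l) (suc n) = below l n

transpose : ℕ → (ℕ → ℕ) → ℕ → ℕ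
transpose zero    p l = 0
transpose (suc K) p l = below l (p 0) + transpose K (p ∘ suc) l

Decreasing : (ℕ → ℕ) → Set
Decreasing p = ∀ k → p (suc k) ≤ p k

decreasing-≤0 : ∀ {p} → Decreasing p → ∀ k → p k ≤ p 0
decreasing-≤0 d zero    = ≤-refl
decreasing-≤0 d (suc k) = ≤-trans (d k) (decreasing-≤0 d k)

below-yes : ∀ {l n} → l < n → below l n ≡ 1
below-yes {zero}  {suc n} _ = refl
below-yes {suc l} {suc n} (s≤s i) = below-yes i

below-no : ∀ {l n} → n ≤ l → below l n ≡ 0
below-no {l}     {zero}  _ = refl
below-no {suc l} {suc n} (s≤s i) = below-no i

-- The rows of a decreasing `p` that reach beyond column `l` form an initial segment. Together with
-- `<-transpose` this makes `k < transpose K p l` and `l < p k` equivalent for `k < K`, on which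
-- involutivity and the exchange of strips rest.
transpose-< : ∀ K {p l k} → Decreasing p → k < transpose K p l → l < p k
transpose-< (suc K) {p} {l} {k} d i with l <? p 0
transpose-< (suc K) {p} {l} {zero}  d i | yes y = y
transpose-< (suc K) {p} {l} {suc k} d i | yes y rewrite below-yes y =
  transpose-< K (d ∘ suc) (s≤s⁻¹ i)
transpose-< (suc K) {p} {l} {k} d i | no n rewrite below-no (≮⇒≥ n) =
  ⊥-elim (n (<-≤-trans (transpose-< K (d ∘ suc) i) (decreasing-≤0 d (suc k))))

<-transpose : ∀ K {p l k} → Decreasing p → k < K → l < p k → k < transpose K p l
<-transpose (suc K) {p} {l} {k} d i j rewrite below-yes (<-≤-trans j (decreasing-≤0 d k)) with k
... | zero   = z<s
... | suc k′ = s≤s (<-transpose K (d ∘ suc) (s≤s⁻¹ i) j)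

transpose-≤ : ∀ K p l → transpose K p l ≤ K
transpose-≤ zero    p l = z≤n
transpose-≤ (suc K) p l with l <? p 0
... | yes y rewrite below-yes y = s≤s (transpose-≤ K _ l)
... | no  n rewrite below-no (≮⇒≥ n) = m≤n⇒m≤1+n (transpose-≤ K _ l)

transpose-cong : ∀ K {p q} → (∀ k → p k ≡ q k) → ∀ l → transpose K p l ≡ transpose K q l
transpose-cong zero    e l = refl
transpose-cong (suc K) e l = cong₂ (λ a b → below l a + b) (e 0) (transpose-cong K (e ∘ suc) l)

-- Partitions inside a `K` by `K` square: transposing exchanges the two bounds, so one parameter
-- serves for a partition and its conjugate.
record Partition (K : ℕ) (p : ℕ → ℕ) : Set where
  field
    decreasing : Decreasing p
    vanishes   : ∀ k → p (k + K) ≡ 0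
    first      : p 0 ≤ K

  pos⇒<K : ∀ {k} → 0 < p k → k < K
  pos⇒<K {k} i with k <? K
  ... | yes y = y
  ... | no  n = ⊥-elim (<⇒≢ i (sym (trans (cong p (sym (m∸n+n≡m (≮⇒≥ n)))) (vanishes (k ∸ K)))))

  from-transpose : ∀ {l k} → k < transpose K p l → l < p k
  from-transpose = transpose-< K decreasing

  to-transpose : ∀ {l k} → l < p k → k < transpose K p l
  to-transpose i = <-transpose K decreasing (pos⇒<K (≤-<-trans z≤n i)) i

open Partition

≤-from-< : ∀ {a b} → (∀ k → k < a → k < b) → a ≤ b
≤-from-< {zero}  f = z≤n
≤-from-< {suc a} f = f a ≤-refl

transpose-partition : ∀ {K p} → Partition K p → Partition K (transpose K p)
transpose-partition {K} {p} π = record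
  { decreasing = λ l → ≤-from-< λ k i → to-transpose π (<-trans (n<1+n l) (from-transpose π i))
  ; vanishes = λ l → n≤0⇒n≡0 (≤-from-< λ k i → ⊥-elim (<⇒≱ (from-transpose π i)
      (≤-trans (decreasing-≤0 (decreasing π) k) (≤-trans (first π) (m≤n+m K l)))))
  ; first = transpose-≤ K p 0 }

transpose-involutive : ∀ {K p} → Partition K p → ∀ l → transpose K (transpose K p) l ≡ p l
transpose-involutive π l = ≤-antisym
  (≤-from-< λ k i → from-transpose π (from-transpose (transpose-partition π) i))
  (≤-from-< λ k i → to-transpose (transpose-partition π) (to-transpose π i))

sumTo : ℕ → (ℕ → ℕ) → ℕ
sumTo zero    p = 0
sumTo (suc K) p = p 0 + sumTo K (p ∘ suc)

sumTo-cong : ∀ K {p q} → (∀ k → p k ≡ q k) → sumTo K p ≡ sumTo K q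
sumTo-cong zero    e = refl
sumTo-cong (suc K) e = cong₂ _+_ (e 0) (sumTo-cong K (e ∘ suc))

sumTo-+ : ∀ K p q → sumTo K (λ k → p k + q k) ≡ sumTo K p + sumTo K q
sumTo-+ zero    p q = refl
sumTo-+ (suc K) p q rewrite sumTo-+ K (p ∘ suc) (q ∘ suc) =
  solve 4 (λ a b c d → (a :+ b) :+ (c :+ d) := (a :+ c) :+ (b :+ d)) refl (p 0) (q 0) _ _
  where open +-*-Solver

sumTo-0 : ∀ K → sumTo K (λ _ → 0) ≡ 0
sumTo-0 zero    = refl
sumTo-0 (suc K) = sumTo-0 K

sumTo-below : ∀ L n → n ≤ L → sumTo L (λ l → below l n) ≡ n
sumTo-below L       zero    _       = sumTo-0 L
sumTo-below (suc L) (suc n) (s≤s i) = cong suc (sumTo-below L n i)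

-- The cells of the diagram are counted by rows and by columns; `L` has to cover the longest row.
sumTo-transpose : ∀ L K p → (∀ k → p k ≤ L) → sumTo L (transpose K p) ≡ sumTo K p
sumTo-transpose L zero    p b = sumTo-0 L
sumTo-transpose L (suc K) p b = trans (sumTo-+ L (λ l → below l (p 0)) (transpose K (p ∘ suc)))
  (cong₂ _+_ (sumTo-below L (p 0) (b 0)) (sumTo-transpose L K (p ∘ suc) (b ∘ suc)))

dual : Flag → Flag
dual weak   = strict
dual strict = weak

≤⇒Step : ∀ {p q} → p ≤ q → q ≤ suc p → Step p q
≤⇒Step {p} {q} i j with m≤n⇒m<n∨m≡n i
... | inj₂ refl = stay
... | inj₁ p<q with ≤-antisym p<q j
... | refl = inc

-- In a horizontal strip row `k + 1` of `q` is no longer than row `k` of `p`, so a column of `q` is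
-- at most one longer than that of `p`. In a vertical strip each row grows by at most one, so column
-- `l + 1` of `q` is no longer than column `l` of `p`.
transpose-edge : ∀ f {K p q} → Partition K p → Partition K q → (∀ k → Edge f (p k) (q k)) →
  (∀ k → Inter f (p k) (q k) (p (suc k)) (q (suc k))) → ∀ l →
  let p′ = transpose K p ; q′ = transpose K q in
  Edge (dual f) (p′ l) (q′ l) × Inter (dual f) (p′ l) (q′ l) (p′ (suc l)) (q′ (suc l))
transpose-edge weak {K} {p} {q} π ρ e i l =
  ≤⇒Step (≤-from-< λ k j → to-transpose ρ (<-≤-trans (from-transpose π j) (e k)))
         (≤-from-< λ { zero _ → z<s ; (suc k) j → s≤s (to-transpose π (<-≤-trans (from-transpose ρ j) (i k))) }) ,
  decreasing (transpose-partition π) l , decreasing (transpose-partition ρ) l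
transpose-edge strict {K} {p} {q} π ρ e i l =
  (≤-from-< λ k j → to-transpose ρ (<-≤-trans (from-transpose π j) (Edge⇒≤ strict (e k)))) ,
  (≤-from-< λ k j → to-transpose π (s≤s⁻¹ (<-≤-trans (from-transpose ρ j) (Step⇒≤suc (e k)))))

-- Transposing the boundary partitions

record Dual (R₁ R₂ : Rule) : Set where
  open Rule
  field
    hf-dual : hf R₂ ≡ dual (hf R₁)
    vf-dual : vf R₂ ≡ dual (vf R₁)
    M-dual  : ∀ m → M R₁ m → M R₂ m
    M-dual′ : ∀ m → M R₂ m → M R₁ m

dual-involutive : ∀ f → dual (dual f) ≡ f
dual-involutive weak   = refl
dual-involutive strict = refl

Dual-sym : ∀ {R₁ R₂} → Dual R₁ R₂ → Dual R₂ R₁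
Dual-sym D = record
  { hf-dual = trans (sym (dual-involutive _)) (cong dual (sym hf-dual))
  ; vf-dual = trans (sym (dual-involutive _)) (cong dual (sym vf-dual))
  ; M-dual = M-dual′ ; M-dual′ = M-dual }
  where open Dual D

total : Region → Grid → ℕ → ℕ
total F m zero    = 0
total F m (suc x) = total F m x + columnSum m x (Region.h F x)

module _ (R : Rule) (F : Region) where
  open Shape-Growth R F

  shapeSize-sumTo : ∀ K m x y → shapeSize K m x y ≡ sumTo K (λ k → S (layer k m) x y)
  shapeSize-sumTo zero    m x y = refl
  shapeSize-sumTo (suc K) m x y = cong (S m x y +_) (shapeSize-sumTo K (peel m) x y)

  -- With layer `n` empty, `shapeSize-conserve` expresses a column sum by the sizes of two boundary
  -- partitions, and transposing does not change sizes.
  columnSum-shape : ∀ n {m} → Valid m → layer n m ≐ zeroGrid → ∀ x →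
    sumTo n (λ k → S (layer k m) x (h x)) + columnSum m x (h x) ≡ sumTo n (λ k → S (layer k m) (suc x) (h x))
  columnSum-shape n {m} v z x = begin
    sumTo n (λ k → S (layer k m) x (h x)) + columnSum m x (h x)
      ≡⟨ cong (_+ columnSum m x (h x)) (sym (shapeSize-sumTo n m x (h x))) ⟩
    shapeSize n m x (h x) + columnSum m x (h x)
      ≡⟨ sym (shapeSize-conserve n v x (h x)) ⟩
    shapeSize n m (suc x) (h x) + columnSum (layer n m) x (h x)
      ≡⟨ cong (shapeSize n m (suc x) (h x) +_) (columnSum-0 (layer n m) x (h x) (z x)) ⟩
    shapeSize n m (suc x) (h x) + 0
      ≡⟨ trans (+-identityʳ _) (shapeSize-sumTo n m (suc x) (h x)) ⟩
    sumTo n (λ k → S (layer k m) (suc x) (h x)) ∎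
    where open ≡-Reasoning

module Filled (R : Rule) (F : Region) (n : ℕ) {m : Grid} (v : Growth.Valid R m)
              (tot : ∀ x → total F m x ≤ n) where
  open Shape-Growth R F

  shape : ℕ → ℕ → ℕ → ℕ
  shape x y k = S (layer k m) x y

  shapeSize-total : ∀ j x y → Cl x y → shapeSize j m x y ≤ total F m x
  shapeSize-total j zero    y c = ≤-reflexive (shapeSize-0y j m y)
  shapeSize-total j (suc x) y c = begin
    shapeSize j m (suc x) y                                  ≤⟨ m≤m+n _ _ ⟩
    shapeSize j m (suc x) y + columnSum (layer j m) x y      ≡⟨ shapeSize-conserve j v x y ⟩
    shapeSize j m x y + columnSum m x y                      ≤⟨ +-mono-≤ (shapeSize-total j x y (Cl-suc x y c)) (columnSum-mono m x c) ⟩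
    total F m x + columnSum m x (h x)                        ∎
    where open ≤-Reasoning

  -- More than `n` positive parts would add up to more than `n`, whereas the size of the partition
  -- is at most the sum of the entries in the first `x` columns.
  shape-vanishes : ∀ k x y → Cl x y → shape x y (k + n) ≡ 0
  shape-vanishes k x y c with shape x y (k + n) in eq
  ... | zero  = refl
  ... | suc _ = ⊥-elim (<⇒≱ (shapeSize-≥ (k + n) v x y (subst (0 <_) (sym eq) z<s))
                  (≤-trans (shapeSize-total (suc (k + n)) x y c) (≤-trans (tot x) (m≤n+m n k))))

  layer-n : layer n m ≐ zeroGrid
  layer-n x y i with layer n m x y in eq
  ... | zero  = refl
  ... | suc _ = ⊥-elim (<⇒≢ (S-pos (layer-valid n v) x y (subst (0 <_) (sym eq) z<s))
                  (sym (shape-vanishes 0 (suc x) (suc y) i)))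

  shape-partition : ∀ x y → Cl x y → Partition n (shape x y)
  shape-partition x y c = record
    { decreasing = λ k → subst (λ g → S g x y ≤ shape x y k) (sym (layer-suc k m)) (S-peel-≤ (layer-valid k v) x y)
    ; vanishes = λ k → shape-vanishes k x y c
    ; first = ≤-trans (m≤m+n _ 0) (≤-trans (shapeSize-total 1 x y c) (tot x)) }

  shape-H : ∀ x y k → Edge hf (shape x y k) (shape (suc x) y k) ×
    Inter hf (shape x y k) (shape (suc x) y k) (shape x y (suc k)) (shape (suc x) y (suc k))
  shape-H x y k rewrite layer-suc k m = edgeH (layer-valid k v) x y , interH (layer-valid k v) x y

  shape-V : ∀ x y k → Edge vf (shape x y k) (shape x (suc y) k) ×
    Inter vf (shape x y k) (shape x (suc y) k) (shape x y (suc k)) (shape x (suc y) (suc k))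
  shape-V x y k rewrite layer-suc k m = edgeV (layer-valid k v) x y , interV (layer-valid k v) x y

module Transfer (R₁ R₂ : Rule) (D : Dual R₁ R₂) (F : Region) (n : ℕ) where
  open Dual D
  private
    module G₁ = Shape-Growth R₁ F
    module G₂ = Shape-Growth R₂ F
  open Region F

  transposed : Grid → ℕ → Grid
  transposed m l x y = transpose n (λ k → G₁.S (G₁.layer k m) x y) l

  Φ : Grid → Grid
  Φ m = G₂.rebuild n (transposed m)

  transpose-zero : ∀ {p} → (∀ k → p k ≡ 0) → ∀ l → transpose n p l ≡ 0
  transpose-zero e l = trans (transpose-cong n e l) (zeros n)
    where
    zeros : ∀ K → transpose K (λ _ → 0) l ≡ 0
    zeros zero    = refl
    zeros (suc K) = zeros K

  module _ {m : Grid} (v : G₁.Valid m) (tot : ∀ x → total F m x ≤ n) where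
    private module F₁ = Filled R₁ F n v tot

    transposed-valid : G₂.ValidBorder n (transposed m)
    transposed-valid = record
      { βH  = λ l x y b b′ → subst (λ f → Edge f _ _) (sym hf-dual) (proj₁ (H l x y b b′))
      ; βV  = λ l x y b b′ → subst (λ f → Edge f _ _) (sym vf-dual) (proj₁ (V l x y b b′))
      ; βHI = λ l x y b b′ → subst (λ f → Inter f _ _ _ _) (sym hf-dual) (proj₂ (H l x y b b′))
      ; βVI = λ l x y b b′ → subst (λ f → Inter f _ _ _ _) (sym vf-dual) (proj₂ (V l x y b b′))
      ; β0y = λ l y _ → transpose-zero (λ k → refl) l
      ; βx0 = λ l x _ → transpose-zero (λ k → G₁.S-x0 (G₁.layer k m) x) l
      ; β≥K = λ l x y b → vanishes (transpose-partition (F₁.shape-partition x y (proj₁ b))) l }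
      where
      H : ∀ l x y → Border x y → Border (suc x) y → _
      H l x y b b′ = transpose-edge (G₁.hf) (F₁.shape-partition x y (proj₁ b)) (F₁.shape-partition (suc x) y (proj₁ b′))
        (λ k → proj₁ (F₁.shape-H x y k)) (λ k → proj₂ (F₁.shape-H x y k)) l
      V : ∀ l x y → Border x y → Border x (suc y) → _
      V l x y b b′ = transpose-edge (G₁.vf) (F₁.shape-partition x y (proj₁ b)) (F₁.shape-partition x (suc y) (proj₁ b′))
        (λ k → proj₁ (F₁.shape-V x y k)) (λ k → proj₂ (F₁.shape-V x y k)) l

    rebuilt : G₂.Rebuilt n (transposed m) (Φ m)
    rebuilt = G₂.S-rebuild n (transposed m) transposed-valid

    Φ-valid : G₂.Valid (Φ m)
    Φ-valid = G₂.Rebuilt.valid rebuilt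

    Φ-shape : ∀ {m₂} → m₂ ≐ Φ m → ∀ k x y → Border x y → G₂.S (G₂.layer k m₂) x y ≡ transposed m k x y
    Φ-shape e k x y b = trans (G₂.S-local (G₂.layer-local k e) x y (proj₁ b)) (G₂.Rebuilt.border rebuilt k x y b)

    Φ-columnSum : ∀ x → columnSum (Φ m) x (h x) ≡ columnSum m x (h x)
    Φ-columnSum x = +-cancelˡ-≡ (sumTo n (λ k → G₁.S (G₁.layer k m) x (h x))) _ _ (begin
      sumTo n (F₁.shape x (h x)) + columnSum (Φ m) x (h x)
        ≡⟨ cong (_+ columnSum (Φ m) x (h x)) (sym (size x (Cl-top x , ≤-refl))) ⟩
      sumTo n (λ k → G₂.S (G₂.layer k (Φ m)) x (h x)) + columnSum (Φ m) x (h x)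
        ≡⟨ columnSum-shape R₂ F n Φ-valid (G₂.Rebuilt.final rebuilt) x ⟩
      sumTo n (λ k → G₂.S (G₂.layer k (Φ m)) (suc x) (h x))
        ≡⟨ size (suc x) (≤-refl , h-anti x) ⟩
      sumTo n (F₁.shape (suc x) (h x))
        ≡⟨ sym (columnSum-shape R₁ F n v F₁.layer-n x) ⟩
      sumTo n (F₁.shape x (h x)) + columnSum m x (h x) ∎)
      where
      open ≡-Reasoning
      Cl-top : ∀ x → Cl x (h x)
      Cl-top zero    = tt
      Cl-top (suc x) = h-anti x
      size : ∀ x {y} → Border x y → sumTo n (λ k → G₂.S (G₂.layer k (Φ m)) x y) ≡ sumTo n (F₁.shape x y)
      size x {y} b = trans (sumTo-cong n (λ k → Φ-shape (λ _ _ _ → refl) k x y b))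
        (sumTo-transpose n n (F₁.shape x y) (λ k → ≤-trans (decreasing-≤0 (decreasing π) k) (first π)))
        where π = F₁.shape-partition x y (proj₁ b)

    -- Stated for every `m₂` that agrees with `Φ m` on the shape, because turning a grid into a
    -- filling forgets its values elsewhere.
    Φ-inverse : ∀ {m₂} → m₂ ≐ Φ m →
      G₁.rebuild n (λ l x y → transpose n (λ k → G₂.S (G₂.layer k m₂) x y) l) ≐ m
    Φ-inverse {m₂} e = G₁.rebuild-S n _ v (λ l x y b → trans
      (transpose-cong n (λ k → Φ-shape e k x y b) l)
      (transpose-involutive (F₁.shape-partition x y (proj₁ b)) l)) F₁.layer-n

-- Complementary chains counted by cells

-- In a weak direction of X a nonzero entry always creates an increasing side. In a strict direction
-- it may be matched by an entry of the other grid in the same cell instead; if it is not, another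
-- side of the cell is constant as well.
By : Flag → Set → Set → Set
By weak   A B = A
By strict A B = B

-- Inequalities such as p < r say that S increases along a side of the cell; a
-- nonzero entry creates such increasing sides, and they propagate along a row or
-- a column until they meet an entry of the other grid.
record Propagation (R : Rule) : Set where
  open Rule R
  field
    not-strict : hf ≡ strict → vf ≡ strict → ⊥
    enterE : ∀ {p q r t m m′} → Loc p q r t m m′ → 0 < m → By hf (q < t) (0 < m′ ⊎ (q < t × q ≤ p))
    enterN : ∀ {p q r t m m′} → Loc p q r t m m′ → 0 < m → By vf (r < t) (0 < m′ ⊎ (r < t × r ≤ p))
    passE  : ∀ {p q r t m m′} → Loc p q r t m m′ → p < r → 0 < m′ ⊎ (q < t × q ≤ p × (vf ≡ strict → m ≡ 0))
    passN  : ∀ {p q r t m m′} → Loc p q r t m m′ → p < q → 0 < m′ ⊎ (r < t × r ≤ p × (hf ≡ strict → m ≡ 0))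
    enterS : ∀ {p q r t m m′} → Loc p q r t m m′ → 0 < m′ → By vf (p < q) (0 < m ⊎ (p < q × t ≤ q))
    enterW : ∀ {p q r t m m′} → Loc p q r t m m′ → 0 < m′ → By hf (p < r) (0 < m ⊎ (p < r × t ≤ r))
    passS  : ∀ {p q r t m m′} → Loc p q r t m m′ → r < t → 0 < m ⊎ (p < q × t ≤ q × (hf ≡ strict → m′ ≡ 0))
    passW  : ∀ {p q r t m m′} → Loc p q r t m m′ → q < t → 0 < m ⊎ (p < r × t ≤ r × (vf ≡ strict → m′ ≡ 0))

propagation₁ : Propagation rule₁
propagation₁ = record
  { not-strict = λ ()
  ; enterE = λ { {q = q} {r} (loc₁ _ _ refl _) i → ≤-<-trans (m≤m⊔n q r) (m<m+n _ i) }
  ; enterN = λ { {q = q} {r} (loc₁ _ _ refl _) i → ≤-<-trans (m≤n⊔m q r) (m<m+n _ i) }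
  ; passE = pE ; passN = pN
  ; enterS = λ { {q = q} {r} l i → <-≤-trans (low l i) (m⊓n≤m q r) }
  ; enterW = λ { {q = q} {r} l i → <-≤-trans (low l i) (m⊓n≤n q r) }
  ; passS = pS ; passW = pW }
  where
  low : ∀ {p q r t m m′} → Loc₁ p q r t m m′ → 0 < m′ → p < q ⊓ r
  low {p} (loc₁ _ _ _ e) i = <-≤-trans (m<n+m p i) (≤-reflexive e)
  carry>0 : ∀ {p q r t m m′} → Loc₁ p q r t m m′ → p < q → p < r → 0 < m′
  carry>0 {m′ = zero}  (loc₁ _ _ _ refl) i j = ⊥-elim (<-irrefl refl (⊓-pres-m< i j))
  carry>0 {m′ = suc _} _ _ _ = z<s
  t≥ : ∀ {p q r t m m′} → Loc₁ p q r t m m′ → q ≤ t × r ≤ t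
  t≥ {q = q} {r} (loc₁ _ _ refl _) = ≤-trans (m≤m⊔n q r) (m≤m+n _ _) , ≤-trans (m≤n⊔m q r) (m≤m+n _ _)
  pE : ∀ {p q r t m m′} → Loc₁ p q r t m m′ → p < r → 0 < m′ ⊎ (q < t × q ≤ p × (weak ≡ strict → m ≡ 0))
  pE {p} {q} l i with p <? q
  ... | yes j = inj₁ (carry>0 l j i)
  ... | no  j = inj₂ (≤-<-trans (≮⇒≥ j) (<-≤-trans i (proj₂ (t≥ l))) , ≮⇒≥ j , λ ())
  pN : ∀ {p q r t m m′} → Loc₁ p q r t m m′ → p < q → 0 < m′ ⊎ (r < t × r ≤ p × (weak ≡ strict → m ≡ 0))
  pN {p} {q} {r} l i with p <? r
  ... | yes j = inj₁ (carry>0 l i j)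
  ... | no  j = inj₂ (≤-<-trans (≮⇒≥ j) (<-≤-trans i (proj₁ (t≥ l))) , ≮⇒≥ j , λ ())
  pS : ∀ {p q r t m m′} → Loc₁ p q r t m m′ → r < t → 0 < m ⊎ (p < q × t ≤ q × (weak ≡ strict → m′ ≡ 0))
  pS {m = suc _} _ _ = inj₁ z<s
  pS {p} {q} {r} {m = zero} (loc₁ i j refl _) k rewrite +-identityʳ (q ⊔ r) with ⊔-sel q r
  ... | inj₁ e rewrite e = inj₂ (≤-<-trans j k , ≤-refl , λ ())
  ... | inj₂ e rewrite e = ⊥-elim (<-irrefl refl k)
  pW : ∀ {p q r t m m′} → Loc₁ p q r t m m′ → q < t → 0 < m ⊎ (p < r × t ≤ r × (weak ≡ strict → m′ ≡ 0))
  pW {m = suc _} _ _ = inj₁ z<s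
  pW {p} {q} {r} {m = zero} (loc₁ i j refl _) k rewrite +-identityʳ (q ⊔ r) with ⊔-sel q r
  ... | inj₁ e rewrite e = ⊥-elim (<-irrefl refl k)
  ... | inj₂ e rewrite e = inj₂ (≤-<-trans i k , ≤-refl , λ ())

propagation₃ : Propagation rule₃
propagation₃ = record
  { not-strict = λ ()
  ; enterE = λ { (flat₁ _) _ → ≤-refl ; (tall₁ _) _ → ≤-refl }
  ; enterN = λ { (flat₁ i) _ → inj₂ (s≤s i , ≤-refl) ; (tall₁ _) _ → inj₁ z<s }
  ; passE = λ { (flat₀ _) i → ⊥-elim (<-irrefl refl i) ; (flat₁ _) i → ⊥-elim (<-irrefl refl i)
              ; tall _ → inj₂ (≤-refl , ≤-refl , λ _ → refl) ; (tall₀ _) _ → inj₁ z<s ; (tall₁ _) _ → inj₁ z<s }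
  ; passN = λ { (flat₀ _) i → inj₂ (i , ≤-refl , λ ()) ; (flat₁ _) i → inj₂ (m<n⇒m<1+n i , ≤-refl , λ ())
              ; tall i → ⊥-elim (<-irrefl refl i) ; (tall₀ _) _ → inj₁ z<s ; (tall₁ _) _ → inj₁ z<s }
  ; enterS = λ { (tall₀ i) _ → inj₂ (i , ≤-refl) ; (tall₁ _) _ → inj₁ z<s }
  ; enterW = λ { (tall₀ _) _ → ≤-refl ; (tall₁ _) _ → ≤-refl }
  ; passS = λ { (flat₀ _) i → inj₂ (i , ≤-refl , λ ()) ; (flat₁ _) _ → inj₁ z<s
              ; tall i → ⊥-elim (<-irrefl refl i) ; (tall₀ i) _ → inj₂ (i , ≤-refl , λ ()) ; (tall₁ _) _ → inj₁ z<s }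
  ; passW = λ { (flat₀ _) i → ⊥-elim (<-irrefl refl i) ; (flat₁ _) _ → inj₁ z<s
              ; tall _ → inj₂ (≤-refl , ≤-refl , λ _ → refl)
              ; (tall₀ _) i → ⊥-elim (<-irrefl refl i) ; (tall₁ _) _ → inj₁ z<s } }

flipPropagation : ∀ {R} → Propagation R → Propagation (flipRule R)
flipPropagation B = record
  { not-strict = λ e e′ → not-strict e′ e
  ; enterE = enterN ; enterN = enterE ; passE = passN ; passN = passE
  ; enterS = enterW ; enterW = enterS ; passS = passW ; passW = passS }
  where open Propagation B

-- The flags describe the kind X.  Chains of the complementary kind Y are strict where
-- X is weak and conversely: after the cell (c, r) they go on in the columns from
-- nextCol c on and in the rows below nextRow r.
nextCol nextRow : Flag → ℕ → ℕ
nextCol weak   c = suc c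
nextCol strict c = c
nextRow weak   r = r
nextRow strict r = suc r

nextCol-mono : ∀ f {c c′} → c ≤ c′ → nextCol f c ≤ nextCol f c′
nextCol-mono weak   i = s≤s i
nextCol-mono strict i = i

nextRow-mono : ∀ f {r r′} → r ≤ r′ → nextRow f r ≤ nextRow f r′
nextRow-mono weak   i = i
nextRow-mono strict i = s≤s i

≤nextCol : ∀ f c → c ≤ nextCol f c
≤nextCol weak   c = n≤1+n c
≤nextCol strict c = ≤-refl

data Chain (f g : Flag) (m : Grid) (X : ℕ) : (L x y : ℕ) → Set where
  []   : ∀ {x y} → Chain f g m X 0 x y
  cons : ∀ {L x y} c r → x ≤ c → c < X → r < y → 0 < m c r →
         Chain f g m X L (nextCol f c) (nextRow g r) → Chain f g m X (suc L) x y

Chain-weaken : ∀ {f g m X L x y x′ y′} → x′ ≤ x → y ≤ y′ → Chain f g m X L x y → Chain f g m X L x′ y′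
Chain-weaken i j []                  = []
Chain-weaken i j (cons c r a b d e k) = cons c r (≤-trans i a) b (<-≤-trans d j) e k

-- `Has m L X Y` stands for a Y-chain of length at least `L` in the rectangle. Iterating the last
-- two fields turns length `L + 1` into positivity of `S` in layer `L`, that is, into more than `L`
-- parts. They start at length 2, since length 1 is compared with `S` directly.
record SecondStat (R : Rule) : Set₁ where
  open Growth R
  field
    Has      : Grid → (L X Y : ℕ) → Set
    Has⇒S    : ∀ {m X Y} → Valid m → Has m 1 X Y → 0 < S m X Y
    S⇒Has    : ∀ {m X Y} → Valid m → 0 < S m X Y → Has m 1 X Y
    Has-peel : ∀ {m L X Y} → Valid m → Has m (2 + L) X Y → Has (peel m) (1 + L) X Y
    peel-Has : ∀ {m L X Y} → Valid m → Has (peel m) (1 + L) X Y → Has m (2 + L) X Y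

  Has⇒layer : ∀ L {m X Y} → Valid m → Has m (suc L) X Y → 0 < S (layer L m) X Y
  Has⇒layer zero    v k = Has⇒S v k
  Has⇒layer (suc L) v k = Has⇒layer L (peel-valid v) (Has-peel v k)

  layer⇒Has : ∀ L {m X Y} → Valid m → 0 < S (layer L m) X Y → Has m (suc L) X Y
  layer⇒Has zero    v k = S⇒Has v k
  layer⇒Has (suc L) v k = peel-Has v (layer⇒Has L (peel-valid v) k)

S-cell : ∀ (R : Rule) {m} → Growth.Valid R m → ∀ X Y → 0 < Growth.S R m X Y →
         ∃₂ λ c r → c < X × r < Y × 0 < m c r
S-cell R {m} v = go
  where
  open Growth R
  go : ∀ X Y → 0 < S m X Y → ∃₂ λ c r → c < X × r < Y × 0 < m c r
  go (suc X) (suc Y) i with source-≡ (loc v X Y)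
  ... | inj₁ e = let c , r , a , b , d = go (suc X) Y (subst (0 <_) e i) in c , r , a , m<n⇒m<1+n b , d
  ... | inj₂ (inj₁ e) = let c , r , a , b , d = go X (suc Y) (subst (0 <_) e i) in c , r , m<n⇒m<1+n a , b , d
  ... | inj₂ (inj₂ (m>0 , _)) = X , Y , ≤-refl , ≤-refl , m>0

module Walks (R : Rule) (B : Propagation R) {m : Grid} (v : Growth.Valid R m) where
  open Growth R
  open Propagation B

  μ : Grid
  μ = peel m

  ℓ : ∀ x y → Cell-Loc μ (S m) m x y
  ℓ = loc v

  -- `passE` hands an increasing side on to the east until a nonzero entry of `μ` stops it. If none
  -- does, the last cell has a constant south side, which contradicts an increasing side that
  -- arrives there from the south.
  walkE : ∀ d c r → S m c r < S m c (suc r) →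
    (∃ λ c′ → c ≤ c′ × c′ ≤ d + c × 0 < μ c′ r) ⊎
    (S m (suc (d + c)) r ≤ S m (d + c) r × (vf ≡ strict → m (d + c) r ≡ 0))
  walkE d c r i with passE (ℓ c r) i
  ... | inj₁ k = inj₁ (c , ≤-refl , m≤n+m c d , k)
  walkE zero c r i | inj₂ (_ , j , k) = inj₂ (j , k)
  walkE (suc d) c r i | inj₂ (j , _) with walkE d (suc c) r j
  ... | inj₁ (c′ , a , b , k) = inj₁ (c′ , <⇒≤ a , ≤-trans b (≤-reflexive (+-suc d c)) , k)
  ... | inj₂ k rewrite +-suc d c = inj₂ k

  walkN : ∀ d c r → S m c r < S m (suc c) r →
    (∃ λ r′ → r ≤ r′ × r′ < d + r × 0 < μ c r′) ⊎ S m c (d + r) < S m (suc c) (d + r)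
  walkN zero    c r i = inj₂ i
  walkN (suc d) c r i with passN (ℓ c r) i
  ... | inj₁ k = inj₁ (r , ≤-refl , s≤s (m≤n+m r d) , k)
  ... | inj₂ (j , _) with walkN d c (suc r) j
  ...   | inj₁ (r′ , a , b , k) = inj₁ (r′ , <⇒≤ a , ≤-trans b (≤-reflexive (+-suc d r)) , k)
  ...   | inj₂ k rewrite +-suc d r = inj₂ k

  walkS : ∀ d c r → S m c (suc (d + r)) < S m (suc c) (suc (d + r)) →
    (∃ λ r′ → r ≤ r′ × r′ ≤ d + r × 0 < m c r′) ⊎
    (S m (suc c) (suc r) ≤ S m (suc c) r × (hf ≡ strict → μ c r ≡ 0))
  walkS d c r i with passS (ℓ c (d + r)) i
  ... | inj₁ k = inj₁ (d + r , m≤n+m r d , ≤-refl , k)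
  walkS zero    c r i | inj₂ (_ , k) = inj₂ k
  walkS (suc d) c r i | inj₂ (j , _) with walkS d c r j
  ... | inj₁ (r′ , a , b , k) = inj₁ (r′ , a , m≤n⇒m≤1+n b , k)
  ... | inj₂ k = inj₂ k

  walkW : ∀ d c r → S m (suc (d + c)) r < S m (suc (d + c)) (suc r) →
    (∃ λ c′ → c < c′ × c′ ≤ d + c × 0 < m c′ r) ⊎ S m (suc c) r < S m (suc c) (suc r)
  walkW zero    c r i = inj₂ i
  walkW (suc d) c r i with passW (ℓ (suc d + c) r) i
  ... | inj₁ k = inj₁ (suc d + c , s≤s (m≤n+m c d) , ≤-refl , k)
  ... | inj₂ (j , _) with walkW d c r j
  ...   | inj₁ (c′ , a , b , k) = inj₁ (c′ , a , m≤n⇒m≤1+n b , k)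
  ...   | inj₂ k = inj₂ k

  -- On the axis `S` is 0, so an increasing side that moves south must be stopped by an entry.
  endS : ∀ c r → S m c r < S m (suc c) r → ∃ λ r′ → r′ < r × 0 < m c r′
  endS c zero i = ⊥-elim (n≮0 i)
  endS c (suc r) i with passS (ℓ c r) i
  ... | inj₁ k = r , ≤-refl , k
  ... | inj₂ (j , _) = let r′ , a , b = endS c r j in r′ , m<n⇒m<1+n a , b

  endW : ∀ c r → S m c r < S m c (suc r) → ∃ λ c′ → c′ < c × 0 < m c′ r
  endW zero r i = ⊥-elim (n≮0 i)
  endW (suc c) r i with passW (ℓ c r) i
  ... | inj₁ k = c , ≤-refl , k
  ... | inj₂ (j , _) = let c′ , a , b = endW c r j in c′ , m<n⇒m<1+n a , b

  -- In a chain of m-cells, two consecutive ones have a cell of the peeled grid between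
  -- them: otherwise the increasing side east of the first one and the one north of the
  -- second one would propagate to the same cell.
  between : ∀ c₀ r₀ c₁ r₁ → nextCol hf c₀ ≤ c₁ → r₁ < nextRow vf r₀ → 0 < m c₀ r₀ → 0 < m c₁ r₁ →
    ∃₂ λ c r → nextCol hf c₀ ≤ c × c ≤ c₁ × r ≤ r₀ × r₁ < nextRow vf r × 0 < μ c r
  between c₀ r₀ c₁ r₁ i j m₀ m₁ = finish (goE hf refl i (enterE (ℓ c₀ r₀) m₀))
    where
    Flat : Set
    Flat = S m (suc c₁) r₀ ≤ S m c₁ r₀ × (vf ≡ strict → m c₁ r₀ ≡ 0)
    fromE : suc c₀ ≤ c₁ → S m (suc c₀) r₀ < S m (suc c₀) (suc r₀) →
      (∃ λ c → suc c₀ ≤ c × c ≤ c₁ × 0 < μ c r₀) ⊎ Flat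
    fromE i k with walkE (c₁ ∸ suc c₀) (suc c₀) r₀ k
    ... | w rewrite m∸n+n≡m i = w
    goE : ∀ f → hf ≡ f → nextCol f c₀ ≤ c₁ →
      By f (S m (suc c₀) r₀ < S m (suc c₀) (suc r₀))
           (0 < μ c₀ r₀ ⊎ (S m (suc c₀) r₀ < S m (suc c₀) (suc r₀) × S m (suc c₀) r₀ ≤ S m c₀ r₀)) →
      (∃ λ c → nextCol f c₀ ≤ c × c ≤ c₁ × 0 < μ c r₀) ⊎ Flat
    goE weak   e i k = fromE i k
    goE strict e i (inj₁ k) = inj₁ (c₀ , ≤-refl , i , k)
    goE strict e i (inj₂ (k , z)) with m≤n⇒m<n∨m≡n i
    ... | inj₁ i< = map₁ (λ (c , a , b) → c , <⇒≤ a , b) (fromE i< k)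
    ... | inj₂ refl = inj₂ (z , λ e′ → ⊥-elim (not-strict e e′))
    Goal : Flag → Set
    Goal g = ∃₂ λ c r → nextCol hf c₀ ≤ c × c ≤ c₁ × r ≤ r₀ × r₁ < nextRow g r × 0 < μ c r
    fromN : S m (suc c₁) r₀ ≤ S m c₁ r₀ → suc r₁ ≤ r₀ → S m c₁ (suc r₁) < S m (suc c₁) (suc r₁) → Goal weak
    fromN z i′ k with walkN (r₀ ∸ suc r₁) c₁ (suc r₁) k
    ... | w rewrite m∸n+n≡m i′ with w
    ...   | inj₁ (r , a , b , k) = c₁ , r , i , ≤-refl , <⇒≤ b , a , k
    ...   | inj₂ k = ⊥-elim (<⇒≱ k z)
    goN : Flat → ∀ g → vf ≡ g → r₁ < nextRow g r₀ →
      By g (S m c₁ (suc r₁) < S m (suc c₁) (suc r₁))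
           (0 < μ c₁ r₁ ⊎ (S m c₁ (suc r₁) < S m (suc c₁) (suc r₁) × S m c₁ (suc r₁) ≤ S m c₁ r₁)) → Goal g
    goN (z , _) weak   e j k = fromN z j k
    goN _ strict e j (inj₁ k) = c₁ , r₁ , i , ≤-refl , s≤s⁻¹ j , ≤-refl , k
    goN (z , z′) strict e j (inj₂ (k , _)) with m≤n⇒m<n∨m≡n (s≤s⁻¹ j)
    ... | inj₁ j< = let c , r , a , b , d , e , f = fromN z j< k in c , r , a , b , d , m<n⇒m<1+n e , f
    ... | inj₂ refl = ⊥-elim (<⇒≢ m₁ (sym (z′ e)))
    finish : (∃ λ c → nextCol hf c₀ ≤ c × c ≤ c₁ × 0 < μ c r₀) ⊎ Flat → Goal vf
    finish (inj₁ (c , a , b , k)) = c , r₀ , a , b , ≤-refl , j , k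
    finish (inj₂ z) = goN z vf refl j (enterN (ℓ c₁ r₁) m₁)

  -- The counterpart of `between`: without an entry of `m` on the way, the side moving south from
  -- the first cell shows that the cell `(c₁ , r₂)` has a constant east side, and the side moving
  -- west from the second cell shows that it increases.
  between′ : ∀ c₁ r₁ c₂ r₂ → nextCol hf c₁ ≤ c₂ → r₂ < nextRow vf r₁ → 0 < μ c₁ r₁ → 0 < μ c₂ r₂ →
    ∃₂ λ c r → c₁ ≤ c × nextCol hf c ≤ c₂ × r₂ ≤ r × r < nextRow vf r₁ × 0 < m c r
  between′ c₁ r₁ c₂ r₂ i j m₁ m₂ = finish (goS vf refl j (enterS (ℓ c₁ r₁) m₁))
    where
    Flat : Set
    Flat = S m (suc c₁) (suc r₂) ≤ S m (suc c₁) r₂ × (hf ≡ strict → μ c₁ r₂ ≡ 0)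
    fromS : suc r₂ ≤ r₁ → S m c₁ r₁ < S m (suc c₁) r₁ →
      (∃ λ r → r₂ ≤ r × r < r₁ × 0 < m c₁ r) ⊎ Flat
    fromS i′ k = map₁ (λ (r , a , b , d) → r , a , ≤-trans (s≤s b) (≤-reflexive e) , d)
      (walkS (r₁ ∸ suc r₂) c₁ r₂ (subst (λ z → S m c₁ z < S m (suc c₁) z) (sym e) k))
      where
      e : suc (r₁ ∸ suc r₂ + r₂) ≡ r₁
      e = trans (sym (+-suc _ r₂)) (m∸n+n≡m i′)
    goS : ∀ g → vf ≡ g → r₂ < nextRow g r₁ →
      By g (S m c₁ r₁ < S m (suc c₁) r₁)
           (0 < m c₁ r₁ ⊎ (S m c₁ r₁ < S m (suc c₁) r₁ × S m (suc c₁) (suc r₁) ≤ S m (suc c₁) r₁)) →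
      (∃ λ r → r₂ ≤ r × r < nextRow g r₁ × 0 < m c₁ r) ⊎ Flat
    goS weak   e j k = fromS j k
    goS strict e j (inj₁ k) = inj₁ (r₁ , s≤s⁻¹ j , ≤-refl , k)
    goS strict e j (inj₂ (k , z)) with m≤n⇒m<n∨m≡n (s≤s⁻¹ j)
    ... | inj₁ j< = map₁ (λ (r , a , b , d) → r , a , m<n⇒m<1+n b , d) (fromS j< k)
    ... | inj₂ refl = inj₂ (z , λ e′ → ⊥-elim (not-strict e′ e))
    Goal : Flag → Set
    Goal f = ∃₂ λ c r → c₁ ≤ c × nextCol f c ≤ c₂ × r₂ ≤ r × r < nextRow vf r₁ × 0 < m c r
    fromW : S m (suc c₁) (suc r₂) ≤ S m (suc c₁) r₂ → suc c₁ ≤ c₂ → S m c₂ r₂ < S m c₂ (suc r₂) → Goal weak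
    fromW z i′ k with walkW (c₂ ∸ suc c₁) c₁ r₂
      (subst (λ z → S m z r₂ < S m z (suc r₂)) (sym (trans (sym (+-suc _ c₁)) (m∸n+n≡m i′))) k)
    ... | inj₁ (c , a , b , k) = c , r₂ , <⇒≤ a ,
          ≤-trans (s≤s b) (≤-reflexive (trans (sym (+-suc _ c₁)) (m∸n+n≡m i′))) , ≤-refl , j , k
    ... | inj₂ k = ⊥-elim (<⇒≱ k z)
    goW : Flat → ∀ f → hf ≡ f → nextCol f c₁ ≤ c₂ →
      By f (S m c₂ r₂ < S m c₂ (suc r₂))
           (0 < m c₂ r₂ ⊎ (S m c₂ r₂ < S m c₂ (suc r₂) × S m (suc c₂) (suc r₂) ≤ S m c₂ (suc r₂))) → Goal f
    goW (z , _) weak   e i k = fromW z i k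
    goW _ strict e i (inj₁ k) = c₂ , r₂ , i , ≤-refl , ≤-refl , j , k
    goW (z , z′) strict e i (inj₂ (k , _)) with m≤n⇒m<n∨m≡n i
    ... | inj₁ i< = let c , r , a , b , d , e , f = fromW z i< k in c , r , a , <⇒≤ b , d , e , f
    ... | inj₂ refl = ⊥-elim (<⇒≢ m₂ (sym (z′ e)))
    finish : (∃ λ r → r₂ ≤ r × r < nextRow vf r₁ × 0 < m c₁ r) ⊎ Flat → Goal hf
    finish (inj₁ (r , a , b , k)) = c₁ , r , ≤-refl , i , a , b , k
    finish (inj₂ z) = goW z hf refl i (enterW (ℓ c₂ r₂) m₂)

  -- A chain of `L + 1` cells has `L` gaps, each filled by `between`. Cells from neighbouring gaps
  -- are separated by the common cell of `m`, so they form a chain again.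
  shrink : ∀ {L X} c₀ r₀ → 0 < m c₀ r₀ → Chain hf vf m X L (nextCol hf c₀) (nextRow vf r₀) →
           Chain hf vf μ X L (nextCol hf c₀) (suc r₀)
  shrink c₀ r₀ m₀ [] = []
  shrink c₀ r₀ m₀ (cons c₁ r₁ a b d e k) =
    let c , r , i₁ , i₂ , i₃ , i₄ , i₅ = between c₀ r₀ c₁ r₁ a d m₀ e in
    cons c r i₁ (≤-<-trans i₂ b) (s≤s i₃) i₅
      (Chain-weaken (nextCol-mono hf i₂) i₄ (shrink c₁ r₁ e k))

  -- `L + 1` cells of `μ` have `L` gaps for `between′`; a further cell lies in the column of the
  -- last one, at or under it, and `leading` adds one on the left of the first. This makes `L + 2`.
  grow : ∀ {L X} c₁ r₁ → c₁ < X → 0 < μ c₁ r₁ → Chain hf vf μ X L (nextCol hf c₁) (nextRow vf r₁) →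
         Chain hf vf m X (suc L) c₁ (nextRow vf r₁)
  grow c₁ r₁ b m₁ [] = let r , i , k = bottom vf (enterS (ℓ c₁ r₁) m₁) in cons c₁ r ≤-refl b i k []
    where
    bottom : ∀ g → By g (S m c₁ r₁ < S m (suc c₁) r₁)
           (0 < m c₁ r₁ ⊎ (S m c₁ r₁ < S m (suc c₁) r₁ × S m (suc c₁) (suc r₁) ≤ S m (suc c₁) r₁)) →
           ∃ λ r → r < nextRow g r₁ × 0 < m c₁ r
    bottom weak   k = endS c₁ r₁ k
    bottom strict (inj₁ k) = r₁ , ≤-refl , k
    bottom strict (inj₂ (k , _)) = let r , a , d = endS c₁ r₁ k in r , m<n⇒m<1+n a , d
  grow c₁ r₁ b m₁ (cons c₂ r₂ a b′ d e k) =
    let c , r , i₁ , i₂ , i₃ , i₄ , i₅ = between′ c₁ r₁ c₂ r₂ a d m₁ e in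
    cons c r i₁ (<-≤-trans (s≤s (≤-trans (≤nextCol hf c) i₂)) b′) i₄ i₅
      (Chain-weaken i₂ (nextRow-mono vf i₃) (grow c₂ r₂ b′ e k))

  leading : ∀ c₁ r₁ → 0 < μ c₁ r₁ → ∃ λ c → nextCol hf c ≤ c₁ × 0 < m c r₁
  leading c₁ r₁ m₁ = go hf (enterW (ℓ c₁ r₁) m₁)
    where
    go : ∀ f → By f (S m c₁ r₁ < S m c₁ (suc r₁))
           (0 < m c₁ r₁ ⊎ (S m c₁ r₁ < S m c₁ (suc r₁) × S m (suc c₁) (suc r₁) ≤ S m c₁ (suc r₁))) →
           ∃ λ c → nextCol f c ≤ c₁ × 0 < m c r₁
    go weak   k = endW c₁ r₁ k
    go strict (inj₁ k) = c₁ , ≤-refl , k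
    go strict (inj₂ (k , _)) = let c , a , d = endW c₁ r₁ k in c , <⇒≤ a , d

chainStat : ∀ {R} → Propagation R → SecondStat R
chainStat {R} B = record
  { Has = λ m L X Y → Chain hf vf m X L 0 Y
  ; Has⇒S = λ { v (cons c r _ a b k _) → <-≤-trans (S-pos v c r k) (S-mono v a b) }
  ; S⇒Has = λ {m} {X} {Y} v i → let c , r , a , b , k = S-cell R v X Y i in cons c r z≤n a b k []
  ; Has-peel = λ { v (cons c r _ a b e k) → Chain-weaken z≤n b (Walks.shrink R B v c r e k) }
  ; peel-Has = λ { v (cons c r _ a b e k) → let c₀ , i , j = Walks.leading R B v c r e in
      cons c₀ r z≤n (≤-<-trans (≤-trans (≤nextCol hf c₀) i) a) b j
        (Chain-weaken i ≤-refl (Walks.grow R B v c r a e k)) } }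
  where open Growth R

-- Complementary chains counted by weight

-- The largest weight of a lattice path going right and down inside the last d of
-- X columns and the first y rows.
maxPath : Grid → (X d y : ℕ) → ℕ
maxPath m X zero    y       = 0
maxPath m X (suc d) zero    = 0
maxPath m X (suc d) (suc y) = m (X ∸ suc d) y + (maxPath m X d (suc y) ⊔ maxPath m X (suc d) y)

maxPath-d0 : ∀ m X d → maxPath m X d 0 ≡ 0
maxPath-d0 m X zero    = refl
maxPath-d0 m X (suc d) = refl

maxPath-right : ∀ m X d y → maxPath m X d y ≤ maxPath m X (suc d) y
maxPath-right m X d zero rewrite maxPath-d0 m X d = z≤n
maxPath-right m X d (suc y) = ≤-trans (m≤m⊔n _ (maxPath m X (suc d) y)) (m≤n+m _ (m (X ∸ suc d) y))

maxPath-down : ∀ m X d y → maxPath m X d y ≤ maxPath m X d (suc y)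
maxPath-down m X zero    y = z≤n
maxPath-down m X (suc d) y = ≤-trans (m≤n⊔m (maxPath m X d (suc y)) _) (m≤n+m _ (m (X ∸ suc d) y))

maxPath-mono : ∀ m X {d d′ y y′} → d ≤ d′ → y ≤ y′ → maxPath m X d y ≤ maxPath m X d′ y′
maxPath-mono m X {d} {d′} {y} {y′} i j = ≤-trans (right i) (down j)
  where
  right : ∀ {d′} → d ≤ d′ → maxPath m X d y ≤ maxPath m X d′ y
  right {zero} z≤n = ≤-refl
  right {suc d′} i with m≤n⇒m<n∨m≡n i
  ... | inj₁ (s≤s i′) = ≤-trans (right i′) (maxPath-right m X d′ y)
  ... | inj₂ refl = ≤-refl
  down : ∀ {y′} → y ≤ y′ → maxPath m X d′ y ≤ maxPath m X d′ y′
  down {zero} z≤n = ≤-refl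
  down {suc y′} j with m≤n⇒m<n∨m≡n j
  ... | inj₁ (s≤s j′) = ≤-trans (down j′) (maxPath-down m X d′ y′)
  ... | inj₂ refl = ≤-refl

maxPath-cell : ∀ m X d y → 0 < maxPath m X d y → ∃₂ λ d′ r → d′ < d × r < y × 0 < m (X ∸ suc d′) r
maxPath-cell m X (suc d) (suc y) i with m (X ∸ suc d) y in eq
... | suc _ = d , y , ≤-refl , ≤-refl , subst (0 <_) (sym eq) z<s
... | zero with ⊔-sel (maxPath m X d (suc y)) (maxPath m X (suc d) y)
...   | inj₁ e = let d′ , r , a , b , k = maxPath-cell m X d (suc y) (subst (0 <_) e i) in d′ , r , m<n⇒m<1+n a , b , k
...   | inj₂ e = let d′ , r , a , b , k = maxPath-cell m X (suc d) y (subst (0 <_) e i) in d′ , r , a , m<n⇒m<1+n b , k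

maxPath-entry : ∀ m X Y {c r} → c < X → r < Y → m c r ≤ maxPath m X X Y
maxPath-entry m X Y {c} {r} i j = ≤-trans
  (≤-trans (≤-reflexive (cong (λ z → m z r) (sym c≡)))
    (m≤m+n _ _))
  (maxPath-mono m X {suc (X ∸ suc c)} (≤-trans (≤-reflexive (sym (+-∸-assoc 1 i))) (m∸n≤m X c)) j)
  where
  c≡ : X ∸ suc (X ∸ suc c) ≡ c
  c≡ = trans (cong (X ∸_) (sym (+-∸-assoc 1 i))) (m∸[m∸n]≡n (<⇒≤ i))

module _ (p q r t m m′ : ℕ) (conserve : m + (q + r) ≡ (p + t) + m′) where
  open +-*-Solver

  -- Adding `conserve` to the hypothesis and cancelling `t + q` moves a comparison from the east
  -- side of a cell to its west side. With `p` and `t` exchanged it moves from the south side to the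
  -- north side.
  shift : ∀ A B → A + t ≤ B + q → (m + A) + r ≤ (m′ + B) + p
  shift A B i = +-cancelʳ-≤ (t + q) _ _ (begin
    ((m + A) + r) + (t + q)   ≡⟨ solve 5 (λ m A r t q → ((m :+ A) :+ r) :+ (t :+ q) := (m :+ (q :+ r)) :+ (A :+ t)) refl m A r t q ⟩
    (m + (q + r)) + (A + t)   ≤⟨ +-mono-≤ (≤-reflexive conserve) i ⟩
    ((p + t) + m′) + (B + q)  ≡⟨ solve 5 (λ p t m′ B q → ((p :+ t) :+ m′) :+ (B :+ q) := ((m′ :+ B) :+ p) :+ (t :+ q)) refl p t m′ B q ⟩
    ((m′ + B) + p) + (t + q)  ∎)
    where open ≤-Reasoning

  shift⁻¹ : ∀ A B → B + q ≤ A + t → (m′ + B) + p ≤ (m + A) + r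
  shift⁻¹ A B i = +-cancelʳ-≤ (t + q) _ _ (begin
    ((m′ + B) + p) + (t + q)  ≡⟨ solve 5 (λ p t m′ B q → ((m′ :+ B) :+ p) :+ (t :+ q) := ((p :+ t) :+ m′) :+ (B :+ q)) refl p t m′ B q ⟩
    ((p + t) + m′) + (B + q)  ≤⟨ +-mono-≤ (≤-reflexive (sym conserve)) i ⟩
    (m + (q + r)) + (A + t)   ≡⟨ solve 5 (λ m A r t q → (m :+ (q :+ r)) :+ (A :+ t) := ((m :+ A) :+ r) :+ (t :+ q)) refl m A r t q ⟩
    ((m + A) + r) + (t + q)   ∎)
    where open ≤-Reasoning

loc₂-t≤ : ∀ {p q r t m m′} → Loc₂ p q r t m m′ → t ≤ suc p
loc₂-t≤ none  = n≤1+n _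
loc₂-t≤ fresh = ≤-refl
loc₂-t≤ east  = ≤-refl
loc₂-t≤ north = ≤-refl
loc₂-t≤ both  = ≤-refl

loc₂-t≥ : ∀ {p q r t m m′} → Loc₂ p q r t m m′ → suc p ≤ t ⊎ (m ≡ 0 × m′ ≡ 0)
loc₂-t≥ none  = inj₂ (refl , refl)
loc₂-t≥ fresh = inj₁ ≤-refl
loc₂-t≥ east  = inj₁ ≤-refl
loc₂-t≥ north = inj₁ ≤-refl
loc₂-t≥ both  = inj₁ ≤-refl

-- WR and WD are the best weights of a path after going right or down from a cell, for m
-- (unprimed) and for the peeled grid (primed).  The two weights of one path differ by
-- the increases of S along the sides where it enters and leaves, except when S is
-- constant around the cell; then the entry is 0 and the path may turn the other way.
module _ {p q r t m m′ : ℕ} (l : Loc₂ p q r t m m′) (WR WD WR′ WD′ : ℕ) where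
  private
    W  = m + (WR ⊔ WD)
    W′ = m′ + (WR′ ⊔ WD′)
    e : m + (q + r) ≡ (p + t) + m′
    e = loc₂-conserve l
    e′ : m + (q + r) ≡ (t + p) + m′
    e′ = trans e (cong (_+ m′) (+-comm p t))

    raise : ∀ {A B} → A ≤ suc B + p → suc p ≤ t → A ≤ B + t
    raise {B = B} i j = ≤-trans i (≤-trans (≤-reflexive (sym (+-suc B p))) (+-monoʳ-≤ B j))
    lower : ∀ {A B} → A ≤ B + t → A ≤ suc B + p
    lower {B = B} i = ≤-trans i (≤-trans (+-monoʳ-≤ B (loc₂-t≤ l)) (≤-reflexive (+-suc B p)))

  path-peel : WR + t ≤ suc WR′ + q → WD + p ≤ WD′ + q ⊎ WD ≤ WR →
              W + r ≤ suc W′ + p × (W + r ≤ W′ + t ⊎ W ≤ WR)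
  path-peel R D = go D (≤-total WD WR)
    where
    viaR : WD ≤ WR → W + r ≤ suc W′ + p × (W + r ≤ W′ + t ⊎ W ≤ WR)
    viaR i = C₁ , C₂ (loc₂-t≥ l)
      where
      C₁ : W + r ≤ suc W′ + p
      C₁ rewrite m≥n⇒m⊔n≡m i = ≤-trans (shift p q r t m m′ e WR (suc WR′) R)
        (+-monoˡ-≤ p (≤-trans (≤-reflexive (+-suc m′ WR′)) (s≤s (+-monoʳ-≤ m′ (m≤m⊔n WR′ WD′)))))
      C₂ : suc p ≤ t ⊎ (m ≡ 0 × m′ ≡ 0) → W + r ≤ W′ + t ⊎ W ≤ WR
      C₂ (inj₁ j) = inj₁ (raise C₁ j)
      C₂ (inj₂ (z , _)) rewrite z | m≥n⇒m⊔n≡m i = inj₂ ≤-refl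
    go : WD + p ≤ WD′ + q ⊎ WD ≤ WR → WD ≤ WR ⊎ WR ≤ WD → W + r ≤ suc W′ + p × (W + r ≤ W′ + t ⊎ W ≤ WR)
    go _        (inj₁ i) = viaR i
    go (inj₂ i) (inj₂ _) = viaR i
    go (inj₁ D) (inj₂ i) = lower C₂ , inj₁ C₂
      where
      C₂ : W + r ≤ W′ + t
      C₂ rewrite m≤n⇒m⊔n≡n i = ≤-trans (shift t q r p m m′ e′ WD WD′ D) (+-monoˡ-≤ t (+-monoʳ-≤ m′ (m≤n⊔m WR′ WD′)))

  peel-path : suc WR′ + q ≤ WR + t ⊎ WR′ ≤ WD′ → WD′ + q ≤ WD + p →
              W′ + t ≤ W + r × (suc W′ + p ≤ W + r ⊎ W′ ≤ WD′)
  peel-path R D = go R (≤-total WR′ WD′)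
    where
    viaD : WR′ ≤ WD′ → W′ + t ≤ W + r × (suc W′ + p ≤ W + r ⊎ W′ ≤ WD′)
    viaD i = C₁ , C₂ (loc₂-t≥ l)
      where
      C₁ : W′ + t ≤ W + r
      C₁ rewrite m≤n⇒m⊔n≡n i = ≤-trans (shift⁻¹ t q r p m m′ e′ WD WD′ D) (+-monoˡ-≤ r (+-monoʳ-≤ m (m≤n⊔m WR WD)))
      C₂ : suc p ≤ t ⊎ (m ≡ 0 × m′ ≡ 0) → suc W′ + p ≤ W + r ⊎ W′ ≤ WD′
      C₂ (inj₁ j) = inj₁ (≤-trans (raise {B = W′} ≤-refl j) C₁)
      C₂ (inj₂ (_ , z)) rewrite z | m≤n⇒m⊔n≡n i = inj₂ ≤-refl
    go : suc WR′ + q ≤ WR + t ⊎ WR′ ≤ WD′ → WR′ ≤ WD′ ⊎ WD′ ≤ WR′ →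
         W′ + t ≤ W + r × (suc W′ + p ≤ W + r ⊎ W′ ≤ WD′)
    go _        (inj₁ i) = viaD i
    go (inj₂ i) (inj₂ _) = viaD i
    go (inj₁ R) (inj₂ i) = ≤-trans (lower {B = W′} ≤-refl) C₂ , inj₁ C₂
      where
      C₂ : suc W′ + p ≤ W + r
      C₂ rewrite m≥n⇒m⊔n≡m i = ≤-trans (+-monoˡ-≤ p (≤-reflexive (sym (+-suc m′ WR′))))
        (≤-trans (shift⁻¹ p q r t m m′ e WR (suc WR′) R) (+-monoˡ-≤ r (+-monoʳ-≤ m (m≤m⊔n WR WD))))

module _ {m : Grid} (v : Growth.Valid rule₂ m) (X : ℕ) where
  open Growth rule₂

  private
    σ : ℕ → ℕ → ℕ
    σ d y = S m (X ∸ d) y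
    V V′ : ℕ → ℕ → ℕ
    V  = maxPath m X
    V′ = maxPath (peel m) X
    cell : ∀ d y → d < X → Loc₂ (σ (suc d) y) (σ d y) (σ (suc d) (suc y)) (σ d (suc y))
                                (m (X ∸ suc d) y) (peel m (X ∸ suc d) y)
    cell d y i = subst (λ z → Loc₂ (σ (suc d) y) (S m z y) (σ (suc d) (suc y)) (S m z (suc y))
                                    (m (X ∸ suc d) y) (peel m (X ∸ suc d) y))
                   (sym (+-∸-assoc 1 i)) (loc v (X ∸ suc d) y)
    σ-step : ∀ d y → σ d (suc y) ≤ suc (σ d y)
    σ-step d y = Step⇒≤suc (edgeV {m} v (X ∸ d) y)
    σ-d0 : ∀ d → σ d 0 ≡ 0
    σ-d0 d = S-x0 m (X ∸ d)
    σ-Xy : ∀ y → σ X y ≡ 0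
    σ-Xy y rewrite n∸n≡0 X = refl

  -- The three statements follow the recursion of `maxPath`: a cell needs the comparison at the west
  -- side of its right neighbour and the one at the north side of the cell below.
  path-left : ∀ d y → d ≤ X → V d (suc y) + σ d (suc y) ≤ suc (V′ d (suc y)) + σ d y
  path-above : ∀ d y → d < X → V (suc d) y + σ (suc d) y ≤ V′ (suc d) y + σ d y ⊎ V (suc d) y ≤ V d y
  path-step : ∀ d y → d < X →
    V (suc d) (suc y) + σ (suc d) (suc y) ≤ suc (V′ (suc d) (suc y)) + σ (suc d) y ×
    (V (suc d) (suc y) + σ (suc d) (suc y) ≤ V′ (suc d) (suc y) + σ d (suc y) ⊎ V (suc d) (suc y) ≤ V d (suc y))
  path-left zero    y i = σ-step 0 y
  path-left (suc d) y i = proj₁ (path-step d y i)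
  path-above d zero i rewrite σ-d0 d | σ-d0 (suc d) = inj₁ z≤n
  path-above d (suc y) i = proj₂ (path-step d y i)
  path-step d y i = path-peel (cell d y i) (V d (suc y)) (V (suc d) y) (V′ d (suc y)) (V′ (suc d) y)
    (path-left d y (<⇒≤ i)) (map₂ (λ k → ≤-trans k (maxPath-down m X d y)) (path-above d y i))

  -- At the west edge of the rectangle `S` is 0, so the terms in `S` drop out of `path-left`.
  maxPath-peel : ∀ Y → V X Y ≤ suc (V′ X Y)
  maxPath-peel zero = ≤-trans (≤-reflexive (maxPath-d0 m X X)) z≤n
  maxPath-peel (suc Y) = begin
    V X (suc Y)                ≤⟨ m≤m+n _ _ ⟩
    V X (suc Y) + σ X (suc Y)  ≤⟨ path-left X Y ≤-refl ⟩
    suc (V′ X (suc Y)) + σ X Y ≡⟨ cong (suc (V′ X (suc Y)) +_) (σ-Xy Y) ⟩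
    suc (V′ X (suc Y)) + 0     ≡⟨ +-identityʳ _ ⟩
    suc (V′ X (suc Y))         ∎
    where open ≤-Reasoning

  path-above′ : ∀ d y → d < X → V′ (suc d) y + σ d y ≤ V (suc d) y + σ (suc d) y
  path-left′ : ∀ d y → d ≤ X → suc (V′ d (suc y)) + σ d y ≤ V d (suc y) + σ d (suc y) ⊎ V′ d (suc y) ≤ V′ d y
  path-step′ : ∀ d y → d < X →
    V′ (suc d) (suc y) + σ d (suc y) ≤ V (suc d) (suc y) + σ (suc d) (suc y) ×
    (suc (V′ (suc d) (suc y)) + σ (suc d) y ≤ V (suc d) (suc y) + σ (suc d) (suc y) ⊎ V′ (suc d) (suc y) ≤ V′ (suc d) y)
  path-above′ d zero i rewrite σ-d0 d | σ-d0 (suc d) = z≤n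
  path-above′ d (suc y) i = proj₁ (path-step′ d y i)
  path-left′ zero    y i = inj₂ z≤n
  path-left′ (suc d) y i = proj₂ (path-step′ d y i)
  path-step′ d y i = peel-path (cell d y i) (V d (suc y)) (V (suc d) y) (V′ d (suc y)) (V′ (suc d) y)
    (map₂ (λ k → ≤-trans k (maxPath-right (peel m) X d y)) (path-left′ d y (<⇒≤ i))) (path-above′ d y i)

  -- Either `path-left′` gives the gain of one, again with `S` zero at the west edge, or the top row
  -- contributes nothing and is removed. Positivity keeps the removal from reaching an empty
  -- rectangle.
  peel-maxPath : ∀ Y → 0 < V′ X Y → suc (V′ X Y) ≤ V X Y
  peel-maxPath zero i = ⊥-elim (<⇒≢ i (sym (maxPath-d0 (peel m) X X)))
  peel-maxPath (suc Y) i with path-left′ X Y ≤-refl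
  ... | inj₁ k = begin
    suc (V′ X (suc Y))         ≤⟨ m≤m+n _ _ ⟩
    suc (V′ X (suc Y)) + σ X Y ≤⟨ k ⟩
    V X (suc Y) + σ X (suc Y)  ≡⟨ cong (V X (suc Y) +_) (σ-Xy (suc Y)) ⟩
    V X (suc Y) + 0            ≡⟨ +-identityʳ _ ⟩
    V X (suc Y)                ∎
    where open ≤-Reasoning
  ... | inj₂ k = ≤-trans (s≤s k) (≤-trans (peel-maxPath Y (<-≤-trans i k)) (maxPath-down m X X Y))

pathStat : SecondStat rule₂
pathStat = record
  { Has = λ m L X Y → L ≤ maxPath m X X Y
  ; Has⇒S = λ {m} {X} {Y} v k → let d , r , a , b , e = maxPath-cell m X X Y k in
      <-≤-trans (S-pos v (X ∸ suc d) r e) (S-mono v (column< a) b)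
  ; S⇒Has = λ {m} {X} {Y} v k → let c , r , a , b , e = S-cell rule₂ v X Y k in
      ≤-trans e (maxPath-entry m X Y a b)
  ; Has-peel = λ {m} {L} {X} {Y} v k → s≤s⁻¹ (≤-trans k (maxPath-peel v X Y))
  ; peel-Has = λ {m} {L} {X} {Y} v k → ≤-trans (s≤s k) (peel-maxPath v X Y (≤-trans z<s k)) }
  where
  open Growth rule₂
  column< : ∀ {d X} → d < X → suc (X ∸ suc d) ≤ X
  column< {d} {X} i = ≤-trans (≤-reflexive (sym (+-∸-assoc 1 i))) (m∸n≤m X d)

-- Finite lists

∈-remove : ∀ {A : Set} {x y : A} (xs : List A) {zs} → y ≢ x → y ∈ xs ++ x ∷ zs → y ∈ xs ++ zs
∈-remove []       ne (here e)  = ⊥-elim (ne e)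
∈-remove []       ne (there i) = i
∈-remove (w ∷ xs) ne (here e)  = here e
∈-remove (w ∷ xs) ne (there i) = there (∈-remove xs ne i)

unique-⊆⇒length-≤ : ∀ {A : Set} {xs ys : List A} → Unique xs → (∀ {x} → x ∈ xs → x ∈ ys) → length xs ≤ length ys
unique-⊆⇒length-≤ [] s = z≤n
unique-⊆⇒length-≤ {xs = x ∷ xs} (x∉ ∷ u) s with ∈-∃++ (s (here refl))
... | as , bs , refl = ≤-trans
  (s≤s (unique-⊆⇒length-≤ u λ {y} y∈ → ∈-remove as (λ e → All.lookup x∉ y∈ (sym e)) (s (there y∈))))
  (≤-reflexive (trans (cong suc (length-++ as)) (trans (sym (+-suc (length as) (length bs))) (sym (length-++ as)))))

maximum : List ℕ → ℕ
maximum = foldr _⊔_ 0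

∈⇒≤maximum : ∀ {x xs} → x ∈ xs → x ≤ maximum xs
∈⇒≤maximum {xs = y ∷ ys} (here refl) = m≤m⊔n y _
∈⇒≤maximum {xs = y ∷ ys} (there i)   = ≤-trans (∈⇒≤maximum i) (m≤n⊔m y _)

maximum-∈ : ∀ xs → 0 < maximum xs → maximum xs ∈ xs
maximum-∈ (x ∷ xs) i with ⊔-sel x (maximum xs)
... | inj₁ e = here e
... | inj₂ e = there (subst (_∈ xs) (sym e) (maximum-∈ xs (subst (0 <_) e i)))

∈-listsUpTo : ∀ {A : Set} {xs : List A} k {ys} → length ys ≤ k → All (_∈ xs) ys → ys ∈ listsUpTo k xs
∈-listsUpTo zero    {[]} _ _ = here refl
∈-listsUpTo (suc k) {[]} _ _ = here refl
∈-listsUpTo {xs = xs} (suc k) {y ∷ ys} (s≤s l) (y∈ ∷ ys∈) =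
  there (∈-concatMap⁺ (λ x → map (x ∷_) (listsUpTo k xs))
    (Any.map (λ { refl → ∈-map⁺ (y ∷_) (∈-listsUpTo k l ys∈) }) y∈))

∧-to : ∀ {x y} → T (x ∧ y) → T x × T y
∧-to = Equivalence.to T-∧

∧-from : ∀ {x y} → T x → T y → T (x ∧ y)
∧-from a b = Equivalence.from T-∧ (a , b)

-- Cells of a shape, numbered from 0

Point : Set
Point = ℕ × ℕ

shift⁺ : Point → Cell
shift⁺ (c , r) = suc c , suc r

shift⁺-injective : ∀ {p q} → shift⁺ p ≡ shift⁺ q → p ≡ q
shift⁺-injective refl = refl

heights : Shape → ℕ → ℕ
heights hs x = nth hs x 0

grid : Filling → Grid
grid f x y = nth (nth f x []) y 0

nth-≤length : ∀ (hs : List ℕ) {x y} → y < nth hs x 0 → x < length hs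
nth-≤length (h ∷ hs) {zero}  _ = z<s
nth-≤length (h ∷ hs) {suc x} i = s≤s (nth-≤length hs i)

InShape : Shape → Point → Set
InShape hs (c , r) = r < heights hs c

inF⁻ : ∀ hs z → T (inF hs z) → ∃ λ p → z ≡ shift⁺ p × InShape hs p
inF⁻ hs (suc c , suc r) i = (c , r) , refl ,
  ≤ᵇ⇒≤ (suc r) _ (proj₂ (∧-to {c <ᵇ length hs} i))
inF⁻ hs (suc c , zero) i = ⊥-elim (proj₂ (∧-to {c <ᵇ length hs} i))

inF⁺ : ∀ hs p → InShape hs p → T (inF hs (shift⁺ p))
inF⁺ hs (c , r) i = ∧-from {c <ᵇ length hs} (<⇒<ᵇ (nth-≤length hs i)) (≤⇒≤ᵇ i)

∈-range : ∀ {a b x} → a ≤ x → x ≤ b → x ∈ range a b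
∈-range {a} {b} {x} i j = subst (_∈ range a b) (m+[n∸m]≡n i)
  (∈-map⁺ (a +_) (∈-upTo⁺ (≤-trans (≤-reflexive (sym (+-∸-assoc 1 i))) (∸-monoˡ-≤ a (s≤s j)))))

range-∈ : ∀ {a b x} → x ∈ range a b → a ≤ x × x ≤ b
range-∈ {a} {b} i with ∈-map⁻ (a +_) i
... | k , k∈ , refl = m≤m+n a k , s≤s⁻¹ (≤-trans (≤-reflexive (sym (+-suc a k)))
      (≤-trans (+-monoʳ-≤ a (∈-upTo⁻ k∈)) (≤-reflexive (m+[n∸m]≡n (a≤ (suc b) (≤-<-trans z≤n (∈-upTo⁻ k∈)))))))
  where
  a≤ : ∀ b → 0 < b ∸ a → a ≤ b
  a≤ b i with a ≤? b
  ... | yes p = p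
  ... | no ¬p = ⊥-elim (<⇒≢ i (sym (m≤n⇒m∸n≡0 (<⇒≤ (≰⇒> ¬p)))))

∈-cells : ∀ hs p → InShape hs p → shift⁺ p ∈ cells hs
∈-cells hs (c , r) i = ∈-concatMap⁺ (λ c → map (λ r → (c , r)) (range 1 (height hs c)))
  (Any.map (λ { refl → ∈-map⁺ (suc c ,_) (∈-range (s≤s z≤n) i) })
    (∈-range (s≤s z≤n) (nth-≤length hs i)))

record Points (hs : Shape) (m : Grid) (_~_ : Point → Point → Set) (ps : List Point) : Set where
  constructor points
  field
    inside  : All (InShape hs) ps
    nonzero : All (λ (c , r) → 0 < m c r) ps
    unique  : Unique ps
    linked  : Linked _~_ ps

totalWeight : Bool → Grid → List Point → ℕ
totalWeight w m ps = sum (map (λ (c , r) → weight w (m c r)) ps)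

==ᶜ-refl : ∀ z → T (z ==ᶜ z)
==ᶜ-refl (a , b) = ∧-from (≡⇒≡ᵇ a a refl) (≡⇒≡ᵇ b b refl)

==ᶜ⇒≡ : ∀ z w → T (z ==ᶜ w) → z ≡ w
==ᶜ⇒≡ (a , b) (c , d) i = let x , y = ∧-to {a ≡ᵇ c} i in cong₂ _,_ (≡ᵇ⇒≡ a c x) (≡ᵇ⇒≡ b d y)

not-T : ∀ {b} → T (not b) → ¬ T b
not-T {false} _ ()

T-not : ∀ {b} → ¬ T b → T (not b)
T-not {false} _ = tt
T-not {true}  n = ⊥-elim (n tt)

distinct⁻ : ∀ ps → T (distinct (map shift⁺ ps)) → Unique ps
distinct⁻ []       _ = []
distinct⁻ (p ∷ ps) i = let a , b = ∧-to {not (any (shift⁺ p ==ᶜ_) (map shift⁺ ps))} i in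
  All.tabulate (λ {q} q∈ e → not-T a (any⁺ (shift⁺ p ==ᶜ_)
    (Any.map (λ { refl → subst (λ z → T (shift⁺ p ==ᶜ shift⁺ z)) e (==ᶜ-refl (shift⁺ p)) }) (∈-map⁺ shift⁺ q∈)))) ∷
  distinct⁻ ps b

distinct⁺ : ∀ ps → Unique ps → T (distinct (map shift⁺ ps))
distinct⁺ []       _ = tt
distinct⁺ (p ∷ ps) (p∉ ∷ u) = ∧-from {not (any (shift⁺ p ==ᶜ_) (map shift⁺ ps))}
  (T-not λ i → go (∈-map⁻ shift⁺ (Any.map (==ᶜ⇒≡ (shift⁺ p) _) (any⁻ (shift⁺ p ==ᶜ_) (map shift⁺ ps) i))))
  (distinct⁺ ps u)
  where
  go : (∃ λ q → q ∈ ps × shift⁺ p ≡ shift⁺ q) → ⊥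
  go (q , q∈ , e) = All.lookup p∉ q∈ (shift⁺-injective e)

consecutive⁻ : ∀ {R} {_~_ : Point → Point → Set} → (∀ p q → T (R (shift⁺ p) (shift⁺ q)) → p ~ q) → ∀ ps →
               T (consecutive R (map shift⁺ ps)) → Linked _~_ ps
consecutive⁻ f []           _ = []
consecutive⁻ f (p ∷ [])     _ = [-]
consecutive⁻ {R} f (p ∷ q ∷ ps) i =
  let a , b = ∧-to {R (shift⁺ p) (shift⁺ q)} i in f p q a ∷ consecutive⁻ f (q ∷ ps) b

consecutive⁺ : ∀ {R} {_~_ : Point → Point → Set} → (∀ p q → p ~ q → T (R (shift⁺ p) (shift⁺ q))) → ∀ {ps} →
               Linked _~_ ps → T (consecutive R (map shift⁺ ps))
consecutive⁺ f []      = tt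
consecutive⁺ f [-]     = tt
consecutive⁺ {R} f {p ∷ q ∷ _} (a ∷ l) = ∧-from {R (shift⁺ p) (shift⁺ q)} (f p q a) (consecutive⁺ f l)

cells⇒points : ∀ hs cs → All (T ∘ inF hs) cs → ∃ λ ps → cs ≡ map shift⁺ ps × All (InShape hs) ps
cells⇒points hs []       []       = [] , refl , []
cells⇒points hs (z ∷ cs) (i ∷ is) with inF⁻ hs z i | cells⇒points hs cs is
... | p , refl , pin | ps , refl , psin = p ∷ ps , refl , pin ∷ psin

nonzero⁻ : ∀ n → T (not (n ≡ᵇ 0)) → 0 < n
nonzero⁻ (suc n) _ = z<s

nonzero⁺ : ∀ n → 0 < n → T (not (n ≡ᵇ 0))
nonzero⁺ (suc n) _ = tt

module Decode (k : ChainKind) (hs : Shape) (f : Filling) (_~_ : Point → Point → Set)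
  (rel⁻ : ∀ p q → T (ChainKind.rel k (shift⁺ p) (shift⁺ q)) → p ~ q)
  (rel⁺ : ∀ p q → p ~ q → T (ChainKind.rel k (shift⁺ p) (shift⁺ q))) where
  open ChainKind k

  RectIn : List Point → Set
  RectIn ps = T (if downward then rectIn hs (map shift⁺ ps) else true)

  decode : ∀ cs → T (isChain k hs f cs) → ∃ λ ps → cs ≡ map shift⁺ ps × Points hs (grid f) _~_ ps × RectIn ps
  decode cs i with ∧-to {all (inF hs) cs} i
  ... | i₁ , j₁ with ∧-to {all (λ x → not (entry f x ≡ᵇ 0)) cs} j₁
  ... | i₂ , j₂ with ∧-to {distinct cs} j₂
  ... | i₃ , j₃ with ∧-to {consecutive rel cs} j₃
  ... | i₄ , i₅ with cells⇒points hs cs (all⁺ (inF hs) cs i₁)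
  ... | ps , refl , ins = ps , refl ,
    points ins (All.map (nonzero⁻ _) (All-map⁻ (all⁺ (λ x → not (entry f x ≡ᵇ 0)) (map shift⁺ ps) i₂)))
      (distinct⁻ ps i₃) (consecutive⁻ rel⁻ ps i₄) , i₅

  encode : ∀ ps → Points hs (grid f) _~_ ps → RectIn ps → T (isChain k hs f (map shift⁺ ps))
  encode ps (points a b c d) e =
    ∧-from {all (inF hs) (map shift⁺ ps)} (all⁻ (inF hs) (All-map⁺ (All.map (λ {p} → inF⁺ hs p) a)))
      (∧-from {all (λ x → not (entry f x ≡ᵇ 0)) (map shift⁺ ps)}
        (all⁻ (λ x → not (entry f x ≡ᵇ 0)) (All-map⁺ (All.map (nonzero⁺ _) b)))
        (∧-from {distinct (map shift⁺ ps)} (distinct⁺ ps c)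
          (∧-from {consecutive rel (map shift⁺ ps)} (consecutive⁺ rel⁺ d) e)))

  -- The entries are nonzero, so counting cells amounts to adding the indicators `[ m >0]`.
  chainLength-points : ∀ {ps} → All (λ (c , r) → 0 < grid f c r) ps →
    chainLength k f (map shift⁺ ps) ≡ totalWeight weighted (grid f) ps
  chainLength-points nz with weighted
  ... | true  = sums nz
    where
    sums : ∀ {ps} → All (λ (c , r) → 0 < grid f c r) ps →
           sum (map (entry f) (map shift⁺ ps)) ≡ totalWeight true (grid f) ps
    sums []       = refl
    sums (_ ∷ nz) = cong (_ +_) (sums nz)
  ... | false = counts nz
    where
    counts : ∀ {ps} → All (λ (c , r) → 0 < grid f c r) ps →
             length (map shift⁺ ps) ≡ totalWeight false (grid f) ps
    counts [] = refl
    counts {(c , r) ∷ _} (i ∷ nz) with grid f c r | i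
    ... | suc _ | _ = cong suc (counts nz)

  candidates chains : List (List Cell)
  candidates = listsUpTo (length (cells hs)) (cells hs)
  chains     = filter (λ cs → T? (isChain k hs f cs)) candidates

  longest⁻ : ∀ L → suc L ≤ longest k hs f →
    ∃ λ ps → Points hs (grid f) _~_ ps × RectIn ps × suc L ≤ totalWeight weighted (grid f) ps
  longest⁻ L i with ∈-map⁻ (chainLength k f) {xs = chains} (maximum-∈ (map (chainLength k f) chains) (≤-trans z<s i))
  ... | cs , cs∈ , e with decode cs (proj₂ (∈-filter⁻ (λ cs → T? (isChain k hs f cs)) {xs = candidates} cs∈))
  ... | ps , refl , P , rect = ps , P , rect ,
    ≤-trans i (≤-reflexive (trans e (chainLength-points (Points.nonzero P))))

  longest⁺ : ∀ ps → Points hs (grid f) _~_ ps → RectIn ps → totalWeight weighted (grid f) ps ≤ longest k hs f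
  longest⁺ ps P rect = ≤-trans (≤-reflexive (sym (chainLength-points (Points.nonzero P))))
    (∈⇒≤maximum (∈-map⁺ (chainLength k f) (∈-filter⁺ (λ cs → T? (isChain k hs f cs))
      (∈-listsUpTo (length (cells hs)) (unique-⊆⇒length-≤ (Unique.map⁺ shift⁺-injective (Points.unique P))
          (λ i → All.lookup cs∈ i)) cs∈)
      (encode ps P rect))))
    where
    cs∈ : All (_∈ cells hs) (map shift⁺ ps)
    cs∈ = All-map⁺ (All.map (λ {p} → ∈-cells hs p) (Points.inside P))

-- Kinds of chains described by flags

Le : Flag → ℕ → ℕ → Set
Le weak   = _≤_
Le strict = _<_

<⇒Le : ∀ f {a b} → a < b → Le f a b
<⇒Le weak   = <⇒≤
<⇒Le strict i = i

Le⇒≤ : ∀ f {a b} → Le f a b → a ≤ b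
Le⇒≤ weak   i = i
Le⇒≤ strict   = <⇒≤

Up Down : Flag → Flag → Point → Point → Set
Up   f g (c , r) (c′ , r′) = Le f c c′ × Le g r r′
Down f g (c , r) (c′ , r′) = Le (dual f) c c′ × Le (dual g) r′ r

-- Spelled out by cases, so that `upKind` and `downKind` reduce to the kinds of the theorem: two
-- weak flags give `NE` and `se`, two strict ones `ne` and `SE`.
upRel downRel : Flag → Flag → Cell → Cell → Bool
upRel weak   weak   = NEr
upRel weak   strict = nEr
upRel strict weak   = Ner
upRel strict strict = ner
downRel weak   weak   = ser
downRel weak   strict = Ser
downRel strict weak   = sEr
downRel strict strict = SEr

upKind downKind : Flag → Flag → ChainKind
upKind   f g = kind (upRel f g) false (isWeighted f g)
downKind f g = kind (downRel f g) true (isWeighted (dual f) (dual g))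

leᵇ : Flag → ℕ → ℕ → Bool
leᵇ weak   a b = a ≤ᵇ b
leᵇ strict a b = a <ᵇ b

leᵇ⁻ : ∀ f a b → T (leᵇ f (suc a) (suc b)) → Le f a b
leᵇ⁻ weak   a b i = s≤s⁻¹ (≤ᵇ⇒≤ (suc a) (suc b) i)
leᵇ⁻ strict a b i = <ᵇ⇒< a b i

leᵇ⁺ : ∀ f a b → Le f a b → T (leᵇ f (suc a) (suc b))
leᵇ⁺ weak   a b i = ≤⇒≤ᵇ (s≤s i)
leᵇ⁺ strict a b i = <⇒<ᵇ i

upRel-leᵇ : ∀ f g c r c′ r′ → upRel f g (c , r) (c′ , r′) ≡ leᵇ g r r′ ∧ leᵇ f c c′
upRel-leᵇ weak   weak   c r c′ r′ = refl
upRel-leᵇ weak   strict c r c′ r′ = refl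
upRel-leᵇ strict weak   c r c′ r′ = refl
upRel-leᵇ strict strict c r c′ r′ = refl

downRel-leᵇ : ∀ f g c r c′ r′ → downRel f g (c , r) (c′ , r′) ≡ leᵇ (dual g) r′ r ∧ leᵇ (dual f) c c′
downRel-leᵇ weak   weak   c r c′ r′ = refl
downRel-leᵇ weak   strict c r c′ r′ = refl
downRel-leᵇ strict weak   c r c′ r′ = refl
downRel-leᵇ strict strict c r c′ r′ = refl

upRel⁻ : ∀ f g p q → T (upRel f g (shift⁺ p) (shift⁺ q)) → Up f g p q
upRel⁻ f g (c , r) (c′ , r′) i rewrite upRel-leᵇ f g (suc c) (suc r) (suc c′) (suc r′) =
  let a , b = ∧-to {leᵇ g (suc r) (suc r′)} i in leᵇ⁻ f c c′ b , leᵇ⁻ g r r′ a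

upRel⁺ : ∀ f g p q → Up f g p q → T (upRel f g (shift⁺ p) (shift⁺ q))
upRel⁺ f g (c , r) (c′ , r′) (a , b) rewrite upRel-leᵇ f g (suc c) (suc r) (suc c′) (suc r′) =
  ∧-from {leᵇ g (suc r) (suc r′)} (leᵇ⁺ g r r′ b) (leᵇ⁺ f c c′ a)

downRel⁻ : ∀ f g p q → T (downRel f g (shift⁺ p) (shift⁺ q)) → Down f g p q
downRel⁻ f g (c , r) (c′ , r′) i rewrite downRel-leᵇ f g (suc c) (suc r) (suc c′) (suc r′) =
  let a , b = ∧-to {leᵇ (dual g) (suc r′) (suc r)} i in leᵇ⁻ (dual f) c c′ b , leᵇ⁻ (dual g) r′ r a

downRel⁺ : ∀ f g p q → Down f g p q → T (downRel f g (shift⁺ p) (shift⁺ q))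
downRel⁺ f g (c , r) (c′ , r′) (a , b) rewrite downRel-leᵇ f g (suc c) (suc r) (suc c′) (suc r′) =
  ∧-from {leᵇ (dual g) (suc r′) (suc r)} (leᵇ⁺ (dual g) r′ r b) (leᵇ⁺ (dual f) c c′ a)

linked-cons : ∀ {A : Set} {_~_ : A → A → Set} {x xs} → All (x ~_) xs → Linked _~_ xs → Linked _~_ (x ∷ xs)
linked-cons []      _ = [-]
linked-cons (i ∷ _) l = i ∷ l

-- Chains of the first kind

module UpChains (R : Rule) (hs : Shape) {m : Grid} (v : Growth.Valid R m) where
  open Growth R

  private
    w = isWeighted hf vf
    _≺_ = Up hf vf
    Chn = Points hs m _≺_

  -- In a strict direction the preceding rectangle can end before the new cell. If both directions
  -- are weak, the cells differ in some coordinate, which decides between `nw` and `se′`.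
  chooseSource : ∀ {c r c′ r′} → (c , r) ≺ (c′ , r′) → (c , r) ≢ (c′ , r′) →
    ∃ λ s → IsSource hf vf s × S m (suc c) (suc r) ≤ source s (S m c′ r′) (S m (suc c′) r′) (S m c′ (suc r′))
  chooseSource {c} {r} {c′} {r′} (i , j) ne = go hf vf i j
    where
    go : ∀ f g → Le f c c′ → Le g r r′ → ∃ λ s → IsSource f g s ×
         S m (suc c) (suc r) ≤ source s (S m c′ r′) (S m (suc c′) r′) (S m c′ (suc r′))
    go strict strict i j = sw , tt , S-mono v i j
    go weak   strict i j = se′ , tt , S-mono v (s≤s i) j
    go strict weak   i j = nw , tt , S-mono v i (s≤s j)
    go weak   weak   i j with m≤n⇒m<n∨m≡n i | m≤n⇒m<n∨m≡n j
    ... | inj₁ i<   | _         = nw , tt , S-mono v i< (s≤s j)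
    ... | _         | inj₁ j<   = se′ , tt , S-mono v (s≤s i) j<
    ... | inj₂ refl | inj₂ refl = ⊥-elim (ne refl)

  follow : ∀ {c r} ps A → A ≤ S m (suc c) (suc r) → Chn ((c , r) ∷ ps) →
    ∃₂ λ c′ r′ → InShape hs (c′ , r′) × A + totalWeight w m ps ≤ S m (suc c′) (suc r′)
  follow {c} {r} [] A i (points (a ∷ _) _ _ _) = c , r , a , ≤-trans (≤-reflexive (+-identityʳ A)) i
  follow {c} {r} ((c₁ , r₁) ∷ ps) A i (points (_ ∷ as) (_ ∷ n ∷ ns) ((ne ∷ _) ∷ us) (l ∷ ls)) =
    let s , is , k = chooseSource l ne
        c′ , r′ , x , y = follow ps (A + weight w (m c₁ r₁))
          (≤-trans (+-monoˡ-≤ _ (≤-trans i k)) (source-≤ s (loc v c₁ r₁) n is)) (points as (n ∷ ns) us ls)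
    in c′ , r′ , x , ≤-trans (≤-reflexive (sym (+-assoc A _ _))) y

  chain-≤ : ∀ L ps → Chn ps → suc L ≤ totalWeight w m ps →
    ∃₂ λ c r → InShape hs (c , r) × suc L ≤ S m (suc c) (suc r)
  chain-≤ L ((c , r) ∷ ps) C@(points _ (n ∷ _) _ _) i =
    let s , is = hasSource hf vf
        c′ , r′ , x , y = follow ps (weight w (m c r)) (≤-trans (m≤n+m _ _) (source-≤ s (loc v c r) n is)) C
    in c′ , r′ , x , ≤-trans i y

  -- The invariant of the trace in `extend`: any cell of the rectangle still to be searched may be
  -- put in front of the chain found so far.
  Room : ℕ → ℕ → List Point → Set
  Room x y ps = ∀ c r → c < x → r < y →
    InShape hs (c , r) × All (λ q → (c , r) ≺ q × (c , r) ≢ q) ps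

  -- `source-≡` is followed back from the corner: it drops a row or a column, or it accounts for the
  -- weight of a cell, which is put in front of the chain.
  extend : ∀ x y → ∀ ps → Chn ps → Room x y ps →
    ∃ λ ps′ → Chn ps′ × S m x y + totalWeight w m ps ≤ totalWeight w m ps′
  extend zero    y       ps C ok = ps , C , ≤-refl
  extend (suc x) zero    ps C ok = ps , C , ≤-refl
  extend (suc x) (suc y) ps C ok with source-≡ (loc v x y)
  ... | inj₁ e rewrite e = extend (suc x) y ps C (λ c r i j → ok c r i (m<n⇒m<1+n j))
  ... | inj₂ (inj₁ e) rewrite e = extend x (suc y) ps C (λ c r i j → ok c r (m<n⇒m<1+n i) j)
  ... | inj₂ (inj₂ (m>0 , s , is , e)) rewrite e = bySource s is
    where
    C′ : Chn ((x , y) ∷ ps)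
    C′ = let a , q = ok x y ≤-refl ≤-refl ; points as ns us ls = C in
      points (a ∷ as) (m>0 ∷ ns) (All.map proj₂ q ∷ us) (linked-cons (All.map proj₁ q) ls)
    done : ∀ {u} → (∃ λ ps′ → Chn ps′ × u + totalWeight w m ((x , y) ∷ ps) ≤ totalWeight w m ps′) →
      ∃ λ ps′ → Chn ps′ × (u + weight w (m x y)) + totalWeight w m ps ≤ totalWeight w m ps′
    done {u} (ps′ , C″ , i) = ps′ , C″ , ≤-trans (≤-reflexive (+-assoc u _ _)) i
    room : ∀ {a b} → a ≤ suc x → b ≤ suc y →
      (∀ c r → c < a → r < b → (c , r) ≺ (x , y) × (c , r) ≢ (x , y)) → Room a b ((x , y) ∷ ps)
    room i j k c r i′ j′ = let p , q = ok c r (<-≤-trans i′ i) (<-≤-trans j′ j) in p , k c r i′ j′ ∷ q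
    weak-h : ∀ {f g} → IsSource f g se′ → ∀ {c} → c < suc x → Le f c x
    weak-h {weak} _ i = s≤s⁻¹ i
    weak-h {strict} {weak}   ()
    weak-h {strict} {strict} ()
    weak-v : ∀ f {g} → IsSource f g nw → ∀ {r} → r < suc y → Le g r y
    weak-v weak   {weak} _ i = s≤s⁻¹ i
    weak-v strict {weak} _ i = s≤s⁻¹ i
    bySource : ∀ s → IsSource hf vf s →
      ∃ λ ps′ → Chn ps′ × (source s (S m x y) (S m (suc x) y) (S m x (suc y)) + weight w (m x y)) + totalWeight w m ps
                          ≤ totalWeight w m ps′
    bySource sw  is = done (extend x y ((x , y) ∷ ps) C′ (room (n≤1+n x) (n≤1+n y)
      λ c r i j → (<⇒Le hf i , <⇒Le vf j) , λ { refl → <-irrefl refl i }))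
    bySource se′ is = done (extend (suc x) y ((x , y) ∷ ps) C′ (room ≤-refl (n≤1+n y)
      λ c r i j → (weak-h {hf} {vf} is i , <⇒Le vf j) , λ { refl → <-irrefl refl j }))
    bySource nw  is = done (extend x (suc y) ((x , y) ∷ ps) C′ (room (n≤1+n x) ≤-refl
      λ c r i j → (<⇒Le hf i , weak-v hf {vf} is j) , λ { refl → <-irrefl refl i }))

-- Chains of the second kind

InRect : (X Y : ℕ) → Point → Set
InRect X Y (c , r) = c < X × r < Y

record Chain-in (X Y : ℕ) (m : Grid) (_~_ : Point → Point → Set) (ps : List Point) : Set where
  constructor chain-in
  field
    inRect  : All (InRect X Y) ps
    nonzero : All (λ (c , r) → 0 < m c r) ps
    unique  : Unique ps
    linked  : Linked _~_ ps

record DownChains {R : Rule} (ST : SecondStat R) : Set where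
  open Growth R
  open SecondStat ST
  field
    Has⁺ : ∀ {X Y m ps} → Chain-in X Y m (Down hf vf) ps →
           Has m (totalWeight (isWeighted (dual hf) (dual vf)) m ps) X Y
    Has⁻ : ∀ {X Y m L} → Has m L X Y → ∃ λ ps → Chain-in X Y m (Down hf vf) ps ×
           L ≤ totalWeight (isWeighted (dual hf) (dual vf)) m ps

Starts : ℕ → ℕ → List Point → Set
Starts x y []            = ⊤
Starts x y ((c , r) ∷ _) = x ≤ c × r < y

nextCol⁺ : ∀ f {c c′} → Le (dual f) c c′ → nextCol f c ≤ c′
nextCol⁺ weak   i = i
nextCol⁺ strict i = i

nextCol⁻ : ∀ f {c c′} → nextCol f c ≤ c′ → Le (dual f) c c′
nextCol⁻ weak   i = i
nextCol⁻ strict i = i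

nextRow⁺ : ∀ g {r r′} → Le (dual g) r′ r → r′ < nextRow g r
nextRow⁺ weak   i = i
nextRow⁺ strict i = s≤s i

nextRow⁻ : ∀ g {r r′} → r′ < nextRow g r → Le (dual g) r′ r
nextRow⁻ weak   i = i
nextRow⁻ strict i = s≤s⁻¹ i

module _ (f g : Flag) {m : Grid} {X : ℕ} where

  toChain : ∀ {x y Y ps} → Chain-in X Y m (Down f g) ps → Starts x y ps → Chain f g m X (totalWeight false m ps) x y
  toChain {ps = []} _ _ = []
  toChain {ps = (c , r) ∷ ps} (chain-in ((a , _) ∷ as) (n ∷ ns) (_ ∷ us) ls) (i , j) with m c r in eq | n
  ... | suc _ | _ = cons c r i a j (subst (0 <_) (sym eq) z<s)
        (toChain (chain-in as ns us (Linked.tail ls)) (starts ls))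
    where
    starts : ∀ {ps} → Linked (Down f g) ((c , r) ∷ ps) → Starts (nextCol f c) (nextRow g r) ps
    starts [-] = tt
    starts ((k , l) ∷ _) = nextCol⁺ f k , nextRow⁺ g l

  fromChain : (f ≡ strict → g ≡ strict → ⊥) → ∀ {L x y Y} → y ≤ Y → Chain f g m X L x y →
    ∃ λ ps → Chain-in X Y m (Down f g) ps × L ≤ totalWeight false m ps ×
             All (λ (c , r) → x ≤ c × r < y) ps
  fromChain ns k [] = [] , chain-in [] [] [] [] , z≤n , []
  fromChain ns {Y = Y} k (cons {L} {x} {y} c r a b d e ch) with fromChain ns {Y = nextRow g r} ≤-refl ch
  ... | ps , chain-in as nz us ls , i , bs = (c , r) ∷ ps ,
    chain-in ((b , <-≤-trans d k) ∷ All.map (λ (u , v) → u , <-≤-trans v (≤-trans (next≤ g) (≤-trans d k))) as) (e ∷ nz)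
      (All.map (λ { (u , v) refl → contra f refl g refl u v }) bs ∷ us)
      (linked-cons (All.map (λ (u , v) → nextCol⁻ f u , nextRow⁻ g v) bs) ls) ,
    lower , (a , d) ∷ All.map (λ (u , v) → ≤-trans a (≤-trans (≤nextCol f c) u) , <-≤-trans v (≤-trans (next≤ g) d)) bs
    where
    next≤ : ∀ g → nextRow g r ≤ suc r
    next≤ weak   = n≤1+n r
    next≤ strict = ≤-refl
    lower : suc L ≤ totalWeight false m ((c , r) ∷ ps)
    lower = +-mono-≤ (weight>0 false e) i
    -- Y is strict where X is weak, so a later cell could repeat an earlier one only if both flags
    -- were `strict`.
    contra : ∀ f′ → f ≡ f′ → ∀ g′ → g ≡ g′ → nextCol f c ≤ c → r < nextRow g r → ⊥
    contra weak   refl _      _    u v = <-irrefl refl u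
    contra strict refl weak   refl u v = <-irrefl refl v
    contra strict e₁   strict e₂   u v = ns e₁ e₂

chainStat-down : ∀ {R} (B : Propagation R) → DownChains (chainStat B)
chainStat-down {R} B = record
  { Has⁺ = λ {X} {Y} {m} {ps} C → subst (λ w → Chain hf vf m X (totalWeight w m ps) 0 Y) (sym unweighted)
      (toChain hf vf C (starts C))
  ; Has⁻ = λ {X} {Y} {m} {L} C → let ps , D , i , _ = fromChain hf vf not-strict ≤-refl C in
      ps , D , subst (λ w → L ≤ totalWeight w m ps) (sym unweighted) i }
  where
  open Growth R
  open Propagation B
  unweighted : isWeighted (dual hf) (dual vf) ≡ false
  unweighted = go hf vf not-strict
    where
    go : ∀ f g → (f ≡ strict → g ≡ strict → ⊥) → isWeighted (dual f) (dual g) ≡ false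
    go weak   _      _ = refl
    go strict weak   _ = refl
    go strict strict n = ⊥-elim (n refl refl)
  starts : ∀ {X Y m ps} → Chain-in X Y m (Down hf vf) ps → Starts 0 Y ps
  starts {ps = []} _ = tt
  starts {ps = _ ∷ _} (chain-in ((_ , i) ∷ _) _ _ _) = z≤n , i

module _ {m : Grid} {X : ℕ} where

  maxPath-unfold : ∀ {c} r → c < X →
    maxPath m X (X ∸ c) (suc r) ≡ m c r + (maxPath m X (X ∸ suc c) (suc r) ⊔ maxPath m X (X ∸ c) r)
  maxPath-unfold {c} r i = go (X ∸ c) (+-∸-assoc 1 i)
    where
    go : ∀ d → d ≡ suc (X ∸ suc c) →
      maxPath m X d (suc r) ≡ m c r + (maxPath m X (X ∸ suc c) (suc r) ⊔ maxPath m X d r)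
    go _ refl = cong (λ z → m z r + (maxPath m X (X ∸ suc c) (suc r) ⊔ maxPath m X (suc (X ∸ suc c)) r))
      (trans (cong (X ∸_) (sym (+-∸-assoc 1 i))) (m∸[m∸n]≡n (<⇒≤ i)))

  -- The next cell of an SE-chain, being distinct, lies in a further column or in a lower row, so it
  -- is within reach of a path that goes on to the right or down.
  toPath : ∀ {c r Y} ps → Chain-in X Y m (Down strict strict) ((c , r) ∷ ps) →
    totalWeight true m ((c , r) ∷ ps) ≤ maxPath m X (X ∸ c) (suc r)
  toPath {c} {r} ps (chain-in ((a , _) ∷ as) (_ ∷ ns) (u ∷ us) ls) rewrite maxPath-unfold r a =
    +-monoʳ-≤ (m c r) (rest ps as ns u us ls)
    where
    rest : ∀ ps → All (InRect X _) ps → All (λ (c , r) → 0 < m c r) ps → All ((c , r) ≢_) ps → Unique ps →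
      Linked (Down strict strict) ((c , r) ∷ ps) →
      totalWeight true m ps ≤ maxPath m X (X ∸ suc c) (suc r) ⊔ maxPath m X (X ∸ c) r
    rest [] _ _ _ _ _ = z≤n
    rest ((c₁ , r₁) ∷ ps) as ns (ne ∷ _) us ((i , j) ∷ ls) = ≤-trans (toPath ps (chain-in as ns us ls)) turn
      where
      turn : maxPath m X (X ∸ c₁) (suc r₁) ≤ maxPath m X (X ∸ suc c) (suc r) ⊔ maxPath m X (X ∸ c) r
      turn with m≤n⇒m<n∨m≡n i | m≤n⇒m<n∨m≡n j
      ... | inj₁ i< | _ = ≤-trans (maxPath-mono m X (∸-monoʳ-≤ X i<) (s≤s j)) (m≤m⊔n _ _)
      ... | inj₂ refl | inj₁ j< = ≤-trans (maxPath-mono m X {X ∸ c} ≤-refl j<) (m≤n⊔m (maxPath m X (X ∸ suc c) (suc r)) _)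
      ... | inj₂ refl | inj₂ refl = ⊥-elim (ne refl)

  -- The nonzero cells of a best path form an SE-chain; zero entries add nothing to its weight and
  -- are skipped, as a chain may not contain them.
  fromPath : ∀ d y → d ≤ X → ∃ λ ps → Chain-in X y m (Down strict strict) ps ×
    maxPath m X d y ≤ totalWeight true m ps × All (λ (c , r) → X ∸ d ≤ c) ps
  fromPath zero    y    _ = [] , chain-in [] [] [] [] , z≤n , []
  fromPath (suc d) zero _ = [] , chain-in [] [] [] [] , z≤n , []
  fromPath (suc d) (suc y) d<X =
    add (m c y) refl (branch (⊔-sel (maxPath m X d (suc y)) (maxPath m X (suc d) y)))
    where
    c = X ∸ suc d
    W = maxPath m X d (suc y) ⊔ maxPath m X (suc d) y
    sc≡ : X ∸ d ≡ suc c
    sc≡ = +-∸-assoc 1 d<X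
    Branch : Set
    Branch = ∃ λ ps → Chain-in X (suc y) m (Down strict strict) ps × W ≤ totalWeight true m ps ×
      All (λ (c′ , r) → (c ≤ c′ × r ≤ y) × (c , y) ≢ (c′ , r)) ps
    branch : W ≡ maxPath m X d (suc y) ⊎ W ≡ maxPath m X (suc d) y → Branch
    branch (inj₁ e) = let ps , C , i , b = fromPath d (suc y) (<⇒≤ d<X) in
      ps , C , ≤-trans (≤-reflexive e) i ,
      All.zipWith (λ { {c′ , r} (u , _ , v) → let u′ = ≤-trans (≤-reflexive (sym sc≡)) u in
        (<⇒≤ u′ , s≤s⁻¹ v) , λ { refl → <-irrefl refl u′ } }) (b , Chain-in.inRect C)
    branch (inj₂ e) = let ps , chain-in as ns us ls , i , b = fromPath (suc d) y d<X in
      ps , chain-in (All.map (λ (u , v) → u , m<n⇒m<1+n v) as) ns us ls , ≤-trans (≤-reflexive e) i ,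
      All.zipWith (λ { (u , _ , v) → (u , <⇒≤ v) , λ { refl → <-irrefl refl v } }) (b , as)
    Goal : ℕ → Set
    Goal k = ∃ λ ps → Chain-in X (suc y) m (Down strict strict) ps ×
      k + W ≤ totalWeight true m ps × All (λ (c′ , r) → c ≤ c′) ps
    add : ∀ k → m c y ≡ k → Branch → Goal (m c y)
    add zero e (ps , C , i , b) = ps , C , ≤-trans (≤-reflexive (cong (_+ W) e)) i , All.map (λ x → proj₁ (proj₁ x)) b
    add (suc _) e (ps , chain-in as ns us ls , i , b) = (c , y) ∷ ps ,
      chain-in ((≤-trans (≤-reflexive (sym sc≡)) (m∸n≤m X d) , ≤-refl) ∷ as) (subst (0 <_) (sym e) z<s ∷ ns)
        (All.map proj₂ b ∷ us) (linked-cons (All.map proj₁ b) ls) ,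
      +-monoʳ-≤ (m c y) i , ≤-refl ∷ All.map (λ x → proj₁ (proj₁ x)) b

pathStat-down : DownChains pathStat
pathStat-down = record
  { Has⁺ = has
  ; Has⁻ = λ {X} {Y} {m} {L} i → let ps , C , j , _ = fromPath X Y ≤-refl in ps , C , ≤-trans i j }
  where
  has : ∀ {X Y m ps} → Chain-in X Y m (Down strict strict) ps → totalWeight true m ps ≤ maxPath m X X Y
  has {ps = []} _ = z≤n
  has {X} {m = m} {(c , r) ∷ ps} C@(chain-in ((_ , i) ∷ _) _ _ _) =
    ≤-trans (toPath ps C) (maxPath-mono m X (m∸n≤m X c) i)

-- Longest chains and shapes

lastPoint : Point → List Point → Point
lastPoint p []       = p
lastPoint p (q ∷ ps) = lastPoint q ps

last-map : ∀ p ps → last (map shift⁺ (p ∷ ps)) ≡ just (shift⁺ (lastPoint p ps))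
last-map p []       = refl
last-map p (q ∷ ps) = last-map q ps

rectIn-≡ : ∀ hs c₁ r₁ cs c₂ r₂ → last ((c₁ , r₁) ∷ cs) ≡ just (c₂ , r₂) → rectIn hs ((c₁ , r₁) ∷ cs) ≡
  all (λ c → all (λ r → inF hs (c , r)) (range (r₁ ⊓ r₂) (r₁ ⊔ r₂))) (range (c₁ ⊓ c₂) (c₁ ⊔ c₂))
rectIn-≡ hs c₁ r₁ cs c₂ r₂ e rewrite e = refl

lastPoint-∈ : ∀ p ps {P : Point → Set} → All P (p ∷ ps) → P (lastPoint p ps)
lastPoint-∈ p []       (x ∷ _)  = x
lastPoint-∈ p (q ∷ ps) (_ ∷ xs) = lastPoint-∈ q ps xs

-- For a chain going down to the right, the north-east corner of the enclosing rectangle is in the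
-- column of the last cell and the row of the first. In a Ferrers shape this corner decides whether
-- the rectangle is contained.
rectIn⁻ : ∀ hs c r ps → T (rectIn hs (map shift⁺ ((c , r) ∷ ps))) → InShape hs (proj₁ (lastPoint (c , r) ps) , r)
rectIn⁻ hs c r ps i with lastPoint (c , r) ps | last-map (c , r) ps
... | c₂ , r₂ | e rewrite rectIn-≡ hs (suc c) (suc r) (map shift⁺ ps) (suc c₂) (suc r₂) e
  with inF⁻ hs (suc c₂ , suc r)
    (All.lookup (all⁺ (λ r → inF hs (suc c₂ , r)) _
      (All.lookup (all⁺ (λ c → all (λ r → inF hs (c , r)) (range (suc r ⊓ suc r₂) (suc r ⊔ suc r₂))) _ i)
        (∈-range (m⊓n≤n (suc c) (suc c₂)) (m≤n⊔m (suc c) (suc c₂)))))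
      (∈-range (m⊓n≤m (suc r) (suc r₂)) (m≤m⊔n (suc r) (suc r₂))))
... | _ , refl , k = k

module _ (hs : Shape) (anti : ∀ x → heights hs (suc x) ≤ heights hs x) where

  heights-anti : ∀ {x x′} → x ≤ x′ → heights hs x′ ≤ heights hs x
  heights-anti {x} {zero} z≤n = ≤-refl
  heights-anti {x} {suc x′} i with m≤n⇒m<n∨m≡n i
  ... | inj₁ (s≤s i′) = ≤-trans (anti x′) (heights-anti i′)
  ... | inj₂ refl = ≤-refl

  InShape-down : ∀ {c r C R} → InShape hs (C , R) → c ≤ C → r ≤ R → InShape hs (c , r)
  InShape-down k i j = ≤-<-trans j (<-≤-trans k (heights-anti i))

  rectIn⁺ : ∀ C R ps → InShape hs (C , R) → All (InRect (suc C) (suc R)) ps → T (rectIn hs (map shift⁺ ps))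
  rectIn⁺ C R [] _ _ = tt
  rectIn⁺ C R ((c , r) ∷ ps) k as@((i , j) ∷ _) with lastPoint (c , r) ps | last-map (c , r) ps | lastPoint-∈ (c , r) ps as
  ... | c₂ , r₂ | e | i₂ , j₂ rewrite rectIn-≡ hs (suc c) (suc r) (map shift⁺ ps) (suc c₂) (suc r₂) e =
    all⁻ _ (All.tabulate λ {c′} c′∈ → all⁻ _ (All.tabulate λ {r′} r′∈ → cell (range-∈ c′∈) (range-∈ r′∈)))
    where
    cell : ∀ {c′ r′} → suc (c ⊓ c₂) ≤ c′ × c′ ≤ suc (c ⊔ c₂) → suc (r ⊓ r₂) ≤ r′ × r′ ≤ suc (r ⊔ r₂) → T (inF hs (c′ , r′))
    cell {suc c′} {suc r′} (_ , a) (_ , b) = inF⁺ hs (c′ , r′) (InShape-down k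
      (≤-trans (s≤s⁻¹ a) (⊔-lub (s≤s⁻¹ i) (s≤s⁻¹ i₂))) (≤-trans (s≤s⁻¹ b) (⊔-lub (s≤s⁻¹ j) (s≤s⁻¹ j₂))))

  module Longest (R : Rule) {ST : SecondStat R} (DC : DownChains ST) (f : Filling) (v : Growth.Valid R (grid f)) where
    open Growth R
    open SecondStat ST
    open DownChains DC
    open UpChains R hs v
    private
      m = grid f
      module UD = Decode (upKind hf vf) hs f (Up hf vf) (upRel⁻ hf vf) (upRel⁺ hf vf)
      module DD = Decode (downKind hf vf) hs f (Down hf vf) (downRel⁻ hf vf) (downRel⁺ hf vf)

    up⁻ : ∀ L → suc L ≤ longest (upKind hf vf) hs f → ∃₂ λ c r → InShape hs (c , r) × suc L ≤ S m (suc c) (suc r)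
    up⁻ L i = let ps , P , _ , j = UD.longest⁻ L i in chain-≤ L ps P j

    up⁺ : ∀ c r → InShape hs (c , r) → S m (suc c) (suc r) ≤ longest (upKind hf vf) hs f
    up⁺ c r i = let ps , P , j = extend (suc c) (suc r) [] (points [] [] [] [])
                                   (λ c′ r′ a b → InShape-down i (s≤s⁻¹ a) (s≤s⁻¹ b) , []) in
      ≤-trans (≤-trans (m≤m+n _ 0) j) (UD.longest⁺ ps P tt)

    layer-mono : ∀ {L L′} x y → L ≤ L′ → S (layer L′ m) x y ≤ S (layer L m) x y
    layer-mono {L} {zero} x y z≤n = ≤-refl
    layer-mono {L} {suc L′} x y i with m≤n⇒m<n∨m≡n i
    ... | inj₂ refl = ≤-refl
    ... | inj₁ (s≤s i′) rewrite layer-suc L′ m = ≤-trans (S-peel-≤ (layer-valid L′ v) x y) (layer-mono x y i′)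

    down⁻ : ∀ L → suc L ≤ longest (downKind hf vf) hs f →
      ∃₂ λ c r → InShape hs (c , r) × 0 < S (layer L m) (suc c) (suc r)
    down⁻ L i with DD.longest⁻ L i
    ... | ((c , r) ∷ ps) , points as ns us ls , rect , j = C , r , rectIn⁻ hs c r ps rect , pos _ j has
      where
      C = proj₁ (lastPoint (c , r) ps)
      cols : ∀ p ps → Linked (Down hf vf) (p ∷ ps) → All (λ q → proj₁ q ≤ proj₁ (lastPoint p ps)) (p ∷ ps)
      cols p [] _ = ≤-refl ∷ []
      cols p (q ∷ ps) (k ∷ ls) = let xs = cols q ps ls in
        ≤-trans (Le⇒≤ (dual hf) (proj₁ k)) (All.head xs) ∷ xs
      rows : ∀ p ps {R} → proj₂ p ≤ R → Linked (Down hf vf) (p ∷ ps) → All (λ q → proj₂ q ≤ R) (p ∷ ps)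
      rows p [] x _ = x ∷ []
      rows p (q ∷ ps) x (k ∷ ls) = x ∷ rows q ps (≤-trans (Le⇒≤ (dual vf) (proj₂ k)) x) ls
      has : Has m (totalWeight (isWeighted (dual hf) (dual vf)) m ((c , r) ∷ ps)) (suc C) (suc r)
      has = Has⁺ (chain-in (All.zipWith (λ (a , b) → s≤s a , s≤s b) (cols (c , r) ps ls , rows (c , r) ps ≤-refl ls)) ns us ls)
      -- The chain found may be longer than `suc L`; `layer-mono` leads back to layer `L`.
      pos : ∀ w → suc L ≤ w → Has m w (suc C) (suc r) → 0 < S (layer L m) (suc C) (suc r)
      pos (suc w) (s≤s k) h = <-≤-trans (Has⇒layer w v h) (layer-mono (suc C) (suc r) k)

    down⁺ : ∀ L c r → InShape hs (c , r) → 0 < S (layer L m) (suc c) (suc r) → suc L ≤ longest (downKind hf vf) hs f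
    down⁺ L c r i k = let ps , chain-in as ns us ls , j = Has⁻ (layer⇒Has L v k) in
      ≤-trans j (DD.longest⁺ ps
        (points (All.map (λ (a , b) → InShape-down i (s≤s⁻¹ a) (s≤s⁻¹ b)) as) ns us ls) (rectIn⁺ c r ps i as))

-- Enumeration of fillings

concatMap-unique : ∀ {A B : Set} (g : A → List B) (key : B → A) {xs} → (∀ {x y} → y ∈ g x → key y ≡ x) →
  Unique xs → (∀ x → Unique (g x)) → Unique (concatMap g xs)
concatMap-unique g key k u ug = Unique.concat⁺ (All-map⁺ (All.tabulate (λ {x} _ → ug x)))
  (AllPairs.map⁺ (AllPairs.map disjoint u))
  where
  disjoint : ∀ {x x′} → x ≢ x′ → Disjoint (g x) (g x′)
  disjoint ne (i , j) = ne (trans (sym (k i)) (k j))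

∈-concatMap : ∀ {A B : Set} (g : A → List B) {x xs y} → x ∈ xs → y ∈ g x → y ∈ concatMap g xs
∈-concatMap g x∈ y∈ = ∈-concatMap⁺ g (Any.map (λ { refl → y∈ }) x∈)

concatMap-∈ : ∀ {A B : Set} (g : A → List B) {xs y} → y ∈ concatMap g xs → ∃ λ x → x ∈ xs × y ∈ g x
concatMap-∈ g {xs} i = find (∈-concatMap⁻ g {xs} i)

comps⁻ : ∀ k n {col} → col ∈ comps k n → length col ≡ k × sum col ≡ n
comps⁻ zero zero (here refl) = refl , refl
comps⁻ (suc k) n i with concatMap-∈ (λ a → map (a ∷_) (comps k (n ∸ a))) {upTo (suc n)} i
... | a , a∈ , j with ∈-map⁻ (a ∷_) j
... | col , col∈ , refl = let l , s = comps⁻ k (n ∸ a) col∈ in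
  cong suc l , trans (cong (a +_) s) (m+[n∸m]≡n (s≤s⁻¹ (∈-upTo⁻ a∈)))

comps⁺ : ∀ k n col → length col ≡ k → sum col ≡ n → col ∈ comps k n
comps⁺ zero n [] refl refl = here refl
comps⁺ (suc k) n (a ∷ col) refl refl = ∈-concatMap (λ a → map (a ∷_) (comps k (n ∸ a)))
  (∈-upTo⁺ (s≤s (m≤m+n a (sum col)))) (∈-map⁺ (a ∷_) (comps⁺ k _ col refl (sym (m+n∸m≡n a (sum col)))))

head₀ : List ℕ → ℕ
head₀ []      = 0
head₀ (a ∷ _) = a

headColumn : Filling → List ℕ
headColumn []        = []
headColumn (col ∷ _) = col

comps-unique : ∀ k n → Unique (comps k n)
comps-unique zero zero    = [] ∷ []
comps-unique zero (suc n) = []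
comps-unique (suc k) n = concatMap-unique (λ a → map (a ∷_) (comps k (n ∸ a))) head₀
  (λ {a} i → let _ , _ , e = ∈-map⁻ (a ∷_) i in cong head₀ e)
  (Unique.upTo⁺ (suc n)) (λ a → Unique.map⁺ (λ { refl → refl }) (comps-unique k (n ∸ a)))

FillingOf : Shape → Filling → Set
FillingOf = Pointwise (λ h col → length col ≡ h)

fillings⁻ : ∀ hs n {f} → f ∈ fillings hs n → FillingOf hs f × sum (map sum f) ≡ n
fillings⁻ [] zero (here refl) = [] , refl
fillings⁻ (h ∷ hs) n i with concatMap-∈ (λ a → concatMap (λ col → map (col ∷_) (fillings hs (n ∸ a))) (comps h a)) {upTo (suc n)} i
... | a , a∈ , j with concatMap-∈ (λ col → map (col ∷_) (fillings hs (n ∸ a))) {comps h a} j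
... | col , col∈ , k with ∈-map⁻ (col ∷_) k
... | f , f∈ , refl = let l , s = comps⁻ h a col∈ ; p , t = fillings⁻ hs (n ∸ a) f∈ in
  l ∷ p , trans (cong₂ _+_ s t) (m+[n∸m]≡n (s≤s⁻¹ (∈-upTo⁻ a∈)))

fillings⁺ : ∀ hs n {f} → FillingOf hs f → sum (map sum f) ≡ n → f ∈ fillings hs n
fillings⁺ [] _ [] refl = here refl
fillings⁺ (h ∷ hs) n {col ∷ f} (l ∷ p) refl =
  ∈-concatMap (λ a → concatMap (λ col → map (col ∷_) (fillings hs (n ∸ a))) (comps h a))
    (∈-upTo⁺ (s≤s (m≤m+n (sum col) _)))
    (∈-concatMap (λ c → map (c ∷_) (fillings hs (n ∸ sum col))) (comps⁺ h (sum col) col l refl)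
      (∈-map⁺ (col ∷_) (fillings⁺ hs _ p (sym (m+n∸m≡n (sum col) _)))))

fillings-unique : ∀ hs n → Unique (fillings hs n)
fillings-unique [] zero    = [] ∷ []
fillings-unique [] (suc n) = []
fillings-unique (h ∷ hs) n = concatMap-unique (λ a → concatMap (λ col → map (col ∷_) (fillings hs (n ∸ a))) (comps h a))
  (sum ∘ headColumn) key (Unique.upTo⁺ (suc n)) λ a →
  concatMap-unique (λ col → map (col ∷_) (fillings hs (n ∸ a))) headColumn
    (λ {col} i → let _ , _ , e = ∈-map⁻ (col ∷_) i in cong headColumn e)
    (comps-unique h a) (λ col → Unique.map⁺ (λ { refl → refl }) (fillings-unique hs (n ∸ a)))
  where
  key : ∀ {a f} → f ∈ concatMap (λ col → map (col ∷_) (fillings hs (n ∸ a))) (comps h a) → sum (headColumn f) ≡ a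
  key {a} i with concatMap-∈ (λ col → map (col ∷_) (fillings hs (n ∸ a))) {comps h a} i
  ... | col , col∈ , k with ∈-map⁻ (col ∷_) k
  ... | _ , _ , refl = proj₂ (comps⁻ h a col∈)

-- Fillings and grids

toFilling : Shape → Grid → Filling
toFilling []       m = []
toFilling (h ∷ hs) m = applyUpTo (m 0) h ∷ toFilling hs (m ∘ suc)

toFilling-shape : ∀ hs m → FillingOf hs (toFilling hs m)
toFilling-shape []       m = []
toFilling-shape (h ∷ hs) m = length-applyUpTo (m 0) h ∷ toFilling-shape hs (m ∘ suc)

nth-applyUpTo : ∀ (g : ℕ → ℕ) h {y} → y < h → nth (applyUpTo g h) y 0 ≡ g y
nth-applyUpTo g (suc h) {zero}  _ = refl
nth-applyUpTo g (suc h) {suc y} i = nth-applyUpTo (g ∘ suc) h (s≤s⁻¹ i)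

grid-toFilling : ∀ hs m x y → y < heights hs x → grid (toFilling hs m) x y ≡ m x y
grid-toFilling (h ∷ hs) m zero    y i = nth-applyUpTo (m 0) h i
grid-toFilling (h ∷ hs) m (suc x) y i = grid-toFilling hs (m ∘ suc) x y i

toFilling-grid : ∀ hs m {f} → FillingOf hs f → (∀ x y → y < heights hs x → m x y ≡ grid f x y) → toFilling hs m ≡ f
toFilling-grid []       m []      e = refl
toFilling-grid (h ∷ hs) m (l ∷ p) e = cong₂ _∷_ (column (m 0) l (e 0)) (toFilling-grid hs (m ∘ suc) p (e ∘ suc))
  where
  column : ∀ (g : ℕ → ℕ) {h col} → length col ≡ h → (∀ y → y < h → g y ≡ nth col y 0) → applyUpTo g h ≡ col
  column g {col = []}     refl e = refl
  column g {col = a ∷ col} refl e = cong₂ _∷_ (e 0 z<s) (column (g ∘ suc) refl (λ y i → e (suc y) (s≤s i)))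

nth-All : ∀ {A : Set} {P : A → Set} {d} → P d → ∀ {xs} → All P xs → ∀ i → P (nth xs i d)
nth-All pd []       i       = pd
nth-All pd (p ∷ ps) zero    = p
nth-All pd (p ∷ ps) (suc i) = nth-All pd ps i

grid-All : ∀ {P : ℕ → Set} → P 0 → ∀ {f} → All (All P) f → ∀ x y → P (grid f x y)
grid-All p0 ps x y = nth-All p0 (nth-All [] ps x) y

toFilling-All : ∀ {P : ℕ → Set} hs m → (∀ x y → P (m x y)) → All (All P) (toFilling hs m)
toFilling-All []       m p = []
toFilling-All (h ∷ hs) m p = applyUpTo⁺₂ (m 0) h (p 0) ∷ toFilling-All hs (m ∘ suc) (p ∘ suc)

sumTo-snoc : ∀ n p → sumTo (suc n) p ≡ sumTo n p + p n
sumTo-snoc zero    p = +-identityʳ (p 0)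
sumTo-snoc (suc n) p = trans (cong (p 0 +_) (sumTo-snoc n (p ∘ suc))) (sym (+-assoc (p 0) _ _))

columnSum-sumTo : ∀ m x y → columnSum m x y ≡ sumTo y (m x)
columnSum-sumTo m x zero    = refl
columnSum-sumTo m x (suc y) = trans (cong (_+ m x y) (columnSum-sumTo m x y)) (sym (sumTo-snoc y (m x)))

total-sumTo : ∀ F m x → total F m x ≡ sumTo x (λ x → columnSum m x (Region.h F x))
total-sumTo F m zero    = refl
total-sumTo F m (suc x) = trans (cong (_+ columnSum m x (Region.h F x)) (total-sumTo F m x)) (sym (sumTo-snoc x (λ x → columnSum m x (Region.h F x))))

sum-nth : ∀ col → sum col ≡ sumTo (length col) (λ y → nth col y 0)
sum-nth []        = refl
sum-nth (a ∷ col) = cong (a +_) (sum-nth col)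

sum-grid : ∀ hs {f} → FillingOf hs f → sum (map sum f) ≡ sumTo (length hs) (λ x → columnSum (grid f) x (heights hs x))
sum-grid [] [] = refl
sum-grid (h ∷ hs) {col ∷ f} (refl ∷ p) = cong₂ _+_
  (trans (sum-nth col) (sym (columnSum-sumTo (grid (col ∷ f)) 0 (length col))))
  (trans (sum-grid hs p) (sumTo-cong (length hs) λ x → trans (columnSum-sumTo (grid f) x (heights hs x))
    (sym (columnSum-sumTo (grid (col ∷ f)) (suc x) (heights hs x)))))

unique-map : ∀ {A B : Set} {g : A → B} {g′ : B → A} {xs} → (∀ {x} → x ∈ xs → g′ (g x) ≡ x) → Unique xs → Unique (map g xs)
unique-map inv [] = []
unique-map {g = g} {g′} inv (x∉ ∷ u) =
  All-map⁺ (All.tabulate λ y∈ e → All.lookup x∉ y∈ (trans (sym (inv (here refl))) (trans (cong g′ e) (inv (there y∈))))) ∷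
  unique-map {g′ = g′} (inv ∘ there) u

≡ᵇ-subst : ∀ {a b s} → a ≡ b → T (a ≡ᵇ s) → T (b ≡ᵇ s)
≡ᵇ-subst refl i = i

-- The bijection between fillings

module Bijection (hs : Shape) (ferrers : IsFerrers hs) (n : ℕ) where

  anti : ∀ x → heights hs (suc x) ≤ heights hs x
  anti = go (proj₁ ferrers)
    where
    go : ∀ {hs} → Linked _≥_ hs → ∀ x → heights hs (suc x) ≤ heights hs x
    go []      x       = z≤n
    go [-]     zero    = z≤n
    go [-]     (suc x) = z≤n
    go (i ∷ l) zero    = i
    go (i ∷ l) (suc x) = go l x

  F : Region
  F = record
    { h = heights hs ; h-anti = anti ; bound = length hs + heights hs 0
    ; h-bound = λ x y i → +-mono-<-≤ (nth-≤length hs i) (≤-trans (<⇒≤ i) (heights-anti hs anti z≤n)) }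

  open Region F

  record Good (R : Rule) (f : Filling) : Set where
    constructor good
    field
      shaped  : FillingOf hs f
      summed  : sum (map sum f) ≡ n
      allowed : All (All (Rule.M R)) f

    valid : Growth.Valid R (grid f)
    valid = grid-All (Rule.M-0 R) allowed

    total-length : total F (grid f) (length hs) ≡ n
    total-length = trans (total-sumTo F (grid f) (length hs)) (trans (sym (sum-grid hs shaped)) summed)

    total-≤ : ∀ x → total F (grid f) x ≤ n
    total-≤ x = ≤-trans (bounded x) (≤-reflexive total-length)
      where
      beyond : ∀ x → length hs ≤ x → heights hs x ≡ 0
      beyond x i with heights hs x in eq
      ... | zero  = refl
      ... | suc _ = ⊥-elim (<⇒≱ (nth-≤length hs {x} {0} (subst (0 <_) (sym eq) z<s)) i)
      mono : ∀ {x x′} → x ≤ x′ → total F (grid f) x ≤ total F (grid f) x′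
      mono {x} {zero} z≤n = ≤-refl
      mono {x} {suc x′} i with m≤n⇒m<n∨m≡n i
      ... | inj₁ (s≤s i′) = ≤-trans (mono i′) (m≤m+n _ _)
      ... | inj₂ refl = ≤-refl
      past : ∀ k → total F (grid f) (k + length hs) ≤ total F (grid f) (length hs)
      past zero    = ≤-refl
      past (suc k) rewrite beyond (k + length hs) (m≤n+m _ k) | +-identityʳ (total F (grid f) (k + length hs)) = past k
      bounded : ∀ x → total F (grid f) x ≤ total F (grid f) (length hs)
      bounded x with ≤-total x (length hs)
      ... | inj₁ i = mono i
      ... | inj₂ i = subst (λ z → total F (grid f) z ≤ _) (m∸n+n≡m i) (past (x ∸ length hs))

  -- Diagonal steps end in a cell whose north-east corner is on the boundary. Since `S` is monotone,
  -- the longest chains are already visible at such corners, where the partitions of both fillings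
  -- can be compared.
  toBorder : ∀ x y → y < heights hs x →
    ∃₂ λ x′ y′ → x ≤ x′ × y ≤ y′ × y′ < heights hs x′ × Border (suc x′) (suc y′)
  toBorder = descend (λ x y → y < heights hs x → ∃₂ λ x′ y′ → x ≤ x′ × y ≤ y′ × y′ < heights hs x′ × Border (suc x′) (suc y′))
    (λ x y o i → ⊥-elim (<⇒≱ i o)) step
    where
    step : ∀ x y → y < heights hs x → _ → _ → (suc y < heights hs (suc x) →
      ∃₂ λ x′ y′ → suc x ≤ x′ × suc y ≤ y′ × y′ < heights hs x′ × Border (suc x′) (suc y′)) → y < heights hs x →
      ∃₂ λ x′ y′ → x ≤ x′ × y ≤ y′ × y′ < heights hs x′ × Border (suc x′) (suc y′)
    step x y i _ _ ih _ with suc y <? heights hs (suc x)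
    ... | yes j = let x′ , y′ , a , b , c = ih j in x′ , y′ , <⇒≤ a , <⇒≤ b , c
    ... | no ¬j = x , y , ≤-refl , ≤-refl , i , i , ≮⇒≥ ¬j

  image : (R₁ R₂ : Rule) → Dual R₁ R₂ → Filling → Filling
  image R₁ R₂ D f = toFilling hs (Transfer.Φ R₁ R₂ D F n (grid f))

  module _ {R₁ R₂ : Rule} (D : Dual R₁ R₂) {ST₁ : SecondStat R₁} (DC₁ : DownChains ST₁)
           {ST₂ : SecondStat R₂} (DC₂ : DownChains ST₂) {f : Filling} (gf : Good R₁ f) where
    open Good gf
    open Transfer R₁ R₂ D F n
    private
      module G₁ = Shape-Growth R₁ F
      module G₂ = Shape-Growth R₂ F
      module F₁ = Filled R₁ F n valid total-≤
      m  = grid f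
      f₂ = image R₁ R₂ D f
      m₂ = grid f₂

      m₂≐ : m₂ ≐ Φ m
      m₂≐ = grid-toFilling hs (Φ m)

      v₂ : G₂.Valid m₂
      v₂ = grid-All {G₂.M} G₂.M-0 (toFilling-All hs (Φ m) (Φ-valid valid total-≤))

    image-good : Good R₂ f₂
    image-good = good (toFilling-shape hs (Φ m)) sums (toFilling-All hs (Φ m) (Φ-valid valid total-≤))
      where
      columns : ∀ x → columnSum m₂ x (heights hs x) ≡ columnSum m x (heights hs x)
      columns x = trans (columnSum-cong (heights hs x) ≤-refl) (Φ-columnSum valid total-≤ x)
        where
        columnSum-cong : ∀ y → y ≤ heights hs x → columnSum m₂ x y ≡ columnSum (Φ m) x y
        columnSum-cong zero    _ = refl
        columnSum-cong (suc y) i = cong₂ _+_ (columnSum-cong y (<⇒≤ i)) (m₂≐ x y i)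
      sums : sum (map sum f₂) ≡ n
      sums = trans (sum-grid hs (toFilling-shape hs (Φ m)))
        (trans (sumTo-cong (length hs) columns) (trans (sym (sum-grid hs shaped)) summed))

    image-inverse : image R₂ R₁ (Dual-sym D) f₂ ≡ f
    image-inverse = toFilling-grid hs _ shaped (Φ-inverse valid total-≤ m₂≐)

    private
      module L₁ = Longest hs anti R₁ DC₁ f valid
      module L₂ = Longest hs anti R₂ DC₂ f₂ v₂

      π : ∀ x y → y < heights hs x → Partition n (F₁.shape (suc x) (suc y))
      π x y i = F₁.shape-partition (suc x) (suc y) i

      shape₂ : ∀ k x y → Border x y → G₂.S (G₂.layer k m₂) x y ≡ transpose n (F₁.shape x y) k
      shape₂ = Φ-shape valid total-≤ m₂≐

      onBorder₁ : ∀ k {a x y} → y < heights hs x → a ≤ G₁.S (G₁.layer k m) (suc x) (suc y) →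
        ∃₂ λ x y → y < heights hs x × Border (suc x) (suc y) × a ≤ F₁.shape (suc x) (suc y) k
      onBorder₁ k {a} {x} {y} i j = let x′ , y′ , p , q , i′ , b = toBorder x y i in
        x′ , y′ , i′ , b , ≤-trans j (G₁.S-mono (G₁.layer-valid k valid) (s≤s p) (s≤s q))

      onBorder₂ : ∀ k {a x y} → y < heights hs x → a ≤ G₂.S (G₂.layer k m₂) (suc x) (suc y) →
        ∃₂ λ x y → y < heights hs x × a ≤ transpose n (F₁.shape (suc x) (suc y)) k
      onBorder₂ k {a} {x} {y} i j = let x′ , y′ , p , q , i′ , b = toBorder x y i in
        x′ , y′ , i′ , ≤-trans (≤-trans j (G₂.S-mono (G₂.layer-valid k v₂) (s≤s p) (s≤s q)))
          (≤-reflexive (shape₂ k (suc x′) (suc y′) b))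

    private
      upLen₁ downLen₁ upLen₂ downLen₂ : ℕ
      upLen₁   = longest (upKind G₁.hf G₁.vf) hs f
      downLen₁ = longest (downKind G₁.hf G₁.vf) hs f
      upLen₂   = longest (upKind G₂.hf G₂.vf) hs f₂
      downLen₂ = longest (downKind G₂.hf G₂.vf) hs f₂

      OnBorder₁ OnBorder₂ : ℕ → ℕ → Set
      OnBorder₁ k a = ∃₂ λ x y → y < heights hs x × Border (suc x) (suc y) × a ≤ F₁.shape (suc x) (suc y) k
      OnBorder₂ k a = ∃₂ λ x y → y < heights hs x × a ≤ transpose n (F₁.shape (suc x) (suc y)) k

      upLen₁⁻ : ∀ L → L < upLen₁ → OnBorder₁ 0 (suc L)
      upLen₁⁻ L i = go (L₁.up⁻ L i)
        where
        go : (∃₂ λ c r → InShape hs (c , r) × suc L ≤ G₁.S m (suc c) (suc r)) → OnBorder₁ 0 (suc L)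
        go (c , r , k , j) = onBorder₁ 0 k j

      downLen₁⁻ : ∀ L → L < downLen₁ → OnBorder₁ L 1
      downLen₁⁻ L i = go (L₁.down⁻ L i)
        where
        go : (∃₂ λ c r → InShape hs (c , r) × 0 < G₁.S (G₁.layer L m) (suc c) (suc r)) → OnBorder₁ L 1
        go (c , r , k , j) = onBorder₁ L k j

      upLen₂⁻ : ∀ L → L < upLen₂ → OnBorder₂ 0 (suc L)
      upLen₂⁻ L i = go (L₂.up⁻ L i)
        where
        go : (∃₂ λ c r → InShape hs (c , r) × suc L ≤ G₂.S m₂ (suc c) (suc r)) → OnBorder₂ 0 (suc L)
        go (c , r , k , j) = onBorder₂ 0 k j

      downLen₂⁻ : ∀ L → L < downLen₂ → OnBorder₂ L 1
      downLen₂⁻ L i = go (L₂.down⁻ L i)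
        where
        go : (∃₂ λ c r → InShape hs (c , r) × 0 < G₂.S (G₂.layer L m₂) (suc c) (suc r)) → OnBorder₂ L 1
        go (c , r , k , j) = onBorder₂ L k j

      -- `L < p 0` amounts to `0 < transpose n p L`: the first part is the number of parts of the
      -- conjugate. The next three lemmas rest on the same exchange.
      upLen₁⇒downLen₂ : ∀ L → OnBorder₁ 0 (suc L) → L < downLen₂
      upLen₁⇒downLen₂ L (x , y , i , b , j) = L₂.down⁺ L x y i
        (≤-trans (Partition.to-transpose (π x y i) j) (≤-reflexive (sym (shape₂ L (suc x) (suc y) b))))

      downLen₂⇒upLen₁ : ∀ L → OnBorder₂ L 1 → L < upLen₁
      downLen₂⇒upLen₁ L (x , y , i , j) = ≤-trans (Partition.from-transpose (π x y i) j) (L₁.up⁺ x y i)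

      downLen₁⇒upLen₂ : ∀ L → OnBorder₁ L 1 → L < upLen₂
      downLen₁⇒upLen₂ L (x , y , i , b , j) = ≤-trans
        (≤-trans (Partition.to-transpose (π x y i) j) (≤-reflexive (sym (shape₂ 0 (suc x) (suc y) b)))) (L₂.up⁺ x y i)

      upLen₂⇒downLen₁ : ∀ L → OnBorder₂ 0 (suc L) → L < downLen₁
      upLen₂⇒downLen₁ L (x , y , i , j) = L₁.down⁺ L x y i (Partition.from-transpose (π x y i) j)

    image-down : longest (upKind G₁.hf G₁.vf) hs f ≡ longest (downKind G₂.hf G₂.vf) hs f₂
    image-down = ≤-antisym {upLen₁} {downLen₂}
      (≤-from-< λ L i → upLen₁⇒downLen₂ L (upLen₁⁻ L i)) (≤-from-< λ L i → downLen₂⇒upLen₁ L (downLen₂⁻ L i))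

    image-up : longest (downKind G₁.hf G₁.vf) hs f ≡ longest (upKind G₂.hf G₂.vf) hs f₂
    image-up = ≤-antisym {downLen₁} {upLen₂}
      (≤-from-< λ L i → downLen₁⇒upLen₂ L (downLen₁⁻ L i)) (≤-from-< λ L i → upLen₂⇒downLen₁ L (upLen₂⁻ L i))

  module _ {R₁ R₂ : Rule} (D : Dual R₁ R₂) {ST₁ : SecondStat R₁} (DC₁ : DownChains ST₁)
           {ST₂ : SecondStat R₂} (DC₂ : DownChains ST₂) (A : List Filling) (unique : Unique A)
           (good₁ : ∀ {f} → f ∈ A → Good R₁ f) (good₂ : ∀ {f} → Good R₂ f → f ∈ A) where

    -- `image` has a left inverse on the fillings counted, so it maps a list without repetitions to
    -- one without repetitions.
    count-≤ : (P Q : Filling → Bool) → (∀ {f} → Good R₁ f → T (P f) → T (Q (image R₁ R₂ D f))) →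
      length (filter (λ f → T? (P f)) A) ≤ length (filter (λ f → T? (Q f)) A)
    count-≤ P Q pres = ≤-trans (≤-reflexive (sym (length-map (image R₁ R₂ D) PA)))
      (unique-⊆⇒length-≤ (unique-map {g′ = image R₂ R₁ (Dual-sym D)} (λ i → image-inverse D DC₁ DC₂ (goodP i)) (Unique.filter⁺ (λ f → T? (P f)) unique)) sub)
      where
      PA = filter (λ f → T? (P f)) A
      goodP : ∀ {f} → f ∈ PA → Good R₁ f
      goodP i = good₁ (proj₁ (∈-filter⁻ (λ f → T? (P f)) {xs = A} i))
      sub : ∀ {g} → g ∈ map (image R₁ R₂ D) PA → g ∈ filter (λ f → T? (Q f)) A
      sub i with ∈-map⁻ (image R₁ R₂ D) i
      ... | f , f∈ , refl = ∈-filter⁺ (λ f → T? (Q f)) (good₂ (image-good D DC₁ DC₂ (goodP f∈)))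
              (pres (goodP f∈) (proj₂ (∈-filter⁻ (λ f → T? (P f)) {xs = A} f∈)))

    count-transfer-≤ : ∀ s t → let open Rule in
      length (filter (λ f → T? ((longest (upKind (hf R₁) (vf R₁)) hs f ≡ᵇ s) ∧ (longest (downKind (hf R₁) (vf R₁)) hs f ≡ᵇ t))) A) ≤
      length (filter (λ f → T? ((longest (upKind (hf R₂) (vf R₂)) hs f ≡ᵇ t) ∧ (longest (downKind (hf R₂) (vf R₂)) hs f ≡ᵇ s))) A)
    count-transfer-≤ s t = count-≤ _ _ λ {f} gf i →
      let a , b = ∧-to {longest (upKind (Rule.hf R₁) (Rule.vf R₁)) hs f ≡ᵇ s} i in
      ∧-from (≡ᵇ-subst (image-up D DC₁ DC₂ gf) b) (≡ᵇ-subst (image-down D DC₁ DC₂ gf) a)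

  -- Duality is symmetric: an injection in each direction gives both inequalities, and no
  -- surjectivity has to be shown.
  count-transfer : ∀ {R₁ R₂} (D : Dual R₁ R₂) {ST₁ : SecondStat R₁} → DownChains ST₁ → {ST₂ : SecondStat R₂} → DownChains ST₂ →
    ∀ A → Unique A → (∀ {f} → f ∈ A → Good R₁ f) → (∀ {f} → Good R₂ f → f ∈ A) → ∀ s t → let open Rule in
    length (filter (λ f → T? ((longest (upKind (hf R₁) (vf R₁)) hs f ≡ᵇ s) ∧ (longest (downKind (hf R₁) (vf R₁)) hs f ≡ᵇ t))) A) ≡
    length (filter (λ f → T? ((longest (upKind (hf R₂) (vf R₂)) hs f ≡ᵇ t) ∧ (longest (downKind (hf R₂) (vf R₂)) hs f ≡ᵇ s))) A)
  count-transfer {R₁} {R₂} D DC₁ DC₂ A u g₁ g₂ s t = ≤-antisym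
    (count-transfer-≤ D DC₁ DC₂ A u g₁ g₂ s t)
    (count-transfer-≤ (Dual-sym D) DC₂ DC₁ A u
      (λ i → let good a b c = g₁ i in good a b (All.map (All.map (Dual.M-dual D _)) c))
      (λ (good a b c) → g₂ (good a b (All.map (All.map (Dual.M-dual D _)) c))) t s)

theorem13 : (hs : Shape) → IsFerrers hs → (n s t : ℕ) → 1 ≤ s → 1 ≤ t →
    (Nstar hs n NE s se t ≡ Nstar hs n ne t SE s)
    × (N01 hs n nE s Se t ≡ N01 hs n Ne t sE s)
theorem13 hs ferrers n s t _ _ =
  count-transfer {rule₁} {rule₂} (record { hf-dual = refl ; vf-dual = refl ; M-dual = λ _ _ → tt ; M-dual′ = λ _ _ → tt })
    (chainStat-down propagation₁) pathStat-down (fillings hs n) (fillings-unique hs n)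
    (λ i → let p , e = fillings⁻ hs n i in good p e (All.tabulate λ _ → All.tabulate λ _ → tt))
    (λ (good p e _) → fillings⁺ hs n p e) s t ,
  count-transfer {rule₃} {rule₄} (record { hf-dual = refl ; vf-dual = refl ; M-dual = λ _ i → i ; M-dual′ = λ _ i → i })
    (chainStat-down propagation₃) (chainStat-down (flipPropagation propagation₃)) (fillings01 hs n)
    (Unique.filter⁺ (λ f → T? (all (all (_≤ᵇ 1)) f)) (fillings-unique hs n))
    (λ {f} i → let j , k = ∈-filter⁻ (λ f → T? (all (all (_≤ᵇ 1)) f)) {xs = fillings hs n} i ; p , e = fillings⁻ hs n j in
      good p e (All.map (λ {col} x → All.map (λ {a} → ≤ᵇ⇒≤ a 1) (all⁺ (_≤ᵇ 1) col x)) (all⁺ (all (_≤ᵇ 1)) f k)))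
    (λ (good p e c) → ∈-filter⁺ (λ f → T? (all (all (_≤ᵇ 1)) f)) (fillings⁺ hs n p e)
      (all⁻ (all (_≤ᵇ 1)) (All.map (λ x → all⁻ (_≤ᵇ 1) (All.map ≤⇒≤ᵇ x)) c))) s t
  where open Bijection hs ferrers n
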